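{- Let $s\ge 2$ and $k$ be integers. There exist constants $C(s,k)$ and $n_0(s,k)$, depending on $s,k$ only, such that the following holds for every integer $t\ge 1$ with $k\ge 2t+1$, every $n\ge n_0(s,k)$ and every real $\delta>0$. Let $\mathcal F\subset\binom{[n]}{k}$ be a family that does not contain a sunflower with $s$ petals and core of size exactly $t-1$, and suppose that $$|\mathcal F|\ge(1-\delta)\,\phi(s,t)\binom{n}{k-t}.$$ Then there exists a family $\mathcal T\subset\binom{[n]}{t}$ that does not contain a sunflower with $s$ petals (with any core) such that $$|\mathcal F\setminus\mathcal F[\mathcal T]|\le\Big(3k\,\phi(s,t)^2\,\delta+\frac{C(s,k)}{n}\Big)\,\phi(s,t)\binom{n-t}{k-t}.$$
   Context: $[n]=\{1,\dots,n\}$, and $\binom{X}{k}$ is the family of all $k$-element subsets of $X$. A family of $s$ (distinct) sets $\{F_1,\dots,F_s\}$ is a sunflower with $s$ petals if $F_i\cap F_j=\bigcap_{u=1}^s F_u$ for all distinct $i,j\in[s]$; the set $\bigcap_{u=1}^sF_u$ is its core. $\phi(s,t)$ denotes the maximum size of a family of $t$-element sets (on an arbitrary ground set) that does not contain a sunflower with $s$ petals (with arbitrary core). For families $\mathcal F,\mathcal B$, $\mathcal F[\mathcal B]=\{F\in\mathcal F : \exists B\in\mathcal B \text{ with } B\subset F\}$. -}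

module Defs where

open import Data.Bool.Properties using () renaming (_≟_ to _≟ᵇ_)
open import Data.Fin.Base using (Fin)
open import Data.Fin.Subset using (Subset; _∩_; ⋂; ∣_∣)
open import Data.Fin.Subset.Properties using (_⊆?_)
open import Data.Integer.Base using (+_)
open import Data.List.Base using (List; length; filter; tabulate)
open import Data.List.Membership.Propositional using (_∈_)
open import Data.List.Relation.Unary.All using (All)
open import Data.List.Relation.Unary.Any using (any?)
open import Data.List.Relation.Unary.Unique.Propositional using (Unique)
open import Data.Nat.Base as ℕ using (ℕ; NonZero)
import Data.Nat.Properties as ℕ
open import Data.Product using (∃-syntax; Σ-syntax; _×_; _,_)
open import Data.Rational.Base as ℚ using (ℚ; 0ℚ; 1ℚ; ½)
import Data.Rational.Properties as ℚ
import Data.Rational.Solver as ℚ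
import Data.Vec.Properties as Vec
open import Function.Definitions using (Injective)
open import Relation.Binary.PropositionalEquality
open import Relation.Nullary using (¬_)
open import Relation.Nullary.Decidable using (¬?)

------------------------------------------------------------------------
-- Real numbers: Cauchy sequences of rationals, added and multiplied
-- pointwise.  Two sequences denote the same real when each is ≤ᵣ the other.

IsCauchy : (ℕ → ℚ) → Set
IsCauchy a = ∀ ε → 0ℚ ℚ.< ε → ∃[ N ] ∀ m n → N ℕ.≤ m → N ℕ.≤ n →
             ℚ.∣ a m ℚ.- a n ∣ ℚ.< ε

record ℝ : Set where
  constructor mkℝ
  field
    seq    : ℕ → ℚ
    cauchy : IsCauchy seq

open ℝ public

infix  4 _≤ᵣ_ _<ᵣ_
infixl 6 _+ᵣ_ _-ᵣ_
infixl 7 _*ᵣ_ _/ᵣ_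

_≤ᵣ_ : ℝ → ℝ → Set
x ≤ᵣ y = ∀ ε → 0ℚ ℚ.< ε → ∃[ N ] ∀ m → N ℕ.≤ m → seq x m ℚ.≤ seq y m ℚ.+ ε

_<ᵣ_ : ℝ → ℝ → Set
x <ᵣ y = ∃[ ε ] 0ℚ ℚ.< ε × (∃[ N ] ∀ m → N ℕ.≤ m → seq x m ℚ.+ ε ℚ.≤ seq y m)

private
  half-pos : ∀ ε → 0ℚ ℚ.< ε → 0ℚ ℚ.< ½ ℚ.* ε
  half-pos ε 0<ε = ℚ.*-monoʳ-<-pos ½ 0<ε

  halves : ∀ ε → ½ ℚ.* ε ℚ.+ ½ ℚ.* ε ≡ ε
  halves ε = trans (sym (ℚ.*-distribʳ-+ ε ½ ½)) (ℚ.*-identityˡ ε)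

  -- The bound holds on a tail of the sequence only.
  bounded : (x : ℝ) → ∃[ A ] ℚ.Positive A × (∃[ N ] ∀ m → N ℕ.≤ m →
            ℚ.∣ seq x m ∣ ℚ.≤ A)
  bounded (mkℝ a c) with c 1ℚ (ℚ.positive⁻¹ 1ℚ)
  ... | N , h = 1ℚ ℚ.+ ℚ.∣ a N ∣
              , ℚ.pos+nonNeg⇒pos 1ℚ ℚ.∣ a N ∣ {{ℚ.∣-∣-nonNeg (a N)}}
              , N , λ m N≤m → begin
    ℚ.∣ a m ∣                           ≡⟨ cong ℚ.∣_∣ (split (a m) (a N)) ⟩
    ℚ.∣ (a m ℚ.- a N) ℚ.+ a N ∣         ≤⟨ ℚ.∣p+q∣≤∣p∣+∣q∣ (a m ℚ.- a N) (a N) ⟩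
    ℚ.∣ a m ℚ.- a N ∣ ℚ.+ ℚ.∣ a N ∣     ≤⟨ ℚ.+-monoˡ-≤ ℚ.∣ a N ∣ (ℚ.<⇒≤ (h m N N≤m ℕ.≤-refl)) ⟩
    1ℚ ℚ.+ ℚ.∣ a N ∣                    ∎
    where
    open ℚ.≤-Reasoning
    open ℚ.+-*-Solver
    split : ∀ p q → p ≡ (p ℚ.- q) ℚ.+ q
    split = solve 2 (λ p q → p := (p :- q) :+ q) refl

  quotient : ∀ D → ℚ.Positive D → ∀ ε → 0ℚ ℚ.< ε →
             ∃[ η ] 0ℚ ℚ.< η × η ℚ.* D ≡ ε
  quotient D D>0 ε 0<ε = ε ℚ.* D⁻¹ , ℚ.positive⁻¹ (ε ℚ.* D⁻¹) {{η>0}} , (begin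
    ε ℚ.* D⁻¹ ℚ.* D     ≡⟨ ℚ.*-assoc ε D⁻¹ D ⟩
    ε ℚ.* (D⁻¹ ℚ.* D)   ≡⟨ cong (ε ℚ.*_) (ℚ.*-inverseˡ D {{D≢0}}) ⟩
    ε ℚ.* 1ℚ            ≡⟨ ℚ.*-identityʳ ε ⟩
    ε                   ∎)
    where
    open ≡-Reasoning
    D≢0 : ℚ.NonZero D
    D≢0 = ℚ.pos⇒nonZero D {{D>0}}
    D⁻¹ : ℚ
    D⁻¹ = (ℚ.1/ D) {{D≢0}}
    η>0 : ℚ.Positive (ε ℚ.* D⁻¹)
    η>0 = ℚ.pos*pos⇒pos ε {{ℚ.positive 0<ε}} D⁻¹ {{ℚ.1/pos⇒pos D {{D>0}}}}

  product< : ∀ p q {η A} → ℚ.Positive A → ℚ.∣ p ∣ ℚ.< η → ℚ.∣ q ∣ ℚ.≤ A →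
             ℚ.∣ p ℚ.* q ∣ ℚ.< η ℚ.* A
  product< p q {η} {A} A>0 p<η q≤A = begin-strict
    ℚ.∣ p ℚ.* q ∣        ≡⟨ ℚ.∣p*q∣≡∣p∣*∣q∣ p q ⟩
    ℚ.∣ p ∣ ℚ.* ℚ.∣ q ∣  ≤⟨ ℚ.*-monoˡ-≤-nonNeg ℚ.∣ p ∣ {{ℚ.∣-∣-nonNeg p}} q≤A ⟩
    ℚ.∣ p ∣ ℚ.* A        <⟨ ℚ.*-monoˡ-<-pos A {{A>0}} p<η ⟩
    η ℚ.* A              ∎
    where open ℚ.≤-Reasoning

fromℚ : ℚ → ℝ
fromℚ q = mkℝ (λ _ → q) λ ε 0<ε → 0 , λ _ _ _ _ →
  subst (ℚ._< ε) (cong ℚ.∣_∣ (sym (ℚ.+-inverseʳ q))) 0<ε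

fromℕ : ℕ → ℝ
fromℕ n = fromℚ (+ n ℚ./ 1)

private
  close-+ : ∀ p q r s η θ → ℚ.∣ p ℚ.- r ∣ ℚ.< η → ℚ.∣ q ℚ.- s ∣ ℚ.< θ →
            ℚ.∣ (p ℚ.+ q) ℚ.- (r ℚ.+ s) ∣ ℚ.< η ℚ.+ θ
  close-+ p q r s η θ p-r q-s = begin-strict
    ℚ.∣ (p ℚ.+ q) ℚ.- (r ℚ.+ s) ∣        ≡⟨ cong ℚ.∣_∣ (regroup p q r s) ⟩
    ℚ.∣ (p ℚ.- r) ℚ.+ (q ℚ.- s) ∣        ≤⟨ ℚ.∣p+q∣≤∣p∣+∣q∣ (p ℚ.- r) (q ℚ.- s) ⟩
    ℚ.∣ p ℚ.- r ∣ ℚ.+ ℚ.∣ q ℚ.- s ∣      <⟨ ℚ.+-mono-< p-r q-s ⟩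
    η ℚ.+ θ                              ∎
    where
    open ℚ.≤-Reasoning
    open ℚ.+-*-Solver
    regroup : ∀ p q r s → (p ℚ.+ q) ℚ.- (r ℚ.+ s) ≡ (p ℚ.- r) ℚ.+ (q ℚ.- s)
    regroup = solve 4 (λ p q r s → (p :+ q) :- (r :+ s) := (p :- r) :+ (q :- s)) refl

  close-* : ∀ p q r s η A B → ℚ.Positive A → ℚ.Positive B →
            ℚ.∣ p ℚ.- r ∣ ℚ.< η → ℚ.∣ q ℚ.- s ∣ ℚ.< η →
            ℚ.∣ p ∣ ℚ.≤ A → ℚ.∣ s ∣ ℚ.≤ B →
            ℚ.∣ p ℚ.* q ℚ.- r ℚ.* s ∣ ℚ.< η ℚ.* (A ℚ.+ B)
  close-* p q r s η A B A>0 B>0 p-r q-s p≤A s≤B = begin-strict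
    ℚ.∣ p ℚ.* q ℚ.- r ℚ.* s ∣
      ≡⟨ cong ℚ.∣_∣ (regroup p q r s) ⟩
    ℚ.∣ (q ℚ.- s) ℚ.* p ℚ.+ (p ℚ.- r) ℚ.* s ∣
      ≤⟨ ℚ.∣p+q∣≤∣p∣+∣q∣ ((q ℚ.- s) ℚ.* p) ((p ℚ.- r) ℚ.* s) ⟩
    ℚ.∣ (q ℚ.- s) ℚ.* p ∣ ℚ.+ ℚ.∣ (p ℚ.- r) ℚ.* s ∣
      <⟨ ℚ.+-mono-< (product< (q ℚ.- s) p A>0 q-s p≤A) (product< (p ℚ.- r) s B>0 p-r s≤B) ⟩
    η ℚ.* A ℚ.+ η ℚ.* B
      ≡⟨ ℚ.*-distribˡ-+ η A B ⟨
    η ℚ.* (A ℚ.+ B) ∎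
    where
    open ℚ.≤-Reasoning
    open ℚ.+-*-Solver
    regroup : ∀ p q r s → p ℚ.* q ℚ.- r ℚ.* s ≡ (q ℚ.- s) ℚ.* p ℚ.+ (p ℚ.- r) ℚ.* s
    regroup = solve 4 (λ p q r s → p :* q :- r :* s := (q :- s) :* p :+ (p :- r) :* s) refl

  cauchy-+ : (x y : ℝ) → IsCauchy (λ m → seq x m ℚ.+ seq y m)
  cauchy-+ x y ε 0<ε =
    let N , h = cauchy x (½ ℚ.* ε) (half-pos ε 0<ε)
        M , g = cauchy y (½ ℚ.* ε) (half-pos ε 0<ε)
    in N ℕ.⊔ M , λ m n p q → subst (_ ℚ.<_) (halves ε)
      (close-+ (seq x m) (seq y m) (seq x n) (seq y n) (½ ℚ.* ε) (½ ℚ.* ε)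
        (h m n (ℕ.m⊔n≤o⇒m≤o N M p) (ℕ.m⊔n≤o⇒m≤o N M q))
        (g m n (ℕ.m⊔n≤o⇒n≤o N M p) (ℕ.m⊔n≤o⇒n≤o N M q)))

  cauchy-* : (x y : ℝ) → IsCauchy (λ m → seq x m ℚ.* seq y m)
  cauchy-* x y ε 0<ε =
    let A , A>0 , K , boundA = bounded x
        B , B>0 , L , boundB = bounded y
        η , 0<η , ηD≡ε = quotient (A ℚ.+ B) (ℚ.pos+pos⇒pos A {{A>0}} B {{B>0}}) ε 0<ε
        N , h = cauchy x η 0<η
        M , g = cauchy y η 0<η
    in (K ℕ.⊔ L) ℕ.⊔ (N ℕ.⊔ M) , λ m n p q →
      let KL≤m = ℕ.m⊔n≤o⇒m≤o (K ℕ.⊔ L) (N ℕ.⊔ M) p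
          KL≤n = ℕ.m⊔n≤o⇒m≤o (K ℕ.⊔ L) (N ℕ.⊔ M) q
          NM≤m = ℕ.m⊔n≤o⇒n≤o (K ℕ.⊔ L) (N ℕ.⊔ M) p
          NM≤n = ℕ.m⊔n≤o⇒n≤o (K ℕ.⊔ L) (N ℕ.⊔ M) q
      in subst (_ ℚ.<_) ηD≡ε
        (close-* (seq x m) (seq y m) (seq x n) (seq y n) η A B A>0 B>0
          (h m n (ℕ.m⊔n≤o⇒m≤o N M NM≤m) (ℕ.m⊔n≤o⇒m≤o N M NM≤n))
          (g m n (ℕ.m⊔n≤o⇒n≤o N M NM≤m) (ℕ.m⊔n≤o⇒n≤o N M NM≤n))
          (boundA m (ℕ.m⊔n≤o⇒m≤o K L KL≤m))
          (boundB n (ℕ.m⊔n≤o⇒n≤o K L KL≤n)))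

_+ᵣ_ : ℝ → ℝ → ℝ
x +ᵣ y = mkℝ (λ m → seq x m ℚ.+ seq y m) (cauchy-+ x y)

_*ᵣ_ : ℝ → ℝ → ℝ
x *ᵣ y = mkℝ (λ m → seq x m ℚ.* seq y m) (cauchy-* x y)

_-ᵣ_ : ℝ → ℝ → ℝ
x -ᵣ y = x +ᵣ fromℚ (ℚ.- 1ℚ) *ᵣ y

_/ᵣ_ : ℝ → (n : ℕ) .{{_ : NonZero n}} → ℝ
x /ᵣ n = x *ᵣ fromℚ (+ 1 ℚ./ n)

------------------------------------------------------------------------
-- Fin n plays the role of [n]; a family is a duplicate-free list, so that
-- length is its cardinality.

record Family (n k : ℕ) : Set where
  field
    sets    : List (Subset n)
    unique  : Unique sets
    uniform : All (λ F → ∣ F ∣ ≡ k) sets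

open Family public

private
  variable
    n k : ℕ

size : Family n k → ℕ
size 𝓕 = length (sets 𝓕)

infix 5 _∖_
infix 6 _[_]

_[_] : List (Subset n) → List (Subset n) → List (Subset n)
𝓕 [ 𝓑 ] = filter (λ F → any? (λ B → B ⊆? F) 𝓑) 𝓕

_∖_ : List (Subset n) → List (Subset n) → List (Subset n)
𝓕 ∖ 𝓖 = filter (λ F → ¬? (any? (Vec.≡-dec _≟ᵇ_ F) 𝓖)) 𝓕

------------------------------------------------------------------------

core : {s : ℕ} → (Fin s → Subset n) → Subset n
core P = ⋂ (tabulate P)

record IsSunflower {s : ℕ} (P : Fin s → Subset n) : Set where
  field
    distinct : Injective _≡_ _≡_ P
    meet     : ∀ {i j} → i ≢ j → P i ∩ P j ≡ core P

HasSunflower : ℕ → Family n k → Set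
HasSunflower {n} s 𝓕 =
  Σ[ P ∈ (Fin s → Subset n) ] (∀ i → P i ∈ sets 𝓕) × IsSunflower P

HasSunflowerWithCoreSize : ℕ → ℕ → Family n k → Set
HasSunflowerWithCoreSize {n} s c 𝓕 =
  Σ[ P ∈ (Fin s → Subset n) ]
    (∀ i → P i ∈ sets 𝓕) × IsSunflower P × ∣ core P ∣ ≡ c

-- IsPhi s t m says φ(s,t) = m.  Only finitely many points lie in a member of
-- a finite family, so ground sets of the form Fin N suffice.
record IsPhi (s t m : ℕ) : Set where
  field
    attained : ∃[ N ] Σ[ 𝓕 ∈ Family N t ] ¬ HasSunflower s 𝓕 × size 𝓕 ≡ m
    maximal  : ∀ N (𝓕 : Family N t) → ¬ HasSunflower s 𝓕 → size 𝓕 ℕ.≤ m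

{-# OPTIONS --safe #-}
module Submission where

-- Enumerate the members of 𝓕 as k-tuples.  As in Füredi's intersection theorem, 𝓕 splits into boundedly
-- many homogeneous classes: for each J ⊊ [k], either no two members of the class agree exactly on J, or
-- every member f has, for any few forbidden points, another member that agrees with f on J and
-- avoids these points elsewhere (J is a kernel).  Kernels are closed under intersection, and none
-- has size t − 1.  By a theorem of Frankl and Katona and k ≥ 2t + 1, a class then either has at
-- most n^(k−t−1) members, or each of its members F has a t-subset A (its root) such that all S
-- with A ⊆ S ⊊ F are kernels.
-- For a (k−t)-set D, let T(D) consist of the roots A with A ∪ D in 𝓕.  It is sunflower-free, and so is
-- T(D) ∪ T(D′) when ∣D ∩ D′∣ ≥ t − 1; hence T(D) = T(D′) as soon as both have φ(s,t) members.  The size of 𝓕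
-- forces ∣T(D)∣ = φ(s,t) for almost all D, and changing D one point at a time shows that almost
-- all T(D) coincide; this common family is 𝓣.

open import Defs
open import Data.Bool.Base using (true; false)
import Data.Bool.Properties as Bool
open import Data.Empty using (⊥; ⊥-elim)
open import Data.Fin.Base using (Fin; zero; suc)
import Data.Fin.Properties as Fin
open import Data.Fin.Subset using (Subset; inside; outside; ∣_∣; _∩_; _∪_; ∁; ⁅_⁆; _⊆_) renaming (_∈_ to _∈ˢ_; _∉_ to _∉ˢ_; ⊤ to ⊤ˢ)
open import Data.Fin.Subset.Properties using (_∈?_; _⊆?_; anySubset?; drop-there; ⊆-antisym; ⊆⊤; ∈⊤; ∣⊤∣≡n; ∣p∣≤n; ∣p∣≡n⇒p≡⊤; p⊆q⇒∣p∣≤∣q∣; p⊂q⇒∣p∣<∣q∣; ∣p∩q∣≤∣p∣; ∣∁p∣≡n∸∣p∣; ∣⁅x⁆∣≡1; x∈⁅x⁆; x∈⁅y⁆⇒x≡y; x∈p∩q⁺; x∈p∩q⁻; x∈p∪q⁺; x∈p∪q⁻; x∈∁p⇒x∉p; x∉p⇒x∈∁p; x∉∁p⇒x∈p)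
open import Data.Integer.Base as ℤ using () renaming (+_ to pos)
import Data.Integer.Properties as ℤ
open import Data.List.Base using (List; []; _∷_; _++_; map; foldr; length; filter; allFin; upTo; cartesianProduct; cartesianProductWith)
open import Data.List.Membership.Propositional using (_∈_; find; lose)
import Data.List.Membership.DecPropositional as DecMembership
open import Data.List.Membership.Propositional.Properties using (∈-map⁺; ∈-map⁻; ∈-++⁻; ∈-++⁺ˡ; ∈-++⁺ʳ; ∈-∃++; ∈-filter⁺; ∈-filter⁻; ∈-allFin; ∈-upTo⁺; ∈-cartesianProduct⁺; ∈-cartesianProduct⁻; ∈-cartesianProductWith⁺; ∈-length)
open import Data.List.Properties using (length-map; length-++; length-tabulate; length-upTo; map-tabulate; filter-notAll)
open import Data.List.Relation.Unary.All as All using (All; []; _∷_)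
open import Data.List.Relation.Unary.AllPairs using ([]) renaming (_∷_ to _∷ᵘ_)
open import Data.List.Relation.Unary.Any as Any using (here; there)
open import Data.List.Relation.Unary.Unique.Propositional using (Unique)
import Data.List.Relation.Unary.Unique.Propositional.Properties as Unique
open import Data.Maybe.Base using (Maybe; just; nothing)
import Data.Maybe.Properties as Maybe
open import Data.Nat.Base as ℕ using (ℕ; zero; suc; NonZero; _+_; _*_; _^_; _∸_; _⊔_; _!; _≤_; _<_; z≤n; s≤s; >-nonZero; >-nonZero⁻¹)
open import Data.Nat.Combinatorics using (_C_; nCk≡nPk/k!; nPk≡n!/[n∸k]!) renaming (_P_ to _℘_)
open import Data.Nat.Combinatorics.Base using () renaming (_P′_ to _℘′_)
open import Data.Nat.Combinatorics.Specification using (k!∣nP′k; nP′k≡n!/[n∸k]!)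
open import Data.Nat.Divisibility using (divides; m≤n⇒m!∣n!; m∣m*n; ∣-trans)
open import Data.Nat.DivMod using (m*[n/m]≡n)
open import Data.Nat.ListAction using (sum)
open import Data.Nat.Properties
open import Algebra.Properties.CommutativeSemigroup *-commutativeSemigroup using (x∙yz≈y∙xz)
import Data.Nat.Solver as ℕ-Solver
open import Data.Product using (∃-syntax; Σ-syntax; _×_; _,_; proj₁; proj₂)
import Data.Product.Properties as Product
open import Data.Rational.Base as ℚ using (ℚ; 0ℚ; 1ℚ)
import Data.Rational.Properties as ℚ
import Data.Rational.Solver as ℚ-Solver
open import Data.Rational.Unnormalised.Base as ℚᵘ using (mkℚᵘ; *≡*)
import Data.Rational.Unnormalised.Properties as ℚᵘ
open import Data.Sum as Sum using (_⊎_; inj₁; inj₂)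
open import Data.Vec.Base as Vec using (Vec; []; _∷_; here; there)
import Data.Vec.Properties as Vec
open import Function.Base using (_∘_)
open import Level using (Level)
open import Relation.Binary.Definitions using (DecidableEquality)
open import Relation.Binary.PropositionalEquality hiding (J; [_])
open import Relation.Nullary using (¬_; Dec; yes; no; does)
open import Relation.Nullary.Decidable using (_×-dec_; _→-dec_; ¬?; map′; decidable-stable)
open import Relation.Unary using (Pred; Decidable)

-- Two obstacles shape the argument. 𝓕 is not k-partite, so the positions in [k] come from an
-- arbitrary enumeration of each member, and two tuples may share a point at different positions.
-- The forbidden points in the definition of a kernel are banned from every position outside J,
-- which keeps such accidental meetings out of the sunflowers that get built. Moreover D has to move
-- one point at a time inside a product, so it is replaced by its orderings among the n^(k-t)
-- tuples; tuples with a repeated entry carry no roots and are charged to the term C(s,k)/n.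
--
-- T(D) ∪ T(D′) is sunflower-free because a sunflower of roots with core of size c < t can be padded
-- with t - 1 - c points of D ∩ D′: the padded roots have fewer than 2t ≤ k points, hence are
-- kernels, and extending them away from each other yields a sunflower in 𝓕 with core of size
-- exactly t - 1.
--
-- In the coefficient of δ, the factor k bounds k - t + 1, the cost of changing k - t coordinates in
-- turn; one factor φ bounds the number of roots at a bad tuple; passing from n C (k-t) to (n-t) C
-- (k-t) costs 2.

private
  variable
    A B : Set
    ℓ : Level
    m n k s t : ℕ

-- Finite sums

∑ : List A → (A → ℕ) → ℕ
∑ xs f = sum (map f xs)

∑-mono : ∀ (xs : List A) {f g : A → ℕ} → (∀ {x} → x ∈ xs → f x ≤ g x) → ∑ xs f ≤ ∑ xs g
∑-mono []       f≤g = z≤n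
∑-mono (x ∷ xs) f≤g = +-mono-≤ (f≤g (here refl)) (∑-mono xs (f≤g ∘ there))

∑-cong : ∀ (xs : List A) {f g : A → ℕ} → (∀ {x} → x ∈ xs → f x ≡ g x) → ∑ xs f ≡ ∑ xs g
∑-cong xs f≡g = ≤-antisym (∑-mono xs (≤-reflexive ∘ f≡g)) (∑-mono xs (≤-reflexive ∘ sym ∘ f≡g))

∑-+ : ∀ (xs : List A) (f g : A → ℕ) → ∑ xs (λ x → f x + g x) ≡ ∑ xs f + ∑ xs g
∑-+ []       f g = refl
∑-+ (x ∷ xs) f g rewrite ∑-+ xs f g =
  solve 4 (λ a b c d → (a :+ b) :+ (c :+ d) := (a :+ c) :+ (b :+ d)) refl (f x) (g x) (∑ xs f) (∑ xs g)
  where open ℕ-Solver.+-*-Solver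

∑-*ˡ : ∀ (xs : List A) c (f : A → ℕ) → ∑ xs (λ x → c * f x) ≡ c * ∑ xs f
∑-*ˡ []       c f = sym (*-zeroʳ c)
∑-*ˡ (x ∷ xs) c f rewrite ∑-*ˡ xs c f = sym (*-distribˡ-+ c (f x) (∑ xs f))

∑-*ʳ : ∀ (xs : List A) c (f : A → ℕ) → ∑ xs (λ x → f x * c) ≡ ∑ xs f * c
∑-*ʳ xs c f = trans (∑-cong xs (λ {x} _ → *-comm (f x) c)) (trans (∑-*ˡ xs c f) (*-comm c (∑ xs f)))

∑-const : ∀ (xs : List A) c → ∑ xs (λ _ → c) ≡ length xs * c
∑-const []       c = refl
∑-const (x ∷ xs) c = cong (c +_) (∑-const xs c)

∑-zero : ∀ (xs : List A) → ∑ xs (λ _ → 0) ≡ 0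
∑-zero xs = trans (∑-const xs 0) (*-zeroʳ (length xs))

∑-swap : ∀ (xs : List A) (ys : List B) (f : A → B → ℕ) →
         ∑ xs (λ x → ∑ ys (f x)) ≡ ∑ ys (λ y → ∑ xs (λ x → f x y))
∑-swap []       ys f = sym (∑-zero ys)
∑-swap (x ∷ xs) ys f = trans (cong (∑ ys (f x) +_) (∑-swap xs ys f))
                             (sym (∑-+ ys (f x) (λ y → ∑ xs (λ x → f x y))))

∑-++ : ∀ (xs ys : List A) (f : A → ℕ) → ∑ (xs ++ ys) f ≡ ∑ xs f + ∑ ys f
∑-++ []       ys f = refl
∑-++ (x ∷ xs) ys f = trans (cong (f x +_) (∑-++ xs ys f)) (sym (+-assoc (f x) (∑ xs f) (∑ ys f)))

∑-map : ∀ (xs : List A) (g : A → B) (f : B → ℕ) → ∑ (map g xs) f ≡ ∑ xs (f ∘ g)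
∑-map []       g f = refl
∑-map (x ∷ xs) g f = cong (f (g x) +_) (∑-map xs g f)

∑-∈ : ∀ {xs : List A} {x} (f : A → ℕ) → x ∈ xs → f x ≤ ∑ xs f
∑-∈ f (here refl)                = m≤m+n _ _
∑-∈ f (there {x = y} x∈xs) = ≤-trans (∑-∈ f x∈xs) (m≤n+m _ (f y))

∑-allFin : ∀ n (f : Fin (suc n) → ℕ) → ∑ (allFin (suc n)) f ≡ f zero + ∑ (allFin n) (f ∘ suc)
∑-allFin n f = cong (f zero +_) (cong sum (trans (map-tabulate suc f) (sym (map-tabulate (λ i → i) (f ∘ suc)))))

below-average : ∀ (xs : List A) (f : A → ℕ) → 0 < length xs → ∃[ x ] x ∈ xs × length xs * f x ≤ ∑ xs f
below-average (x ∷ [])     f _ = x , here refl , ≤-refl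
below-average (x ∷ y ∷ ys) f _ with below-average (y ∷ ys) f (s≤s z≤n)
... | z , z∈ , z≤ with ≤-total (f x) (f z)
... | inj₁ fx≤fz = x , here refl , +-monoʳ-≤ (f x) (≤-trans (*-monoʳ-≤ (suc (length ys)) fx≤fz) z≤)
... | inj₂ fz≤fx = z , there z∈ , +-mono-≤ fz≤fx z≤

𝟙 : ∀ {P : Set ℓ} → Dec P → ℕ
𝟙 (yes _) = 1
𝟙 (no  _) = 0

𝟙-yes : ∀ {P : Set ℓ} (d : Dec P) → P → 𝟙 d ≡ 1
𝟙-yes (yes _) _ = refl
𝟙-yes (no ¬p) p = ⊥-elim (¬p p)

𝟙-no : ∀ {P : Set ℓ} (d : Dec P) → ¬ P → 𝟙 d ≡ 0
𝟙-no (yes p) ¬p = ⊥-elim (¬p p)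
𝟙-no (no _)  _  = refl

length-filter-𝟙 : ∀ {P : Pred A ℓ} (P? : Decidable P) xs → length (filter P? xs) ≡ ∑ xs (λ x → 𝟙 (P? x))
length-filter-𝟙 P? []       = refl
length-filter-𝟙 P? (x ∷ xs) with P? x
... | yes _ = cong suc (length-filter-𝟙 P? xs)
... | no  _ = length-filter-𝟙 P? xs

Unique⇒length≤ : ∀ {xs ys : List A} → Unique xs → (∀ {x} → x ∈ xs → x ∈ ys) → length xs ≤ length ys
Unique⇒length≤ []          xs⊆ys = z≤n
Unique⇒length≤ {xs = x ∷ xs} (x≢ ∷ᵘ u) xs⊆ys with ∈-∃++ (xs⊆ys (here refl))
... | as , bs , refl = begin
  suc (length xs)             ≤⟨ s≤s (Unique⇒length≤ u xs⊆) ⟩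
  suc (length (as ++ bs))     ≡⟨ cong suc (length-++ as) ⟩
  suc (length as + length bs) ≡⟨ +-suc (length as) (length bs) ⟨
  length as + suc (length bs) ≡⟨ length-++ as ⟨
  length (as ++ x ∷ bs)       ∎
  where
  open ≤-Reasoning
  xs⊆ : ∀ {y} → y ∈ xs → y ∈ as ++ bs
  xs⊆ y∈ with ∈-++⁻ as (xs⊆ys (there y∈))
  ... | inj₁ y∈as         = ∈-++⁺ˡ y∈as
  ... | inj₂ (here refl)  = ⊥-elim (All.lookup x≢ y∈ refl)
  ... | inj₂ (there y∈bs) = ∈-++⁺ʳ as y∈bs

Unique-map : ∀ {xs : List A} (f : A → B) → (∀ {x y} → x ∈ xs → y ∈ xs → f x ≡ f y → x ≡ y) →
             Unique xs → Unique (map f xs)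
Unique-map f inj []        = []
Unique-map {xs = x ∷ xs} f inj (x≢ ∷ᵘ u) = All.tabulate fx≢ ∷ᵘ Unique-map f (λ p q → inj (there p) (there q)) u
  where
  fx≢ : ∀ {z} → z ∈ map f xs → f x ≢ z
  fx≢ z∈ refl with ∈-map⁻ f z∈
  ... | y , y∈ , fx≡fy = All.lookup x≢ y∈ (inj (here refl) (there y∈) fx≡fy)

-- Vectors over a finite alphabet

allVecs : List A → ∀ d → List (Vec A d)
allVecs xs zero    = Vec.[] ∷ []
allVecs xs (suc d) = cartesianProductWith Vec._∷_ xs (allVecs xs d)

∑-cartesianProductWith : ∀ {D : Set} (_•_ : A → B → D) xs ys (f : D → ℕ) →
  ∑ (cartesianProductWith _•_ xs ys) f ≡ ∑ xs (λ x → ∑ ys (λ y → f (x • y)))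
∑-cartesianProductWith _•_ []       ys f = refl
∑-cartesianProductWith _•_ (x ∷ xs) ys f = trans (∑-++ (map (x •_) ys) _ f)
  (cong₂ _+_ (∑-map ys (x •_) f) (∑-cartesianProductWith _•_ xs ys f))

length-∑ : ∀ (xs : List A) → ∑ xs (λ _ → 1) ≡ length xs
length-∑ xs = trans (∑-const xs 1) (*-identityʳ (length xs))

length-allVecs : ∀ (xs : List A) d → length (allVecs xs d) ≡ length xs ^ d
length-allVecs xs zero    = refl
length-allVecs xs (suc d) = trans (sym (length-∑ (allVecs xs (suc d))))
  (trans (∑-cartesianProductWith Vec._∷_ xs (allVecs xs d) (λ _ → 1))
  (trans (∑-cong xs (λ _ → trans (length-∑ (allVecs xs d)) (length-allVecs xs d)))
         (∑-const xs (length xs ^ d))))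

∈-allVecs : ∀ (xs : List A) → (∀ x → x ∈ xs) → ∀ {d} (v : Vec A d) → v ∈ allVecs xs d
∈-allVecs xs full Vec.[]      = here refl
∈-allVecs xs full (x Vec.∷ v) = ∈-cartesianProductWith⁺ Vec._∷_ (full x) (∈-allVecs xs full v)

-- Subsets of Fin n

infix 4 _≟ˢ_

_≟ˢ_ : DecidableEquality (Subset n)
_≟ˢ_ = Vec.≡-dec Bool._≟_

comprehension : ∀ {p} {P : Pred (Fin n) p} → Decidable P → Subset n
comprehension P? = Vec.tabulate (does ∘ P?)

∈-comprehension⁺ : ∀ {p} {P : Pred (Fin n) p} (P? : Decidable P) {x} → P x → x ∈ˢ comprehension P?
∈-comprehension⁺ P? {x} Px = Vec.lookup⇒[]= x _ (trans (Vec.lookup∘tabulate (does ∘ P?) x) does≡)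
  where
  does≡ : does (P? x) ≡ true
  does≡ with P? x
  ... | yes _  = refl
  ... | no ¬Px = ⊥-elim (¬Px Px)

∈-comprehension⁻ : ∀ {p} {P : Pred (Fin n) p} (P? : Decidable P) {x} → x ∈ˢ comprehension P? → P x
∈-comprehension⁻ P? {x} x∈ with P? x | trans (sym (Vec.lookup∘tabulate (does ∘ P?) x)) (Vec.[]=⇒lookup x∈)
... | yes Px | _  = Px
... | no _   | ()

card-∑ : (p : Subset n) → ∣ p ∣ ≡ ∑ (allFin n) (λ x → 𝟙 (x ∈? p))
card-∑ []            = refl
card-∑ {suc n} (s ∷ p) = trans (head s) (sym (∑-allFin n (λ x → 𝟙 (x ∈? (s ∷ p)))))
  where
  tail : ∀ s → ∑ (allFin n) (λ x → 𝟙 (suc x ∈? (s ∷ p))) ≡ ∣ p ∣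
  tail s = trans (∑-cong (allFin n) λ {x} _ → pointwise x (x ∈? p)) (sym (card-∑ p))
    where
    pointwise : ∀ x (d : Dec (x ∈ˢ p)) → 𝟙 (suc x ∈? (s ∷ p)) ≡ 𝟙 d
    pointwise x (yes x∈) = 𝟙-yes (suc x ∈? (s ∷ p)) (there x∈)
    pointwise x (no x∉)  = 𝟙-no (suc x ∈? (s ∷ p)) (x∉ ∘ drop-there)
  head : ∀ s → ∣ s ∷ p ∣ ≡ 𝟙 (zero ∈? (s ∷ p)) + ∑ (allFin n) (λ x → 𝟙 (suc x ∈? (s ∷ p)))
  head inside  = cong suc (sym (tail inside))
  head outside = sym (tail outside)

card-⊎ : (p q r : Subset n) → (∀ {x} → x ∈ˢ p → x ∈ˢ q ⊎ x ∈ˢ r) →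
         (∀ {x} → x ∈ˢ q → x ∈ˢ p) → (∀ {x} → x ∈ˢ r → x ∈ˢ p) →
         (∀ {x} → x ∈ˢ q → x ∉ˢ r) → ∣ p ∣ ≡ ∣ q ∣ + ∣ r ∣
card-⊎ {n} p q r split q⊆p r⊆p disjoint = begin
  ∣ p ∣                                              ≡⟨ card-∑ p ⟩
  ∑ (allFin n) (λ x → 𝟙 (x ∈? p))                    ≡⟨ ∑-cong (allFin n) (λ {x} _ → pointwise x) ⟩
  ∑ (allFin n) (λ x → 𝟙 (x ∈? q) + 𝟙 (x ∈? r))       ≡⟨ ∑-+ (allFin n) _ _ ⟩
  ∑ (allFin n) (λ x → 𝟙 (x ∈? q)) + ∑ (allFin n) (λ x → 𝟙 (x ∈? r)) ≡⟨ cong₂ _+_ (card-∑ q) (card-∑ r) ⟨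
  ∣ q ∣ + ∣ r ∣                                      ∎
  where
  open ≡-Reasoning
  pointwise : ∀ x → 𝟙 (x ∈? p) ≡ 𝟙 (x ∈? q) + 𝟙 (x ∈? r)
  pointwise x with x ∈? q | x ∈? r
  ... | yes x∈q | yes x∈r = ⊥-elim (disjoint x∈q x∈r)
  ... | yes x∈q | no  _   = 𝟙-yes (x ∈? p) (q⊆p x∈q)
  ... | no  _   | yes x∈r = 𝟙-yes (x ∈? p) (r⊆p x∈r)
  ... | no  x∉q | no  x∉r = 𝟙-no (x ∈? p) (λ x∈p → Sum.[ x∉q , x∉r ]′ (split x∈p))

card-∪ : (p q : Subset n) → (∀ {x} → x ∈ˢ p → x ∉ˢ q) → ∣ p ∪ q ∣ ≡ ∣ p ∣ + ∣ q ∣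
card-∪ p q = card-⊎ (p ∪ q) p q (x∈p∪q⁻ p q) (x∈p∪q⁺ ∘ inj₁) (x∈p∪q⁺ ∘ inj₂)

card-split : (p q : Subset n) → ∣ p ∣ ≡ ∣ p ∩ q ∣ + ∣ p ∩ ∁ q ∣
card-split p q = card-⊎ p (p ∩ q) (p ∩ ∁ q) split
  (proj₁ ∘ x∈p∩q⁻ p q) (proj₁ ∘ x∈p∩q⁻ p (∁ q))
  (λ x∈ x∈′ → x∈∁p⇒x∉p (proj₂ (x∈p∩q⁻ p (∁ q) x∈′)) (proj₂ (x∈p∩q⁻ p q x∈)))
  where
  split : ∀ {x} → x ∈ˢ p → x ∈ˢ p ∩ q ⊎ x ∈ˢ p ∩ ∁ q
  split {x} x∈p with x ∈? q
  ... | yes x∈q = inj₁ (x∈p∩q⁺ (x∈p , x∈q))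
  ... | no  x∉q = inj₂ (x∈p∩q⁺ (x∈p , x∉p⇒x∈∁p x∉q))

infixl 6 _⟍_

_⟍_ : Subset n → Fin n → Subset n
p ⟍ x = p ∩ ∁ ⁅ x ⁆

x∈p⟍y⁺ : ∀ {x y} {p : Subset n} → x ∈ˢ p → x ≢ y → x ∈ˢ p ⟍ y
x∈p⟍y⁺ {y = y} x∈p x≢y = x∈p∩q⁺ (x∈p , x∉p⇒x∈∁p (x≢y ∘ x∈⁅y⁆⇒x≡y y))

x∈p⟍y⁻ : ∀ {x y} (p : Subset n) → x ∈ˢ p ⟍ y → x ∈ˢ p × x ≢ y
x∈p⟍y⁻ {y = y} p x∈ = proj₁ (x∈p∩q⁻ p _ x∈) ,
  λ { refl → x∈∁p⇒x∉p (proj₂ (x∈p∩q⁻ p _ x∈)) (x∈⁅x⁆ y) }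

card-insert : ∀ {x} (p : Subset n) → x ∉ˢ p → ∣ ⁅ x ⁆ ∪ p ∣ ≡ suc ∣ p ∣
card-insert {x = x} p x∉p = trans (card-∪ ⁅ x ⁆ p (λ y∈ → subst (_∉ˢ p) (sym (x∈⁅y⁆⇒x≡y x y∈)) x∉p))
                                  (cong (_+ ∣ p ∣) (∣⁅x⁆∣≡1 x))

card-⟍ : ∀ {x} (p : Subset n) → x ∈ˢ p → ∣ p ∣ ≡ suc ∣ p ⟍ x ∣
card-⟍ {x = x} p x∈p = trans (cong ∣_∣ (⊆-antisym p⊆ ⊆p)) (card-insert (p ⟍ x) (λ x∈ → proj₂ (x∈p⟍y⁻ p x∈) refl))
  where
  p⊆ : p ⊆ ⁅ x ⁆ ∪ (p ⟍ x)
  p⊆ {y} y∈ with y Fin.≟ x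
  ... | yes refl = x∈p∪q⁺ (inj₁ (x∈⁅x⁆ x))
  ... | no  y≢x  = x∈p∪q⁺ (inj₂ (x∈p⟍y⁺ y∈ y≢x))
  ⊆p : ⁅ x ⁆ ∪ (p ⟍ x) ⊆ p
  ⊆p y∈ with x∈p∪q⁻ ⁅ x ⁆ (p ⟍ x) y∈
  ... | inj₁ y∈x rewrite x∈⁅y⁆⇒x≡y x y∈x = x∈p
  ... | inj₂ y∈p = proj₁ (x∈p⟍y⁻ p y∈p)

elements : Subset n → List (Fin n)
elements {n} p = filter (_∈? p) (allFin n)

length-elements : (p : Subset n) → length (elements p) ≡ ∣ p ∣
length-elements p = trans (length-filter-𝟙 (_∈? p) (allFin _)) (sym (card-∑ p))

∈-elements⁺ : ∀ {x} {p : Subset n} → x ∈ˢ p → x ∈ elements p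
∈-elements⁺ {p = p} x∈p = ∈-filter⁺ (_∈? p) (∈-allFin _) x∈p

∈-elements⁻ : ∀ {x} (p : Subset n) → x ∈ elements p → x ∈ˢ p
∈-elements⁻ {n} p x∈ = proj₂ (∈-filter⁻ (_∈? p) {xs = allFin n} x∈)

Unique-elements : (p : Subset n) → Unique (elements p)
Unique-elements p = Unique.filter⁺ (_∈? p) (Unique.allFin⁺ _)

subset-of-size : ∀ (p : Subset n) {m} → m ≤ ∣ p ∣ → ∃[ q ] q ⊆ p × ∣ q ∣ ≡ m
subset-of-size []            z≤n = [] , (λ ()) , refl
subset-of-size (inside ∷ p)  {zero}  _ with subset-of-size p z≤n
... | q , q⊆p , ∣q∣≡0 = outside ∷ q , (λ { (there x∈) → there (q⊆p x∈) }) , ∣q∣≡0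
subset-of-size (inside ∷ p)  {suc m} (s≤s m≤) with subset-of-size p m≤
... | q , q⊆p , ∣q∣≡m = inside ∷ q , (λ { here → here ; (there x∈) → there (q⊆p x∈) }) , cong suc ∣q∣≡m
subset-of-size (outside ∷ p) m≤ with subset-of-size p m≤
... | q , q⊆p , ∣q∣≡m = outside ∷ q , (λ { (there x∈) → there (q⊆p x∈) }) , ∣q∣≡m

superset-of-size : ∀ (p : Subset n) {m} → ∣ p ∣ ≤ m → m ≤ n → ∃[ q ] p ⊆ q × ∣ q ∣ ≡ m
superset-of-size []            z≤n z≤n = [] , (λ ()) , refl
superset-of-size (inside ∷ p)  (s≤s p≤m) (s≤s m≤n) with superset-of-size p p≤m m≤n
... | q , p⊆q , ∣q∣≡m = inside ∷ q , (λ { here → here ; (there x∈) → there (p⊆q x∈) }) , cong suc ∣q∣≡m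
superset-of-size {suc n} (outside ∷ p) {m} p≤m m≤n with m≤n⇒m<n∨m≡n m≤n
... | inj₂ refl = ⊤ˢ , (λ _ → ∈⊤) , ∣⊤∣≡n (suc n)
... | inj₁ (s≤s m≤n′) with superset-of-size p p≤m m≤n′
... | q , p⊆q , ∣q∣≡m = outside ∷ q , (λ { (there x∈) → there (p⊆q x∈) }) , ∣q∣≡m

∃-nonempty : ∀ (p : Subset n) → 0 < ∣ p ∣ → ∃[ x ] x ∈ˢ p
∃-nonempty (inside ∷ p)  _  = zero , here
∃-nonempty (outside ∷ p) 0< with ∃-nonempty p 0<
... | x , x∈ = suc x , there x∈

≢⇒⊈ : ∀ {p q : Subset n} → p ⊆ q → p ≢ q → ∃[ x ] x ∈ˢ q × x ∉ˢ p
≢⇒⊈ {p = p} {q} p⊆q p≢q with Fin.any? (λ x → x ∈? (q ∩ ∁ p))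
... | yes (x , x∈) = x , proj₁ (x∈p∩q⁻ q _ x∈) , x∈∁p⇒x∉p (proj₂ (x∈p∩q⁻ q _ x∈))
... | no ∄ = ⊥-elim (p≢q (⊆-antisym p⊆q q⊆p))
  where
  q⊆p : q ⊆ p
  q⊆p {x} x∈q with x ∈? p
  ... | yes x∈p = x∈p
  ... | no  x∉p = ⊥-elim (∄ (x , x∈p∩q⁺ (x∈q , x∉p⇒x∈∁p x∉p)))

⊆-card-≡ : ∀ {p q : Subset n} → p ⊆ q → ∣ q ∣ ≤ ∣ p ∣ → p ≡ q
⊆-card-≡ {p = p} {q} p⊆q q≤p with Fin.any? (λ x → x ∈? (q ∩ ∁ p))
... | yes (x , x∈) = ⊥-elim (<⇒≱ (p⊂q⇒∣p∣<∣q∣ (p⊆q , x , proj₁ (x∈p∩q⁻ q _ x∈) , x∈∁p⇒x∉p (proj₂ (x∈p∩q⁻ q _ x∈)))) q≤p)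
... | no ∄ = ⊆-antisym p⊆q λ {x} → q⊆p x
  where
  q⊆p : ∀ x → x ∈ˢ q → x ∈ˢ p
  q⊆p x x∈q with x ∈? p
  ... | yes x∈p = x∈p
  ... | no  x∉p = ⊥-elim (∄ (x , x∈p∩q⁺ (x∈q , x∉p⇒x∈∁p x∉p)))

-- Tuples as enumerations of sets

IsEntry : Vec (Fin n) k → Subset k → Pred (Fin n) _
IsEntry f J x = ∃[ a ] a ∈ˢ J × Vec.lookup f a ≡ x

isEntry? : ∀ (f : Vec (Fin n) k) J → Decidable (IsEntry f J)
isEntry? f J x = Fin.any? (λ a → (a ∈? J) ×-dec (Vec.lookup f a Fin.≟ x))

image : Vec (Fin n) k → Subset k → Subset n
image f J = comprehension (isEntry? f J)

∈-image⁺ : ∀ (f : Vec (Fin n) k) {J a} → a ∈ˢ J → Vec.lookup f a ∈ˢ image f J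
∈-image⁺ f {J} a∈J = ∈-comprehension⁺ (isEntry? f J) (_ , a∈J , refl)

∈-image⁻ : ∀ (f : Vec (Fin n) k) J {x} → x ∈ˢ image f J → IsEntry f J x
∈-image⁻ f J = ∈-comprehension⁻ (isEntry? f J)

Injectiveᵛ : Vec (Fin n) k → Set
Injectiveᵛ f = ∀ a b → Vec.lookup f a ≡ Vec.lookup f b → a ≡ b

card-image : ∀ (f : Vec (Fin n) k) J → Injectiveᵛ f → ∣ image f J ∣ ≡ ∣ J ∣
card-image f J inj = trans (sym (length-elements (image f J))) (trans (≤-antisym ≤₁ ≤₂) (length-elements J))
  where
  open ≤-Reasoning
  ≤₁ : length (elements (image f J)) ≤ length (elements J)
  ≤₁ = begin
    length (elements (image f J))                ≤⟨ Unique⇒length≤ (Unique-elements (image f J)) incl ⟩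
    length (map (Vec.lookup f) (elements J))     ≡⟨ length-map (Vec.lookup f) (elements J) ⟩
    length (elements J)                          ∎
    where
    incl : ∀ {x} → x ∈ elements (image f J) → x ∈ map (Vec.lookup f) (elements J)
    incl x∈ with ∈-image⁻ f J (∈-elements⁻ _ x∈)
    ... | a , a∈J , refl = ∈-map⁺ (Vec.lookup f) (∈-elements⁺ a∈J)
  ≤₂ : length (elements J) ≤ length (elements (image f J))
  ≤₂ = begin
    length (elements J)                          ≡⟨ length-map (Vec.lookup f) (elements J) ⟨
    length (map (Vec.lookup f) (elements J))     ≤⟨ Unique⇒length≤ (Unique.map⁺ (λ {a} {b} → inj a b) (Unique-elements J)) incl ⟩
    length (elements (image f J))                ∎
    where
    incl : ∀ {x} → x ∈ map (Vec.lookup f) (elements J) → x ∈ elements (image f J)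
    incl x∈ with ∈-map⁻ (Vec.lookup f) x∈
    ... | a , a∈ , refl = ∈-elements⁺ (∈-image⁺ f (∈-elements⁻ J a∈))

entries : Vec (Fin n) k → Subset n
entries f = image f ⊤ˢ

enumerate : ∀ (p : Subset n) → ∣ p ∣ ≡ k → ∃[ f ] entries {k = k} f ≡ p × Injectiveᵛ f
enumerate p refl = go (elements p) (length-elements p) (Unique-elements p) (∈-elements⁻ p) ∈-elements⁺
  where
  go : ∀ xs {l} → length xs ≡ l → Unique xs → (∀ {x} → x ∈ xs → x ∈ˢ p) → (∀ {x} → x ∈ˢ p → x ∈ xs) →
       ∃[ f ] entries {k = l} f ≡ p × Injectiveᵛ f
  go xs refl u xs⊆p p⊆xs = f , ⊆-antisym to from , inj
    where
    f = Vec.fromList xs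
    lookup∈ : ∀ ys (a : Fin (length ys)) → Vec.lookup (Vec.fromList ys) a ∈ ys
    lookup∈ (y ∷ ys) zero    = here refl
    lookup∈ (y ∷ ys) (suc a) = there (lookup∈ ys a)
    position : ∀ {ys x} → x ∈ ys → ∃[ a ] Vec.lookup (Vec.fromList ys) a ≡ x
    position (here refl) = zero , refl
    position (there x∈) with position x∈
    ... | a , eq = suc a , eq
    to : entries f ⊆ p
    to x∈ with ∈-image⁻ f ⊤ˢ x∈
    ... | a , _ , refl = xs⊆p (lookup∈ xs a)
    from : p ⊆ entries f
    from x∈ with position (p⊆xs x∈)
    ... | a , refl = ∈-image⁺ f ∈⊤
    injective : ∀ {ys} → Unique ys → Injectiveᵛ (Vec.fromList ys)
    injective (_ ∷ᵘ _)  zero    zero    eq = refl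
    injective {y ∷ ys} (y≢ ∷ᵘ u) zero    (suc b) eq = ⊥-elim (All.lookup y≢ (lookup∈ ys b) eq)
    injective {y ∷ ys} (y≢ ∷ᵘ u) (suc a) zero    eq = ⊥-elim (All.lookup y≢ (lookup∈ ys a) (sym eq))
    injective (_  ∷ᵘ u) (suc a) (suc b) eq = cong suc (injective u a b eq)
    inj = injective u

-- The Frankl–Katona theorem

common? : (g : Subset n) (A : Fin m → Subset n) (D : Subset m) →
          Decidable (λ y → y ∈ˢ g × (∀ i → i ∈ˢ D → y ∈ˢ A i))
common? g A D y = (y ∈? g) ×-dec Fin.all? (λ i → (i ∈? D) →-dec (y ∈? A i))

common : Subset n → (Fin m → Subset n) → Subset m → Subset n
common g A D = comprehension (common? g A D)

containing? : (A : Fin m → Subset n) (Q : Subset m) (x : Fin n) → Decidable (λ i → i ∈ˢ Q × x ∈ˢ A i)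
containing? A Q x i = (i ∈? Q) ×-dec (x ∈? A i)

containing : (Fin m → Subset n) → Subset m → Fin n → Subset m
containing A Q x = comprehension (containing? A Q x)

-- Integral stand-ins for the reciprocals 1 / r, so that the weighted double count below stays in ℕ.
multiplesOf! : ∀ M → ∃[ w ] ∀ r → 0 < r → r ≤ M → r * w r ≡ M !
multiplesOf! M = (λ r → proj₁ (quotient r)) , λ r → proj₂ (quotient r)
  where
  quotient : ∀ r → ∃[ w ] (0 < r → r ≤ M → r * w ≡ M !)
  quotient zero    = 0 , λ ()
  quotient (suc r) with suc r ≤? M
  ... | no  r≰M = 0 , λ _ r≤M → ⊥-elim (r≰M r≤M)
  ... | yes r≤M with ∣-trans (m∣m*n {suc r} (r !)) (m≤n⇒m!∣n! r≤M)
  ... | divides w eq = w , λ _ _ → trans (*-comm (suc r) w) (sym eq)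

-- If every incident pair had degree at most the size of the set, then weighting
-- the pair (i , x) by 1 / ∣ A i ∣ would give ∣ Q ∣ ≤ ∣ g ∣; the weights are scaled by a factorial.
incident-pair : (g : Subset n) (Q : Subset m) (A : Fin m → Subset n) →
                ∣ g ∣ < ∣ Q ∣ → (∀ i → i ∈ˢ Q → 0 < ∣ g ∩ A i ∣) →
                ∃[ i ] ∃[ x ] i ∈ˢ Q × x ∈ˢ g × x ∈ˢ A i × ∣ g ∩ A i ∣ < ∣ containing A Q x ∣
incident-pair {n} {m} g Q A g<Q nonempty
  with Fin.any? (λ i → Fin.any? (λ x → (i ∈? Q) ×-dec (x ∈? g) ×-dec (x ∈? A i) ×-dec (∣ g ∩ A i ∣ <? ∣ containing A Q x ∣)))
... | yes found = found
... | no  none  = ⊥-elim (<⇒≱ g<Q (*-cancelˡ-≤ (M !) {{>-nonZero (1≤n! M)}} M!Q≤M!g))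
  where
  open ≤-Reasoning
  M : ℕ
  -- Large enough for both kinds of denominators: `a i` is at most n and `d x` is at most m.
  M = m + n
  w : ℕ → ℕ
  w = proj₁ (multiplesOf! M)
  w-quotient : ∀ r → 0 < r → r ≤ M → r * w r ≡ M !
  w-quotient = proj₂ (multiplesOf! M)
  w-antitone : ∀ r r′ → 0 < r → r ≤ r′ → r′ ≤ M → w r′ ≤ w r
  w-antitone (suc r) r′ _ r≤r′ r′≤M = *-cancelˡ-≤ (suc r) (begin
    suc r * w r′     ≤⟨ *-monoˡ-≤ (w r′) r≤r′ ⟩
    r′ * w r′        ≡⟨ w-quotient r′ (≤-trans (s≤s z≤n) r≤r′) r′≤M ⟩
    M !              ≡⟨ w-quotient (suc r) (s≤s z≤n) (≤-trans r≤r′ r′≤M) ⟨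
    suc r * w (suc r) ∎)
  a : Fin m → ℕ
  a i = ∣ g ∩ A i ∣
  d : Fin n → ℕ
  d x = ∣ containing A Q x ∣
  incident? : ∀ i → Decidable (λ x → i ∈ˢ Q × x ∈ˢ g ∩ A i)
  incident? i x = (i ∈? Q) ×-dec (x ∈? (g ∩ A i))
  e : Fin m → Fin n → ℕ
  e i x = 𝟙 (incident? i x)
  d≤a : ∀ {i x} → i ∈ˢ Q → x ∈ˢ g ∩ A i → d x ≤ a i
  d≤a {i} {x} i∈Q x∈ with x∈p∩q⁻ g (A i) x∈
  ... | x∈g , x∈A = ≮⇒≥ (λ a<d → none (i , x , i∈Q , x∈g , x∈A , a<d))
  row : ∀ i → 𝟙 (i ∈? Q) * (M !) ≤ ∑ (allFin n) (λ x → e i x * w (a i))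
  row i with i ∈? Q
  ... | no  _   = z≤n
  ... | yes i∈Q = begin
    1 * (M !)                                         ≡⟨ *-identityˡ (M !) ⟩
    M !                                               ≡⟨ w-quotient (a i) (nonempty i i∈Q) (≤-trans (∣p∣≤n (g ∩ A i)) (m≤n+m n m)) ⟨
    a i * w (a i)                                     ≡⟨ cong (_* w (a i)) (card-∑ (g ∩ A i)) ⟩
    ∑ (allFin n) (λ x → 𝟙 (x ∈? (g ∩ A i))) * w (a i)   ≡⟨ ∑-*ʳ (allFin n) (w (a i)) _ ⟨
    ∑ (allFin n) (λ x → 𝟙 (x ∈? (g ∩ A i)) * w (a i))   ≤⟨ ∑-mono (allFin n) (λ {x} _ → *-monoˡ-≤ (w (a i)) (pointwise x)) ⟩
    ∑ (allFin n) (λ x → 𝟙 (yes i∈Q ×-dec (x ∈? (g ∩ A i))) * w (a i)) ∎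
    where
    pointwise : ∀ x → 𝟙 (x ∈? (g ∩ A i)) ≤ 𝟙 (yes i∈Q ×-dec (x ∈? (g ∩ A i)))
    pointwise x with x ∈? (g ∩ A i)
    ... | yes _ = ≤-refl
    ... | no  _ = z≤n
  -- In the absence of the wanted pair, `d x ≤ a i` at every incidence, so the weight read along
  -- rows is at most the weight read along columns. Rows then sum to M! per index in Q, columns to
  -- at most M! per point of g.
  exchange : ∀ i x → e i x * w (a i) ≤ e i x * w (d x)
  exchange i x with incident? i x
  ... | no  _            = z≤n
  ... | yes (i∈Q , x∈) = *-monoʳ-≤ 1 (w-antitone (d x) (a i) 0<d (d≤a i∈Q x∈) (≤-trans (∣p∣≤n (g ∩ A i)) (m≤n+m n m)))
    where
    0<d : 0 < d x
    0<d = subst (_≤ d x) (∣⁅x⁆∣≡1 i) (p⊆q⇒∣p∣≤∣q∣ (λ j∈ → subst (_∈ˢ containing A Q x) (sym (x∈⁅y⁆⇒x≡y i j∈))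
            (∈-comprehension⁺ (containing? A Q x) (i∈Q , proj₂ (x∈p∩q⁻ g (A i) x∈)))))
  column : ∀ x → ∑ (allFin m) (λ i → e i x * w (d x)) ≤ 𝟙 (x ∈? g) * (M !)
  column x = begin
    ∑ (allFin m) (λ i → e i x * w (d x))  ≡⟨ ∑-*ʳ (allFin m) (w (d x)) _ ⟩
    ∑ (allFin m) (λ i → e i x) * w (d x)  ≤⟨ bound (x ∈? g) ⟩
    𝟙 (x ∈? g) * (M !)                    ∎
    where
    e≤ : ∀ i → e i x ≤ 𝟙 (i ∈? containing A Q x)
    e≤ i with incident? i x
    ... | no  _          = z≤n
    ... | yes (i∈Q , x∈) = ≤-reflexive (sym (𝟙-yes (i ∈? containing A Q x)
            (∈-comprehension⁺ (containing? A Q x) (i∈Q , proj₂ (x∈p∩q⁻ g (A i) x∈)))))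
    bound : (x∈?g : Dec (x ∈ˢ g)) → ∑ (allFin m) (λ i → e i x) * w (d x) ≤ 𝟙 x∈?g * (M !)
    bound (no x∉g) = ≤-reflexive (cong (_* w (d x)) (trans (∑-cong (allFin m) (λ {i} _ → 𝟙-no (incident? i x)
      (x∉g ∘ proj₁ ∘ x∈p∩q⁻ g (A i) ∘ proj₂))) (∑-zero (allFin m))))
    bound (yes _)  = begin
      ∑ (allFin m) (λ i → e i x) * w (d x)  ≤⟨ *-monoˡ-≤ (w (d x)) (≤-trans (∑-mono (allFin m) (λ {i} _ → e≤ i)) (≤-reflexive (sym (card-∑ (containing A Q x))))) ⟩
      d x * w (d x)                         ≤⟨ degree (d x) (≤-trans (∣p∣≤n (containing A Q x)) (m≤m+n m n)) ⟩
      1 * (M !)                             ∎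
      where
      degree : ∀ r → r ≤ M → r * w r ≤ 1 * (M !)
      degree zero    _   = z≤n
      degree (suc r) r≤M = ≤-reflexive (trans (w-quotient (suc r) (s≤s z≤n) r≤M) (sym (*-identityˡ (M !))))
  M!Q≤M!g : (M !) * ∣ Q ∣ ≤ (M !) * ∣ g ∣
  M!Q≤M!g = begin
    (M !) * ∣ Q ∣                                         ≡⟨ *-comm (M !) ∣ Q ∣ ⟩
    ∣ Q ∣ * (M !)                                         ≡⟨ cong (_* (M !)) (card-∑ Q) ⟩
    ∑ (allFin m) (λ i → 𝟙 (i ∈? Q)) * (M !)               ≡⟨ ∑-*ʳ (allFin m) (M !) _ ⟨
    ∑ (allFin m) (λ i → 𝟙 (i ∈? Q) * (M !))               ≤⟨ ∑-mono (allFin m) (λ {i} _ → row i) ⟩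
    ∑ (allFin m) (λ i → ∑ (allFin n) (λ x → e i x * w (a i))) ≤⟨ ∑-mono (allFin m) (λ {i} _ → ∑-mono (allFin n) (λ {x} _ → exchange i x)) ⟩
    ∑ (allFin m) (λ i → ∑ (allFin n) (λ x → e i x * w (d x))) ≡⟨ ∑-swap (allFin m) (allFin n) _ ⟩
    ∑ (allFin n) (λ x → ∑ (allFin m) (λ i → e i x * w (d x))) ≤⟨ ∑-mono (allFin n) (λ {x} _ → column x) ⟩
    ∑ (allFin n) (λ x → 𝟙 (x ∈? g) * (M !))               ≡⟨ ∑-*ʳ (allFin n) (M !) _ ⟩
    ∑ (allFin n) (λ x → 𝟙 (x ∈? g)) * (M !)               ≡⟨ cong (_* (M !)) (card-∑ g) ⟨
    ∣ g ∣ * (M !)                                         ≡⟨ *-comm ∣ g ∣ (M !) ⟩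
    (M !) * ∣ g ∣                                         ∎

common-insert : ∀ (g : Subset n) (A : Fin m → Subset n) i D →
                common g A (⁅ i ⁆ ∪ D) ≡ common (g ∩ A i) A D
common-insert g A i D = ⊆-antisym to from
  where
  to : common g A (⁅ i ⁆ ∪ D) ⊆ common (g ∩ A i) A D
  to y∈ with ∈-comprehension⁻ (common? g A (⁅ i ⁆ ∪ D)) y∈
  ... | y∈g , y∈A = ∈-comprehension⁺ (common? (g ∩ A i) A D)
    (x∈p∩q⁺ (y∈g , y∈A i (x∈p∪q⁺ (inj₁ (x∈⁅x⁆ i)))) , λ l l∈D → y∈A l (x∈p∪q⁺ (inj₂ l∈D)))
  from : common (g ∩ A i) A D ⊆ common g A (⁅ i ⁆ ∪ D)
  from {y} y∈ with ∈-comprehension⁻ (common? (g ∩ A i) A D) y∈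
  ... | y∈gA , y∈A = ∈-comprehension⁺ (common? g A (⁅ i ⁆ ∪ D)) (proj₁ (x∈p∩q⁻ g (A i) y∈gA) , cover)
    where
    cover : ∀ l → l ∈ˢ ⁅ i ⁆ ∪ D → y ∈ˢ A l
    cover l l∈ with x∈p∪q⁻ ⁅ i ⁆ D l∈
    ... | inj₁ l∈i rewrite x∈⁅y⁆⇒x≡y i l∈i = proj₂ (x∈p∩q⁻ g (A i) y∈gA)
    ... | inj₂ l∈D = y∈A l l∈D

insert-⊆ : ∀ {i} {D Q : Subset m} → i ∈ˢ Q → D ⊆ Q → ⁅ i ⁆ ∪ D ⊆ Q
insert-⊆ {i = i} {D} i∈Q D⊆Q l∈ with x∈p∪q⁻ ⁅ i ⁆ D l∈
... | inj₁ l∈i rewrite x∈⁅y⁆⇒x≡y i l∈i = i∈Q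
... | inj₂ l∈D = D⊆Q l∈D

⟍-⊆ : ∀ (p : Subset n) x → p ⟍ x ⊆ p
⟍-⊆ p x = proj₁ ∘ x∈p⟍y⁻ p

card-insert-⟍ : ∀ {i} {D Q : Subset m} → D ⊆ Q ⟍ i → ∣ ⁅ i ⁆ ∪ D ∣ ≡ suc ∣ D ∣
card-insert-⟍ {i = i} {D} {Q} D⊆ = card-insert D (λ i∈D → proj₂ (x∈p⟍y⁻ Q (D⊆ i∈D)) refl)

-- Given an incident pair (i , x) with x of degree larger than ∣ g ∩ A i ∣, induct on the traces on
-- (g ∩ A i) ∖ x of the other sets containing x; putting i and x back adds one to both sides.
frankl-katona : ∀ r (g : Subset n) (Q : Subset m) (A : Fin m → Subset n) → ∣ g ∣ ≤ r → ∣ g ∣ < ∣ Q ∣ →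
                ∃[ D ] D ⊆ Q × suc ∣ common g A D ∣ ≡ ∣ D ∣
frankl-katona {n} {m} r g Q A g≤r g<Q with Fin.any? (λ i → (i ∈? Q) ×-dec (∣ g ∩ A i ∣ ≤? 0))
... | yes (i , i∈Q , empty) = ⁅ i ⁆ , (λ l∈ → subst (_∈ˢ Q) (sym (x∈⁅y⁆⇒x≡y i l∈)) i∈Q) ,
      trans (cong suc (n≤0⇒n≡0 (≤-trans (p⊆q⇒∣p∣≤∣q∣ incl) empty))) (sym (∣⁅x⁆∣≡1 i))
  where
  incl : common g A ⁅ i ⁆ ⊆ g ∩ A i
  incl y∈ with ∈-comprehension⁻ (common? g A ⁅ i ⁆) y∈
  ... | y∈g , y∈A = x∈p∩q⁺ (y∈g , y∈A i (x∈⁅x⁆ i))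
... | no nonempty with incident-pair g Q A g<Q (λ i i∈Q → ≰⇒> (λ empty → nonempty (i , i∈Q , empty)))
... | i , x , i∈Q , x∈g , x∈A , a<d = recurse r g≤r
  where
  x∈gA = x∈p∩q⁺ (x∈g , x∈A)
  gA≡ = card-⟍ (g ∩ A i) x∈gA
  Qₓ = containing A Q x
  i∈Qₓ = ∈-comprehension⁺ (containing? A Q x) (i∈Q , x∈A)
  recurse : ∀ r → ∣ g ∣ ≤ r → ∃[ D ] D ⊆ Q × suc ∣ common g A D ∣ ≡ ∣ D ∣
  recurse zero    g≤0 = ⊥-elim (<⇒≱ (subst (0 <_) (sym (card-⟍ g x∈g)) (s≤s z≤n)) g≤0)
  recurse (suc r) g≤r = extend (frankl-katona r ((g ∩ A i) ⟍ x) (Qₓ ⟍ i) A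
    (≤-pred (≤-trans (≤-reflexive (sym gA≡)) (≤-trans (∣p∩q∣≤∣p∣ g (A i)) g≤r)))
    (≤-pred (subst₂ _<_ gA≡ (card-⟍ Qₓ i∈Qₓ) a<d)))
    where
    extend : ∃[ D ] D ⊆ Qₓ ⟍ i × suc ∣ common ((g ∩ A i) ⟍ x) A D ∣ ≡ ∣ D ∣ → ∃[ D ] D ⊆ Q × suc ∣ common g A D ∣ ≡ ∣ D ∣
    extend (D , D⊆ , eq) = ⁅ i ⁆ ∪ D ,
      insert-⊆ i∈Q (proj₁ ∘ ∈-comprehension⁻ (containing? A Q x) ∘ ⟍-⊆ Qₓ i ∘ D⊆) ,
      (begin
        suc ∣ common g A (⁅ i ⁆ ∪ D) ∣              ≡⟨ cong (suc ∘ ∣_∣) (common-insert g A i D) ⟩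
        suc ∣ common (g ∩ A i) A D ∣                ≡⟨ cong suc (card-⟍ (common (g ∩ A i) A D) x∈common) ⟩
        suc (suc ∣ common (g ∩ A i) A D ⟍ x ∣)      ≡⟨ cong (λ c → suc (suc ∣ c ∣)) (⊆-antisym to from) ⟩
        suc (suc ∣ common ((g ∩ A i) ⟍ x) A D ∣)    ≡⟨ cong suc eq ⟩
        suc ∣ D ∣                                   ≡⟨ card-insert-⟍ D⊆ ⟨
        ∣ ⁅ i ⁆ ∪ D ∣                               ∎)
      where
      open ≡-Reasoning
      x∈common = ∈-comprehension⁺ (common? (g ∩ A i) A D)
        (x∈gA , λ l l∈D → proj₂ (∈-comprehension⁻ (containing? A Q x) (⟍-⊆ Qₓ i (D⊆ l∈D))))
      to : common (g ∩ A i) A D ⟍ x ⊆ common ((g ∩ A i) ⟍ x) A D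
      to y∈ with x∈p⟍y⁻ _ y∈
      ... | y∈c , y≢x with ∈-comprehension⁻ (common? (g ∩ A i) A D) y∈c
      ... | y∈gA , y∈A = ∈-comprehension⁺ (common? ((g ∩ A i) ⟍ x) A D) (x∈p⟍y⁺ y∈gA y≢x , y∈A)
      from : common ((g ∩ A i) ⟍ x) A D ⊆ common (g ∩ A i) A D ⟍ x
      from y∈ with ∈-comprehension⁻ (common? ((g ∩ A i) ⟍ x) A D) y∈
      ... | y∈gA , y∈A with x∈p⟍y⁻ (g ∩ A i) y∈gA
      ... | y∈gA′ , y≢x = x∈p⟍y⁺ (∈-comprehension⁺ (common? (g ∩ A i) A D) (y∈gA′ , y∈A)) y≢x

-- Each unit of the excess j is paid by forcing an arbitrary index i of Q into D: g shrinks to its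
-- trace on `A i`, Q loses one index, and the strict inequality survives with j lowered by one.
frankl-katona-+ : ∀ j (g : Subset n) (Q : Subset m) (A : Fin m → Subset n) → ∣ g ∣ + j < ∣ Q ∣ →
                  ∃[ D ] D ⊆ Q × suc (∣ common g A D ∣ + j) ≡ ∣ D ∣
frankl-katona-+ zero    g Q A g<Q with frankl-katona ∣ g ∣ g Q A ≤-refl (subst (_< ∣ Q ∣) (+-identityʳ ∣ g ∣) g<Q)
... | D , D⊆Q , eq = D , D⊆Q , trans (cong suc (+-identityʳ _)) eq
frankl-katona-+ (suc j) g Q A g<Q with ∃-nonempty Q (≤-trans (s≤s z≤n) g<Q)
... | i , i∈Q with frankl-katona-+ j (g ∩ A i) (Q ⟍ i) A
                     (≤-pred (≤-trans (s≤s (s≤s (+-monoˡ-≤ j (∣p∩q∣≤∣p∣ g (A i)))))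
                       (subst₂ _≤_ (cong suc (+-suc ∣ g ∣ j)) (card-⟍ Q i∈Q) g<Q)))
... | D , D⊆ , eq = ⁅ i ⁆ ∪ D , insert-⊆ i∈Q (⟍-⊆ Q i ∘ D⊆) ,
  trans (cong suc (+-suc _ j))
    (trans (cong suc (trans (cong (λ c → suc (∣ c ∣ + j)) (common-insert g A i D)) eq)) (sym (card-insert-⟍ D⊆)))

-- Intersection-closed families without members of a given size

private
  double : ∀ t r → (2 * t + 1) + r ≡ t + (t + suc r)
  double = solve 2 (λ t r → (con 2 :* t :+ con 1) :+ r := t :+ (t :+ (con 1 :+ r))) refl
    where open ℕ-Solver.+-*-Solver

  shuffle : ∀ a c d → suc (a + c) + d ≡ (suc d + a) + c
  shuffle = solve 3 (λ a c d → (con 1 :+ (a :+ c)) :+ d := ((con 1 :+ d) :+ a) :+ c) refl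
    where open ℕ-Solver.+-*-Solver

module _ {k : ℕ} (I : Subset k → Set) (I? : Decidable I) where

  -- In the application I consists of the kernels of a class, and every agreement set of two
  -- distinct members is a kernel. An uncovered set of positions therefore identifies the members of
  -- the class, and a small one makes the class small.
  Covered : Subset k → Set
  Covered W = ∃[ J ] I J × W ⊆ J

  covered? : Decidable Covered
  covered? W = anySubset? (λ J → I? J ×-dec (W ⊆? J))

  minimal-uncovered : ∀ r W → ∣ W ∣ ≤ r → ¬ Covered W → ∃[ W′ ] ¬ Covered W′ × (∀ x → x ∈ˢ W′ → Covered (W′ ⟍ x))
  minimal-uncovered r W W≤r ¬cov with Fin.any? (λ x → (x ∈? W) ×-dec ¬? (covered? (W ⟍ x)))
  ... | no none = W , ¬cov , λ x x∈C → decidable-stable (covered? (W ⟍ x)) (λ ¬cov′ → none (x , x∈C , ¬cov′))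
  ... | yes (x , x∈C , ¬cov′) = descend r W≤r
    where
    descend : ∀ r → ∣ W ∣ ≤ r → _
    descend zero    W≤r = ⊥-elim (<⇒≱ (subst (0 <_) (sym (card-⟍ W x∈C)) (s≤s z≤n)) W≤r)
    descend (suc r) W≤r = minimal-uncovered r (W ⟍ x) (≤-pred (subst (_≤ suc r) (card-⟍ W x∈C) W≤r)) ¬cov′

  module _ (∩-closed : ∀ J K → I J → I K → I (J ∩ K)) where

    -- A proper set J is the intersection of the sets `⊤ˢ ⟍ x` over x outside J. The induction on
    -- the complement stops at a single missing point, because `⊤ˢ` itself need not satisfy I.
    co-singletons⇒supersets : ∀ A → (∀ x → x ∉ˢ A → I (⊤ˢ ⟍ x)) → ∀ J → A ⊆ J → J ≢ ⊤ˢ → I J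
    co-singletons⇒supersets A co J A⊆J J≢⊤ = go ∣ ∁ J ∣ J ≤-refl A⊆J J≢⊤
      where
      go : ∀ r J → ∣ ∁ J ∣ ≤ r → A ⊆ J → J ≢ ⊤ˢ → I J
      go r J J≤r A⊆J J≢⊤ with ≢⇒⊈ ⊆⊤ J≢⊤
      ... | x , _ , x∉J with (⁅ x ⁆ ∪ J) ≟ˢ ⊤ˢ
      ...   | yes full = subst I (⊆-antisym ⊆J J⊆) (co x (x∉J ∘ A⊆J))
        where
        ⊆J : ⊤ˢ ⟍ x ⊆ J
        ⊆J {y} y∈ with x∈p∪q⁻ ⁅ x ⁆ J (subst (y ∈ˢ_) (sym full) ∈⊤)
        ... | inj₁ y∈x = ⊥-elim (proj₂ (x∈p⟍y⁻ ⊤ˢ y∈) (x∈⁅y⁆⇒x≡y x y∈x))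
        ... | inj₂ y∈J = y∈J
        J⊆ : J ⊆ ⊤ˢ ⟍ x
        J⊆ y∈J = x∈p⟍y⁺ ∈⊤ (λ { refl → x∉J y∈J })
      ...   | no  proper = subst I (⊆-antisym ⊆J J⊆) (∩-closed _ _ (step r J≤r) (co x (x∉J ∘ A⊆J)))
        where
        smaller : ∣ ∁ (⁅ x ⁆ ∪ J) ∣ < ∣ ∁ J ∣
        smaller = p⊂q⇒∣p∣<∣q∣ ((λ y∈ → x∉p⇒x∈∁p (λ y∈J → x∈∁p⇒x∉p y∈ (x∈p∪q⁺ (inj₂ y∈J)))) ,
                    x , x∉p⇒x∈∁p x∉J , (λ x∈ → x∈∁p⇒x∉p x∈ (x∈p∪q⁺ (inj₁ (x∈⁅x⁆ x)))))
        step : ∀ r → ∣ ∁ J ∣ ≤ r → I (⁅ x ⁆ ∪ J)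
        step zero    J≤r = ⊥-elim (<⇒≱ smaller (≤-trans J≤r z≤n))
        step (suc r) J≤r = go r (⁅ x ⁆ ∪ J) (≤-pred (≤-trans smaller J≤r)) (x∈p∪q⁺ ∘ inj₂ ∘ A⊆J) proper
        ⊆J : (⁅ x ⁆ ∪ J) ∩ (⊤ˢ ⟍ x) ⊆ J
        ⊆J y∈ with x∈p∩q⁻ (⁅ x ⁆ ∪ J) _ y∈
        ... | y∈₁ , y∈₂ with x∈p∪q⁻ ⁅ x ⁆ J y∈₁
        ... | inj₁ y∈x = ⊥-elim (proj₂ (x∈p⟍y⁻ ⊤ˢ y∈₂) (x∈⁅y⁆⇒x≡y x y∈x))
        ... | inj₂ y∈J = y∈J
        J⊆ : J ⊆ (⁅ x ⁆ ∪ J) ∩ (⊤ˢ ⟍ x)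
        J⊆ y∈J = x∈p∩q⁺ (x∈p∪q⁺ (inj₂ y∈J) , x∈p⟍y⁺ ∈⊤ (λ { refl → x∉J y∈J }))

    -- Starting from K instead of `⊤ˢ` makes every such intersection nonempty as an intersection, so
    -- that closure under binary intersections keeps it in I.
    ⋂⁺ : Subset k → (Fin k → Subset k) → List (Fin k) → Subset k
    ⋂⁺ K J = foldr (λ x M → J x ∩ M) K

    I-⋂⁺ : ∀ {K J} xs → I K → (∀ {x} → x ∈ xs → I (J x)) → I (⋂⁺ K J xs)
    I-⋂⁺ []       IK IJ = IK
    I-⋂⁺ (x ∷ xs) IK IJ = ∩-closed _ _ (IJ (here refl)) (I-⋂⁺ xs IK (IJ ∘ there))

    ∈-⋂⁺⁺ : ∀ {K J y} xs → y ∈ˢ K → (∀ {x} → x ∈ xs → y ∈ˢ J x) → y ∈ˢ ⋂⁺ K J xs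
    ∈-⋂⁺⁺ []       y∈K y∈J = y∈K
    ∈-⋂⁺⁺ (x ∷ xs) y∈K y∈J = x∈p∩q⁺ (y∈J (here refl) , ∈-⋂⁺⁺ xs y∈K (y∈J ∘ there))

    ∈-⋂⁺⁻ : ∀ {K J y} xs → y ∈ˢ ⋂⁺ K J xs → y ∈ˢ K × (∀ {x} → x ∈ xs → y ∈ˢ J x)
    ∈-⋂⁺⁻ []       y∈ = y∈ , λ ()
    ∈-⋂⁺⁻ {K} {J} (x ∷ xs) y∈ with x∈p∩q⁻ (J x) (⋂⁺ K J xs) y∈
    ... | y∈x , y∈xs with ∈-⋂⁺⁻ xs y∈xs
    ... | y∈K , y∈J = y∈K , λ { (here refl) → y∈x ; (there z∈) → y∈J z∈ }

    module _ {t r : ℕ} (no-t-1 : ∀ J → I J → suc ∣ J ∣ ≢ t)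
             (Q W : Subset k) (Q⊆W : Q ⊆ W) (W-uncovered : ¬ Covered W)
             (∣Q∣≡ : ∣ Q ∣ ≡ t + suc r) (∣∁Q∣≡ : ∣ ∁ Q ∣ ≡ t)
             (J : Fin k → Subset k) (IJ : ∀ {x} → x ∈ˢ Q → I (J x)) (⊆J : ∀ {x} → x ∈ˢ Q → W ⟍ x ⊆ J x) where

      x∉J : ∀ {x} → x ∈ˢ Q → x ∉ˢ J x
      x∉J {x} x∈Q x∈J = W-uncovered (J x , IJ x∈Q , W⊆J)
        where
        W⊆J : W ⊆ J x
        W⊆J {y} y∈C with y Fin.≟ x
        ... | yes refl = x∈J
        ... | no  y≢x  = ⊆J x∈Q (x∈p⟍y⁺ y∈C y≢x)
      -- Inside Q, `J x` misses x only. Suppose `J x₀` misses a point of the t-set `∁ Q`.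
      -- Frankl-Katona on the traces gives D with ∣ D ∣ = c + r + 1, where c points of `∁ Q` lie in
      -- `J x₀` and in all `J x` with x in D. The intersection M of these sets loses 1 + ∣ D ∣ of
      -- the t + r + 1 points of Q and keeps c points outside Q, so it has exactly t - 1 points,
      -- which is excluded.
      ∁Q⊆J : ∀ x → x ∈ˢ Q → ∁ Q ⊆ J x
      ∁Q⊆J x₀ x₀∈Q with ∁ Q ⊆? J x₀
      ... | yes p = p
      ... | no ¬p = ⊥-elim (no-t-1 M (I-⋂⁺ (elements D) (IJ x₀∈Q) (IJ ∘ D⊆Q)) sizeM)
        where
        smaller : suc ∣ ∁ Q ∩ J x₀ ∣ ≤ t
        smaller = subst (∣ ∁ Q ∩ J x₀ ∣ <_) ∣∁Q∣≡ (≤∧≢⇒< (∣p∩q∣≤∣p∣ (∁ Q) (J x₀))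
          (λ eq → ¬p (λ {y} y∈∁Q → proj₂ (x∈p∩q⁻ (∁ Q) (J x₀)
            (subst (y ∈ˢ_) (sym (⊆-card-≡ {p = ∁ Q ∩ J x₀} (proj₁ ∘ x∈p∩q⁻ (∁ Q) (J x₀)) (≤-reflexive (sym eq)))) y∈∁Q)))))
        -- The index `x₀` is held back since `J x₀` is already used to cut `∁ Q` down to at most t -
        -- 1 points; the remaining t + r indices still exceed this by more than r.
        fk = frankl-katona-+ r (∁ Q ∩ J x₀) (Q ⟍ x₀) J
          (≤-trans (+-monoˡ-≤ r smaller) (≤-reflexive (suc-injective
            (trans (sym (+-suc t r)) (trans (sym ∣Q∣≡) (card-⟍ Q x₀∈Q))))))
        D = proj₁ fk
        D⊆ = proj₁ (proj₂ fk)
        c = ∣ common (∁ Q ∩ J x₀) J D ∣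
        ∣D∣≡ : suc (c + r) ≡ ∣ D ∣
        ∣D∣≡ = proj₂ (proj₂ fk)
        D⊆Q : ∀ {x} → x ∈ elements D → x ∈ˢ Q
        D⊆Q x∈ = ⟍-⊆ Q x₀ (D⊆ (∈-elements⁻ D x∈))
        M = ⋂⁺ (J x₀) J (elements D)
        M-Q : ∣ Q ∣ ≡ ∣ ⁅ x₀ ⁆ ∪ D ∣ + ∣ M ∩ Q ∣
        M-Q = card-⊎ Q (⁅ x₀ ⁆ ∪ D) (M ∩ Q) split (insert-⊆ x₀∈Q (⟍-⊆ Q x₀ ∘ D⊆))
                (proj₂ ∘ x∈p∩q⁻ M Q) disjoint
          where
          split : ∀ {y} → y ∈ˢ Q → y ∈ˢ ⁅ x₀ ⁆ ∪ D ⊎ y ∈ˢ M ∩ Q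
          split {y} y∈Q with y ∈? (⁅ x₀ ⁆ ∪ D)
          ... | yes y∈ = inj₁ y∈
          ... | no  y∉ = inj₂ (x∈p∩q⁺ (∈-⋂⁺⁺ (elements D)
                  (⊆J x₀∈Q (x∈p⟍y⁺ (Q⊆W y∈Q) (λ { refl → y∉ (x∈p∪q⁺ (inj₁ (x∈⁅x⁆ x₀))) })))
                  (λ x∈ → ⊆J (D⊆Q x∈) (x∈p⟍y⁺ (Q⊆W y∈Q) (λ { refl → y∉ (x∈p∪q⁺ (inj₂ (∈-elements⁻ D x∈))) }))) , y∈Q))
          disjoint : ∀ {y} → y ∈ˢ ⁅ x₀ ⁆ ∪ D → y ∉ˢ M ∩ Q
          disjoint y∈ y∈MQ with x∈p∩q⁻ M Q y∈MQ
          ... | y∈M , y∈Q with ∈-⋂⁺⁻ (elements D) y∈M | x∈p∪q⁻ ⁅ x₀ ⁆ D y∈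
          ... | y∈₀ , _ | inj₁ y∈x₀ = x∉J x₀∈Q (subst (_∈ˢ J x₀) (x∈⁅y⁆⇒x≡y x₀ y∈x₀) y∈₀)
          ... | _ , y∈J | inj₂ y∈D  = x∉J y∈Q (y∈J (∈-elements⁺ y∈D))
        M∖Q : M ∩ ∁ Q ≡ common (∁ Q ∩ J x₀) J D
        M∖Q = ⊆-antisym to from
          where
          to : M ∩ ∁ Q ⊆ common (∁ Q ∩ J x₀) J D
          to y∈ with x∈p∩q⁻ M (∁ Q) y∈
          ... | y∈M , y∈∁Q with ∈-⋂⁺⁻ (elements D) y∈M
          ... | y∈₀ , y∈J = ∈-comprehension⁺ (common? (∁ Q ∩ J x₀) J D) (x∈p∩q⁺ (y∈∁Q , y∈₀) , λ x x∈D → y∈J (∈-elements⁺ x∈D))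
          from : common (∁ Q ∩ J x₀) J D ⊆ M ∩ ∁ Q
          from y∈ with ∈-comprehension⁻ (common? (∁ Q ∩ J x₀) J D) y∈
          ... | y∈∁Q₀ , y∈J with x∈p∩q⁻ (∁ Q) (J x₀) y∈∁Q₀
          ... | y∈∁Q , y∈₀ = x∈p∩q⁺ (∈-⋂⁺⁺ (elements D) y∈₀ (λ x∈ → y∈J _ (∈-elements⁻ D x∈)) , y∈∁Q)
        sizeM : suc ∣ M ∣ ≡ t
        sizeM = +-cancelʳ-≡ (suc (c + r)) (suc ∣ M ∣) t (begin
          suc ∣ M ∣ + suc (c + r)             ≡⟨ cong₂ (λ a b → suc a + b) (trans (card-split M Q) (cong (λ z → ∣ M ∩ Q ∣ + ∣ z ∣) M∖Q)) ∣D∣≡ ⟩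
          suc (∣ M ∩ Q ∣ + c) + ∣ D ∣         ≡⟨ shuffle (∣ M ∩ Q ∣) c (∣ D ∣) ⟩
          (suc ∣ D ∣ + ∣ M ∩ Q ∣) + c         ≡⟨ cong (λ z → (z + ∣ M ∩ Q ∣) + c) (card-insert-⟍ D⊆) ⟨
          (∣ ⁅ x₀ ⁆ ∪ D ∣ + ∣ M ∩ Q ∣) + c    ≡⟨ cong (_+ c) M-Q ⟨
          ∣ Q ∣ + c                           ≡⟨ cong (_+ c) ∣Q∣≡ ⟩
          (t + suc r) + c                     ≡⟨ +-assoc t (suc r) c ⟩
          t + (suc r + c)                     ≡⟨ cong (λ z → t + suc z) (+-comm r c) ⟩
          t + suc (c + r)                     ∎)
          where
          open ≡-Reasoning
      co-singleton : ∀ x → x ∉ˢ ∁ Q → I (⊤ˢ ⟍ x)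
      co-singleton x x∉A = subst I (⊆-antisym to from) (IJ x∈Q)
        where
        x∈Q = x∉∁p⇒x∈p x∉A
        to : J x ⊆ ⊤ˢ ⟍ x
        to y∈ = x∈p⟍y⁺ ∈⊤ (λ { refl → x∉J x∈Q y∈ })
        from : ⊤ˢ ⟍ x ⊆ J x
        from {y} y∈ with y ∈? Q
        ... | yes y∈Q = ⊆J x∈Q (x∈p⟍y⁺ (Q⊆W y∈Q) (proj₂ (x∈p⟍y⁻ ⊤ˢ y∈)))
        ... | no  y∉Q = ∁Q⊆J x x∈Q (x∉p⇒x∈∁p y∉Q)

    -- `⊤ˢ` is uncovered because members of I are proper. If all sets of k - t - 1 positions are
    -- covered, a minimal uncovered W has at least k - t of them; any k - t serve as Q, and the root
    -- is its complement. The hypothesis on k writes ∣ Q ∣ as t + (r + 1), with r the excess handed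
    -- to Frankl-Katona.
    uncovered⊎supersets : ∀ {t} → 2 * t + 1 ≤ k →
      (∀ J → I J → J ≢ ⊤ˢ) → (∀ J → I J → suc ∣ J ∣ ≢ t) →
      (∃[ S ] ∣ S ∣ ≡ k ∸ suc t × ¬ Covered S) ⊎
      (∃[ A ] ∣ A ∣ ≡ t × (∀ J → A ⊆ J → J ≢ ⊤ˢ → I J))
    uncovered⊎supersets {t} 2t+1≤k proper no-t-1
      with anySubset? (λ S → (∣ S ∣ ≟ k ∸ suc t) ×-dec ¬? (covered? S)) | m≤n⇒∃[o]m+o≡n 2t+1≤k
    ... | yes uncovered | _ = inj₁ uncovered
    ... | no  none | r , 2t+1+r≡k = inj₂ (structured (minimal-uncovered ∣ ⊤ˢ {k} ∣ ⊤ˢ ≤-refl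
              (λ { (J , IJ , ⊤⊆J) → proper J IJ (⊆-antisym ⊆⊤ ⊤⊆J) })))
      where
      k≡ : k ≡ t + (t + suc r)
      k≡ = trans (sym 2t+1+r≡k) (double t r)
      k∸t≡ : k ∸ t ≡ t + suc r
      k∸t≡ = trans (cong (_∸ t) k≡) (m+n∸m≡n t (t + suc r))
      suc-k∸1+t : suc (k ∸ suc t) ≡ k ∸ t
      suc-k∸1+t = sym (+-∸-assoc 1 {k} {suc t} (subst (suc t ≤_) (sym k≡)
                    (subst (_≤ t + (t + suc r)) (+-comm t 1) (+-monoʳ-≤ t (≤-trans (s≤s z≤n) (m≤n+m (suc r) t))))))
      large : ∀ W → ¬ Covered W → k ∸ t ≤ ∣ W ∣
      large W W-uncovered with k ∸ t ≤? ∣ W ∣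
      ... | yes p = p
      ... | no ¬p with superset-of-size W (≤-pred (subst (∣ W ∣ <_) (sym suc-k∸1+t) (≰⇒> ¬p))) (m∸n≤m k (suc t))
      ... | S , W⊆S , ∣S∣≡ = ⊥-elim (none (S , ∣S∣≡ , λ { (J , IJ , S⊆J) → W-uncovered (J , IJ , S⊆J ∘ W⊆S) }))
      structured : (∃[ W ] ¬ Covered W × (∀ x → x ∈ˢ W → Covered (W ⟍ x))) →
                   ∃[ A ] ∣ A ∣ ≡ t × (∀ J → A ⊆ J → J ≢ ⊤ˢ → I J)
      structured (W , W-uncovered , W-minimal) with subset-of-size W (large W W-uncovered)
      ... | Q , Q⊆W , ∣Q∣≡ = ∁ Q , ∣∁Q∣≡ , co-singletons⇒supersets (∁ Q)
              (co-singleton no-t-1 Q W Q⊆W W-uncovered (trans ∣Q∣≡ k∸t≡) ∣∁Q∣≡ (proj₁ ∘ choose)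
                (λ {x} x∈Q → proj₁ (proj₂ (choose x) x∈Q)) (λ {x} x∈Q → proj₂ (proj₂ (choose x) x∈Q)))
        where
        ∣∁Q∣≡ : ∣ ∁ Q ∣ ≡ t
        ∣∁Q∣≡ = trans (∣∁p∣≡n∸∣p∣ Q) (trans (cong (k ∸_) ∣Q∣≡) (m∸[m∸n]≡n (subst (t ≤_) (sym k≡) (m≤m+n t _))))
        choose : ∀ x → ∃[ J ] (x ∈ˢ Q → I J × W ⟍ x ⊆ J)
        choose x with x ∈? Q
        -- A default that makes the family of sets total; only its values on Q enter.
        ... | no  x∉Q = ⊤ˢ , λ x∈Q → ⊥-elim (x∉Q x∈Q)
        ... | yes x∈Q with W-minimal x (Q⊆W x∈Q)
        ... | J , IJ , ⊆J = J , λ _ → IJ , ⊆J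

-- Lists of bounded length over `Fin n` are finite in number; this makes being blocked decidable, so
-- that the peeling below can search for blocked tuples.
∃-bounded-list? : ∀ b {P : List (Fin n) → Set} → Decidable P → Dec (∃[ L ] length L ≤ b × P L)
∃-bounded-list? zero {P} P? = map′ (λ P[] → [] , z≤n , P[]) (λ { ([] , _ , P[]) → P[] }) (P? [])
∃-bounded-list? (suc b) {P} P? with P? [] | Fin.any? (λ i → ∃-bounded-list? b (λ L → P? (i ∷ L)))
... | yes P[] | _                     = yes ([] , z≤n , P[])
... | no _    | yes (i , L , L≤b , p) = yes (i ∷ L , s≤s L≤b , p)
... | no ¬P[] | no ¬p                 = no λ { ([] , _ , P[]) → ¬P[] P[]
                                             ; (i ∷ L , s≤s L≤b , p) → ¬p (i , L , L≤b , p) }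

-- Homogeneous families of tuples

Tuple : ℕ → ℕ → Set
Tuple n k = Vec (Fin n) k

Agree : Subset k → Tuple n k → Tuple n k → Set
Agree J f g = ∀ a → a ∈ˢ J → Vec.lookup f a ≡ Vec.lookup g a

agree? : (J : Subset k) (f g : Tuple n k) → Dec (Agree J f g)
agree? J f g = Fin.all? (λ a → (a ∈? J) →-dec (Vec.lookup f a Fin.≟ Vec.lookup g a))

Agree-trans : ∀ {J : Subset k} {f g h : Tuple n k} → Agree J f g → Agree J g h → Agree J f h
Agree-trans f~g g~h a a∈J = trans (f~g a a∈J) (g~h a a∈J)

Agree-sym : ∀ {J : Subset k} {f g : Tuple n k} → Agree J f g → Agree J g f
Agree-sym f~g a a∈J = sym (f~g a a∈J)

Hits : Subset k → List (Fin n) → Tuple n k → Set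
Hits J L g = ∃[ a ] a ∉ˢ J × Vec.lookup g a ∈ L

hits? : (J : Subset k) (L : List (Fin n)) (g : Tuple n k) → Dec (Hits J L g)
hits? J L g = Fin.any? (λ a → ¬? (a ∈? J) ×-dec (Vec.lookup g a ∈?ᴸ L))
  where open DecMembership Fin._≟_ renaming (_∈?_ to _∈?ᴸ_)

-- L may contain the points of f itself; then g is new at every position outside J.
Extends : ℕ → List (Tuple n k) → Subset k → Tuple n k → Set
Extends b F J f = ∀ L → length L ≤ b → ∃[ g ] g ∈ F × Agree J f g × ¬ Hits J L g

Blocked : ℕ → List (Tuple n k) → Subset k → Tuple n k → Set
Blocked b F J f = ∃[ L ] length L ≤ b × All (λ g → Agree J f g → Hits J L g) F

-- A positive form of: no two members agree exactly on J. For f ≡ g it only asks for a position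
-- outside J.
Separated : List (Tuple n k) → Subset k → Set
Separated F J = ∀ f g → f ∈ F → g ∈ F → Agree J f g → ∃[ a ] a ∉ˢ J × Vec.lookup f a ≡ Vec.lookup g a

blocked? : ∀ b (F : List (Tuple n k)) J f → Dec (Blocked b F J f)
blocked? b F J f = ∃-bounded-list? b (λ L → All.all? (λ g → agree? J f g →-dec hits? J L g) F)

¬blocked⇒extends : ∀ b (F : List (Tuple n k)) J f → ¬ Blocked b F J f → Extends b F J f
¬blocked⇒extends b F J f ¬blocked L L≤b with Any.any? (λ g → agree? J f g ×-dec ¬? (hits? J L g)) F
... | yes found = find found
... | no  none  = ⊥-elim (¬blocked (L , L≤b , All.tabulate λ {g} g∈F f~g →
                    decidable-stable (hits? J L g) λ ¬hit → none (lose g∈F (f~g , ¬hit))))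

Extends-⊆ : ∀ {b} {F G : List (Tuple n k)} {J f} → (∀ {g} → g ∈ F → g ∈ G) → Extends b F J f → Extends b G J f
Extends-⊆ F⊆G ext L L≤b with ext L L≤b
... | g , g∈F , rest = g , F⊆G g∈F , rest

-- A label (J , a , p) records that a tuple was discarded since its class under agreement
-- on J is blocked by a list whose p-th element is the entry of the tuple at a.
Label : ℕ → Set
Label k = Subset k × Fin k × ℕ

_≟ˡ_ : DecidableEquality (Maybe (Label k))
_≟ˡ_ = Maybe.≡-dec (Product.≡-dec _≟ˢ_ (Product.≡-dec Fin._≟_ _≟_))

record Peeling (b : ℕ) (alive : List (Subset k)) (F : List (Tuple n k)) : Set where
  field
    label   : Tuple n k → Maybe (Label k)
    extends : ∀ {J f} → J ∈ alive → f ∈ F → label f ≡ nothing →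
              Extends b (filter (λ g → label g ≟ˡ nothing) F) J f
    meets   : ∀ {J a p f g} → f ∈ F → g ∈ F → label f ≡ just (J , a , p) → label g ≡ just (J , a , p) →
              Agree J f g → a ∉ˢ J × Vec.lookup f a ≡ Vec.lookup g a
    bounded : ∀ {J a p f} → f ∈ F → label f ≡ just (J , a , p) → J ∈ alive × p < b

entry-at : ∀ {A : Set} (L : List A) (p : ℕ) → Maybe A
entry-at []      p       = nothing
entry-at (x ∷ L) zero    = just x
entry-at (x ∷ L) (suc p) = entry-at L p

entry-at-index : ∀ {A : Set} {L : List A} {x} → x ∈ L → ∃[ p ] p < length L × entry-at L p ≡ just x
entry-at-index (here refl) = zero , s≤s z≤n , refl
entry-at-index (there x∈) with entry-at-index x∈
... | p , p< , eq = suc p , s≤s p< , eq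

-- As long as some `f₀` is blocked at some `J₀` by a list L, all remaining tuples that agree with
-- `f₀` on `J₀` are removed at once. Hence tuples with a common label that agree on `J₀` leave in
-- the same round, their labels point into the same L, and a common index p gives a common entry at
-- position a. Removing whole groups is what makes labels from different rounds compatible.
peel : ∀ b (alive : List (Subset k)) r (F : List (Tuple n k)) → length F ≤ r → Peeling b alive F
peel {k} {n} b alive r F F≤r with Any.any? (λ f → Any.any? (λ J → blocked? b F J f) alive) F
... | no none = record
  { label   = λ _ → nothing
  ; extends = λ {J} {f} J∈ f∈ _ → Extends-⊆ {J = J} {f} (λ g∈ → ∈-filter⁺ (λ _ → nothing ≟ˡ nothing) g∈ refl)
                (¬blocked⇒extends b F J f (λ blocked → none (lose f∈ (lose J∈ blocked))))
  ; meets   = λ _ _ ()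
  ; bounded = λ _ ()
  }
... | yes found with find found
... | f₀ , f₀∈ , found′ with find found′
... | J₀ , J₀∈ , L , L≤b , group-hits = step r F≤r
  where
  rest? = λ g → ¬? (agree? J₀ f₀ g)
  F′ = filter rest? F
  step : ∀ r → length F ≤ r → Peeling b alive F
  step zero    F≤0 = ⊥-elim (<⇒≱ (∈-length f₀∈) F≤0)
  step (suc r) F≤r = record { label = label ; extends = extends ; meets = meets ; bounded = bounded }
    where
    P′ : Peeling b alive F′
    P′ = peel b alive r F′ (≤-pred (≤-trans (filter-notAll rest? F
           (lose f₀∈ (λ ¬f~f → ¬f~f (λ _ _ → refl)))) F≤r))
    module P′ = Peeling P′
    colour : ∀ g → Dec (Agree J₀ f₀ g) → Dec (Hits J₀ L g) → Maybe (Label k)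
    colour g (no _)  _                   = P′.label g
    -- Never reached on F: L hits every member of the group. The value only makes the labelling
    -- total.
    colour g (yes _) (no _)              = nothing
    colour g (yes _) (yes (a , _ , g∈L)) = just (J₀ , a , proj₁ (entry-at-index g∈L))
    label : Tuple n k → Maybe (Label k)
    label g = colour g (agree? J₀ f₀ g) (hits? J₀ L g)
    data View (g : Tuple n k) : Maybe (Label k) → Set where
      inside-group  : ∀ {a} → Agree J₀ f₀ g → a ∉ˢ J₀ → (g∈L : Vec.lookup g a ∈ L) → View g (just (J₀ , a , proj₁ (entry-at-index g∈L)))
      outside-group : g ∈ F′ → View g (P′.label g)
    view : ∀ {g} → g ∈ F → View g (label g)
    view {g} g∈F with agree? J₀ f₀ g | hits? J₀ L g
    ... | no f≁g  | _                     = outside-group (∈-filter⁺ rest? g∈F f≁g)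
    ... | yes f~g | yes (a , a∉J₀ , g∈L)  = inside-group f~g a∉J₀ g∈L
    ... | yes f~g | no ¬hit               = ⊥-elim (¬hit (All.lookup group-hits g∈F f~g))
    extends : ∀ {J f} → J ∈ alive → f ∈ F → label f ≡ nothing →
              Extends b (filter (λ g → label g ≟ˡ nothing) F) J f
    extends {J} {f} J∈ f∈F eq with label f | view f∈F
    ... | _ | outside-group f∈F′ = Extends-⊆ {J = J} {f} incl (P′.extends J∈ f∈F′ eq)
      where
      incl : ∀ {g} → g ∈ filter (λ g → P′.label g ≟ˡ nothing) F′ → g ∈ filter (λ g → label g ≟ˡ nothing) F
      incl {g} g∈ with ∈-filter⁻ (λ g → P′.label g ≟ˡ nothing) {xs = F′} g∈
      ... | g∈F′ , eq′ with ∈-filter⁻ rest? {xs = F} g∈F′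
      ... | g∈F , f≁g = ∈-filter⁺ (λ g → label g ≟ˡ nothing) g∈F label≡
        where
        label≡ : label g ≡ nothing
        label≡ with agree? J₀ f₀ g
        ... | no _    = eq′
        ... | yes f~g = ⊥-elim (f≁g f~g)
    meets : ∀ {J a p f g} → f ∈ F → g ∈ F → label f ≡ just (J , a , p) → label g ≡ just (J , a , p) →
            Agree J f g → a ∉ˢ J × Vec.lookup f a ≡ Vec.lookup g a
    meets {J} {a} {p} {f} {g} f∈F g∈F eq-f eq-g f~g with label f | label g | view f∈F | view g∈F
    ... | _ | _ | outside-group f∈F′ | outside-group g∈F′ = P′.meets f∈F′ g∈F′ eq-f eq-g f~g
    -- Equal labels force the later round to concern `J₀` as well; but then g agrees with `f₀` on
    -- `J₀` and would have left together with f.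
    ... | _ | _ | inside-group f₀~f _ _ | outside-group g∈F′ with refl ← eq-f =
      ⊥-elim (proj₂ (∈-filter⁻ rest? {xs = F} g∈F′) (Agree-trans {f = f₀} {f} {g} f₀~f f~g))
    ... | _ | _ | outside-group f∈F′ | inside-group f₀~g _ _ with refl ← eq-g =
      ⊥-elim (proj₂ (∈-filter⁻ rest? {xs = F} f∈F′) (Agree-trans {f = f₀} {g} {f} f₀~g (Agree-sym {f = f} {g} f~g)))
    ... | _ | _ | inside-group _ a∉J₀ f∈L | inside-group {a′} _ _ g∈L with refl ← eq-f =
      a∉J₀ , same {a′} {g∈L} eq-g
      where
      same : ∀ {a′} {g∈L : Vec.lookup g a′ ∈ L} → just (J₀ , a′ , proj₁ (entry-at-index g∈L)) ≡ just (J₀ , a , proj₁ (entry-at-index f∈L)) →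
             Vec.lookup f a ≡ Vec.lookup g a
      same {g∈L = g∈L} eq with entry-at-index f∈L | entry-at-index g∈L
      ... | _ , _ , at-f | _ , _ , at-g with refl ← eq = Maybe.just-injective (trans (sym at-f) at-g)
    bounded : ∀ {J a p f} → f ∈ F → label f ≡ just (J , a , p) → J ∈ alive × p < b
    bounded {f = f} f∈F eq with label f | view f∈F
    ... | _ | outside-group f∈F′ = P′.bounded f∈F′ eq
    ... | _ | inside-group _ _ g∈L with refl ← eq = J₀∈ , ≤-trans (proj₁ (proj₂ (entry-at-index g∈L))) L≤b

length-cartesianProduct : ∀ {A B : Set} (xs : List A) (ys : List B) → length (cartesianProduct xs ys) ≡ length xs * length ys
length-cartesianProduct xs ys = begin
  length (cartesianProduct xs ys)          ≡⟨ length-∑ (cartesianProduct xs ys) ⟨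
  ∑ (cartesianProduct xs ys) (λ _ → 1)     ≡⟨ ∑-cartesianProductWith _,_ xs ys (λ _ → 1) ⟩
  ∑ xs (λ _ → ∑ ys (λ _ → 1))              ≡⟨ ∑-const xs _ ⟩
  length xs * ∑ ys (λ _ → 1)               ≡⟨ cong (length xs *_) (length-∑ ys) ⟩
  length xs * length ys                    ∎
  where open ≡-Reasoning

gather : ∀ {A B : Set} {Q : A → List B → Set} (ls : List A) Y →
         (∀ {l} → l ∈ ls → ∃[ R ] length R ≤ Y × Q l R) →
         ∃[ R ] length R ≤ length ls * Y × (∀ {l} → l ∈ ls → ∃[ R′ ] Q l R′ × (∀ {x} → x ∈ R′ → x ∈ R))
gather []       Y choose = [] , z≤n , λ ()
gather (l ∷ ls) Y choose with choose (here refl) | gather ls Y (λ l∈ → choose (there l∈))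
... | R₁ , R₁≤ , q | R₂ , R₂≤ , qs = R₁ ++ R₂ ,
  subst (_≤ Y + length ls * Y) (sym (length-++ R₁)) (+-mono-≤ R₁≤ R₂≤) , λ where
    (here refl) → R₁ , q , ∈-++⁺ˡ
    (there l∈)  → proj₁ (qs l∈) , proj₁ (proj₂ (qs l∈)) , λ {x} x∈ → ∈-++⁺ʳ R₁ (proj₂ (proj₂ (qs l∈)) x∈)

record Homogeneous (b : ℕ) (alive : List (Subset k)) (G : List (Tuple n k)) : Set where
  field
    extends   : ∀ {J f} → J ∈ alive → f ∈ G → Extends b G J f
    separated : ∀ J → J ≢ ⊤ˢ → J ∈ alive ⊎ Separated G J

-- A bound on the number of classes: one class of survivors and at most (number of alive sets) · k ·
-- b classes of discarded tuples, each with one alive set fewer.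
parts : ℕ → ℕ → ℕ → ℕ
parts k b zero    = 1
parts k b (suc u) = 1 + suc u * (k * b) * parts k b u

module _ {b : ℕ} {F₀ : List (Tuple n k)} {Ok : Tuple n k → Set} {X : ℕ}
         (dichotomy : ∀ {alive G} → (∀ {g} → g ∈ G → g ∈ F₀) → Unique G → Homogeneous b alive G →
                      (∀ {f} → f ∈ G → Ok f) ⊎ length G ≤ X) where

  -- The survivors of one peeling are homogeneous for the current alive sets. A class of discarded
  -- tuples labelled (J , a , p) is separated at J, so J moves from the alive sets to the separated
  -- ones and the recursion ends. R gathers the classes that the dichotomy declares small.
  partition : ∀ u alive F → length alive ≤ u → (∀ {f} → f ∈ F → f ∈ F₀) → Unique F →
              (∀ J → J ≢ ⊤ˢ → J ∈ alive ⊎ Separated F J) →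
              ∃[ R ] length R ≤ parts k b u * X × (∀ {f} → f ∈ F → f ∈ R ⊎ Ok f)
  partition u alive F alive≤u F⊆F₀ uniq separated = combine undiscarded (gather labels _ discarded)
    where
    open Peeling (peel b alive (length F) F ≤-refl)
    class : Maybe (Label k) → List (Tuple n k)
    class l = filter (λ g → label g ≟ˡ l) F
    class⁻ : ∀ {l f} → f ∈ class l → f ∈ F × label f ≡ l
    class⁻ {l} = ∈-filter⁻ (λ g → label g ≟ˡ l) {xs = F}
    class⁺ : ∀ {l f} → f ∈ F → label f ≡ l → f ∈ class l
    class⁺ {l} = ∈-filter⁺ (λ g → label g ≟ˡ l)
    class-unique : ∀ {l} → Unique (class l)
    class-unique {l} = Unique.filter⁺ (λ g → label g ≟ˡ l) uniq
    labels : List (Label k)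
    labels = cartesianProduct alive (cartesianProduct (allFin k) (upTo b))
    smaller : ℕ → ℕ
    -- Without alive sets there are no labels; the value 0 matches `parts k b zero ≡ 1`, where only
    -- the survivors count.
    smaller zero    = 0
    smaller (suc u) = parts k b u * X
    undiscarded : ∃[ R ] length R ≤ X × (∀ {f} → f ∈ class nothing → f ∈ R ⊎ Ok f)
    undiscarded with dichotomy {alive} {class nothing} (F⊆F₀ ∘ proj₁ ∘ class⁻) class-unique homogeneous
      where
      homogeneous : Homogeneous b alive (class nothing)
      homogeneous = record
        { extends   = λ J∈ f∈ → extends J∈ (proj₁ (class⁻ f∈)) (proj₂ (class⁻ f∈))
        ; separated = λ J J≢⊤ → Sum.map₂ (λ sep f g f∈ g∈ → sep f g (proj₁ (class⁻ f∈)) (proj₁ (class⁻ g∈))) (separated J J≢⊤)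
        }
    ... | inj₁ ok = [] , z≤n , inj₂ ∘ ok
    ... | inj₂ ≤X = class nothing , ≤X , inj₁
    discarded : ∀ {l} → l ∈ labels → ∃[ R ] length R ≤ smaller u × (∀ {f} → f ∈ class (just l) → f ∈ R ⊎ Ok f)
    discarded {J , a , p} l∈ = recurse u alive≤u
      where
      J∈ : J ∈ alive
      J∈ = proj₁ (∈-cartesianProduct⁻ alive _ l∈)
      fewer? = λ J′ → ¬? (J′ ≟ˢ J)
      recurse : ∀ u → length alive ≤ u → ∃[ R ] length R ≤ smaller u × (∀ {f} → f ∈ class (just (J , a , p)) → f ∈ R ⊎ Ok f)
      recurse zero    alive≤0 = ⊥-elim (<⇒≱ (∈-length J∈) alive≤0)
      recurse (suc u) alive≤u = partition u (filter fewer? alive) (class (just (J , a , p)))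
        (≤-pred (≤-trans (filter-notAll fewer? alive (lose J∈ (λ J≢J → J≢J refl))) alive≤u))
        (F⊆F₀ ∘ proj₁ ∘ class⁻) class-unique separated′
        where
        separated′ : ∀ J′ → J′ ≢ ⊤ˢ → J′ ∈ filter fewer? alive ⊎ Separated (class (just (J , a , p))) J′
        separated′ J′ J′≢⊤ with J′ ≟ˢ J
        ... | yes refl = inj₂ λ f g f∈ g∈ f~g →
                a , meets (proj₁ (class⁻ f∈)) (proj₁ (class⁻ g∈)) (proj₂ (class⁻ f∈)) (proj₂ (class⁻ g∈)) f~g
        ... | no J′≢J with separated J′ J′≢⊤
        ...   | inj₁ J′∈ = inj₁ (∈-filter⁺ fewer? J′∈ J′≢J)
        ...   | inj₂ sep = inj₂ λ f g f∈ g∈ → sep f g (proj₁ (class⁻ f∈)) (proj₁ (class⁻ g∈))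
    combine : (∃[ R ] length R ≤ X × (∀ {f} → f ∈ class nothing → f ∈ R ⊎ Ok f)) →
              (∃[ R ] length R ≤ length labels * smaller u ×
                (∀ {l} → l ∈ labels → ∃[ R′ ] (∀ {f} → f ∈ class (just l) → f ∈ R′ ⊎ Ok f) × (∀ {x} → x ∈ R′ → x ∈ R))) →
              ∃[ R ] length R ≤ parts k b u * X × (∀ {f} → f ∈ F → f ∈ R ⊎ Ok f)
    combine (R₁ , R₁≤ , cover₁) (R₂ , R₂≤ , cover₂) = R₁ ++ R₂ ,
      subst (_≤ parts k b u * X) (sym (length-++ R₁)) (total u alive≤u R₂≤) , cover
      where
      open ≤-Reasoning
      length-labels : length labels ≡ length alive * (k * b)
      length-labels = trans (length-cartesianProduct alive _) (cong (length alive *_)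
        (trans (length-cartesianProduct (allFin k) (upTo b)) (cong₂ _*_ (length-tabulate {n = k} (λ a → a)) (length-upTo b))))
      total : ∀ u → length alive ≤ u → length R₂ ≤ length labels * smaller u → length R₁ + length R₂ ≤ parts k b u * X
      total zero    _       R₂≤ = +-mono-≤ R₁≤ (≤-trans R₂≤ (≤-reflexive (*-zeroʳ (length labels))))
      total (suc u) alive≤u R₂≤ = +-mono-≤ R₁≤ (begin
        length R₂                                       ≤⟨ R₂≤ ⟩
        length labels * (parts k b u * X)               ≡⟨ cong (_* (parts k b u * X)) length-labels ⟩
        length alive * (k * b) * (parts k b u * X)      ≤⟨ *-monoˡ-≤ (parts k b u * X) (*-monoˡ-≤ (k * b) alive≤u) ⟩
        suc u * (k * b) * (parts k b u * X)             ≡⟨ *-assoc (suc u * (k * b)) (parts k b u) X ⟨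
        suc u * (k * b) * parts k b u * X               ∎)
      cover : ∀ {f} → f ∈ F → f ∈ R₁ ++ R₂ ⊎ Ok f
      cover {f} f∈F with label f in eq
      ... | nothing = Sum.map₁ ∈-++⁺ˡ (cover₁ (class⁺ f∈F eq))
      ... | just (J , a , p) with bounded f∈F eq
      ... | J∈ , p<b with cover₂ (∈-cartesianProduct⁺ J∈ (∈-cartesianProduct⁺ (∈-allFin a) (∈-upTo⁺ p<b)))
      ... | R′ , cover′ , R′⊆R₂ = Sum.map₁ (∈-++⁺ʳ R₁ ∘ R′⊆R₂) (cover′ (class⁺ f∈F eq))

allSubsets : ∀ k → List (Subset k)
allSubsets = allVecs (inside ∷ outside ∷ [])

∈-allSubsets : (J : Subset k) → J ∈ allSubsets k
∈-allSubsets = ∈-allVecs (inside ∷ outside ∷ []) λ { true → here refl ; false → there (here refl) }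

-- Sunflowers from expandable sets

Expandable : ℕ → List (Subset n) → Subset n → Set
Expandable b 𝓕 S = ∀ L → length L ≤ b → ∃[ H ] H ∈ 𝓕 × S ⊆ H × (∀ {x} → x ∈ L → x ∈ˢ H → x ∈ˢ S)

points : ∀ {s} → (Fin s → Subset n) → List (Fin n)
points {s = zero}  S = []
points {s = suc s} S = elements (S zero) ++ points (S ∘ suc)

length-points : ∀ {s} (S : Fin s → Subset n) → (∀ i → ∣ S i ∣ ≤ k) → length (points S) ≤ s * k
length-points {s = zero}  S S≤k = z≤n
length-points {s = suc s} S S≤k = ≤-trans (≤-reflexive (length-++ (elements (S zero))))
  (+-mono-≤ (≤-trans (≤-reflexive (length-elements (S zero))) (S≤k zero)) (length-points (S ∘ suc) (S≤k ∘ suc)))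

∈-points : ∀ {s} (S : Fin s → Subset n) i {x} → x ∈ˢ S i → x ∈ points S
∈-points S zero    x∈ = ∈-++⁺ˡ (∈-elements⁺ x∈)
∈-points S (suc i) x∈ = ∈-++⁺ʳ (elements (S zero)) (∈-points (S ∘ suc) i x∈)

-- Greedy choice. The first set avoids the points of all later `S i`, and the later sets avoid the
-- first one. A common point of `H₀` and a later `H j` therefore lies in `S j`, and then in
-- `S zero`. Each choice adds k points to the forbidden list, which the budget `s * k` covers.
expand : ∀ {b s} {𝓕 : List (Subset n)} → All (λ F → ∣ F ∣ ≡ k) 𝓕 →
         (S : Fin s → Subset n) → (∀ i → ∣ S i ∣ ≤ k) → (∀ i → Expandable b 𝓕 (S i)) →
         ∀ avoid → length avoid + s * k ≤ b →
         Σ[ H ∈ (Fin s → Subset n) ] (∀ i → H i ∈ 𝓕) × (∀ i → S i ⊆ H i) ×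
         (∀ i {x} → x ∈ avoid → x ∈ˢ H i → x ∈ˢ S i) ×
         (∀ {i j} → i ≢ j → H i ∩ H j ⊆ S i ∩ S j)
expand {s = zero} sized S S≤k expandable avoid bound = (λ ()) , (λ ()) , (λ ()) , (λ ()) , (λ { {()} })
expand {n} {k} {b} {suc s} {𝓕} sized S S≤k expandable avoid bound
  with expandable zero (avoid ++ points (S ∘ suc))
         (≤-trans (≤-reflexive (length-++ avoid)) (≤-trans (+-monoʳ-≤ (length avoid)
           (≤-trans (length-points (S ∘ suc) (S≤k ∘ suc)) (m≤n+m (s * k) k))) bound))
... | H₀ , H₀∈ , S₀⊆H₀ , avoids₀
  with expand sized (S ∘ suc) (S≤k ∘ suc) (expandable ∘ suc) (avoid ++ elements H₀)
         (≤-trans (≤-reflexive (trans (cong (_+ s * k) (trans (length-++ avoid)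
           (cong (length avoid +_) (trans (length-elements H₀) (All.lookup sized H₀∈)))))
           (+-assoc (length avoid) k (s * k)))) bound)
... | H , H∈ , S⊆H , avoids , meets = H′ , H′∈ , S⊆H′ , avoids′ , λ {i} {j} → meets′ i j
  where
  H′ : Fin (suc s) → Subset n
  H′ zero    = H₀
  H′ (suc i) = H i
  H′∈ : ∀ i → H′ i ∈ 𝓕
  H′∈ zero    = H₀∈
  H′∈ (suc i) = H∈ i
  S⊆H′ : ∀ i → S i ⊆ H′ i
  S⊆H′ zero    = S₀⊆H₀
  S⊆H′ (suc i) = S⊆H i
  avoids′ : ∀ i {x} → x ∈ avoid → x ∈ˢ H′ i → x ∈ˢ S i
  avoids′ zero    x∈ = avoids₀ (∈-++⁺ˡ x∈)
  avoids′ (suc i) x∈ = avoids i (∈-++⁺ˡ x∈)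
  meet₀ : ∀ j {x} → x ∈ˢ H₀ → x ∈ˢ H j → x ∈ˢ S zero × x ∈ˢ S (suc j)
  meet₀ j x∈₀ x∈ⱼ = avoids₀ (∈-++⁺ʳ avoid (∈-points (S ∘ suc) j x∈Sⱼ)) x∈₀ , x∈Sⱼ
    where x∈Sⱼ = avoids j (∈-++⁺ʳ avoid (∈-elements⁺ x∈₀)) x∈ⱼ
  meets′ : ∀ i j → i ≢ j → H′ i ∩ H′ j ⊆ S i ∩ S j
  meets′ zero    zero    i≢j = ⊥-elim (i≢j refl)
  meets′ zero    (suc j) i≢j x∈ with x∈p∩q⁻ H₀ (H j) x∈
  ... | x∈₀ , x∈ⱼ = x∈p∩q⁺ (meet₀ j x∈₀ x∈ⱼ)
  meets′ (suc i) zero    i≢j x∈ with x∈p∩q⁻ (H i) H₀ x∈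
  ... | x∈ᵢ , x∈₀ = x∈p∩q⁺ (proj₂ (meet₀ i x∈₀ x∈ᵢ) , proj₁ (meet₀ i x∈₀ x∈ᵢ))
  meets′ (suc i) (suc j) i≢j = meets (i≢j ∘ cong suc)

∈-core⁺ : ∀ {s} (P : Fin s → Subset n) {x} → (∀ i → x ∈ˢ P i) → x ∈ˢ core P
∈-core⁺ {s = zero}  P x∈ = ∈⊤
∈-core⁺ {s = suc s} P x∈ = x∈p∩q⁺ (x∈ zero , ∈-core⁺ (P ∘ suc) (x∈ ∘ suc))

∈-core⁻ : ∀ {s} (P : Fin s → Subset n) {x} → x ∈ˢ core P → ∀ i → x ∈ˢ P i
∈-core⁻ {s = suc s} P x∈ zero    = proj₁ (x∈p∩q⁻ (P zero) (core (P ∘ suc)) x∈)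
∈-core⁻ {s = suc s} P x∈ (suc i) = ∈-core⁻ (P ∘ suc) (proj₂ (x∈p∩q⁻ (P zero) (core (P ∘ suc)) x∈)) i

another : ∀ {s} → 2 ≤ s → (i : Fin s) → ∃[ j ] i ≢ j
another (s≤s (s≤s _)) zero    = suc zero , λ ()
another (s≤s (s≤s _)) (suc i) = zero , λ ()

sunflower : ∀ {s} → 2 ≤ s → (H : Fin s → Subset n) (K : Subset n) → (∀ i → ∣ K ∣ < ∣ H i ∣) →
            (∀ {i j} → i ≢ j → H i ∩ H j ≡ K) → IsSunflower H × core H ≡ K
sunflower {n} {s} 2≤s H K K<H meets = record { distinct = distinct ; meet = λ i≢j → trans (meets i≢j) (sym core≡K) } , core≡K
  where
  K⊆H : ∀ i → K ⊆ H i
  K⊆H i x∈K with another 2≤s i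
  ... | j , i≢j = proj₁ (x∈p∩q⁻ (H i) (H j) (subst (_ ∈ˢ_) (sym (meets i≢j)) x∈K))
  core⊆K : ∀ {s} → 2 ≤ s → (H : Fin s → Subset n) → (∀ {i j} → i ≢ j → H i ∩ H j ≡ K) → core H ⊆ K
  core⊆K (s≤s (s≤s _)) H meets x∈ = subst (_ ∈ˢ_) (meets {zero} {suc zero} (λ ()))
    (x∈p∩q⁺ (∈-core⁻ H x∈ zero , ∈-core⁻ H x∈ (suc zero)))
  core≡K : core H ≡ K
  core≡K = ⊆-antisym (core⊆K 2≤s H meets) (λ x∈K → ∈-core⁺ H (λ i → K⊆H i x∈K))
  distinct : ∀ {i j} → H i ≡ H j → i ≡ j
  distinct {i} {j} Hᵢ≡Hⱼ with i Fin.≟ j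
  ... | yes i≡j = i≡j
  ... | no  i≢j = ⊥-elim (<⇒≱ (K<H i) (subst (λ p → ∣ H i ∣ ≤ ∣ p ∣) (meets i≢j)
                    (p⊆q⇒∣p∣≤∣q∣ (λ x∈ → x∈p∩q⁺ (x∈ , subst (_ ∈ˢ_) Hᵢ≡Hⱼ x∈)))))

expandable⇒sunflower : 2 ≤ s → (𝓕 : Family n k) (S : Subset n) → ∣ S ∣ < k → Expandable (s * k) (sets 𝓕) S →
                       HasSunflowerWithCoreSize s ∣ S ∣ 𝓕
expandable⇒sunflower {s} {n} {k} 2≤s 𝓕 S S<k expandable
  with expand (uniform 𝓕) (λ (_ : Fin s) → S) (λ _ → <⇒≤ S<k) (λ _ → expandable) [] ≤-refl
... | H , H∈ , S⊆H , _ , meets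
  with sunflower 2≤s H S (λ i → subst (∣ S ∣ <_) (sym (All.lookup (uniform 𝓕) (H∈ i))) S<k)
         (λ {i} {j} i≢j → ⊆-antisym (λ x∈ → proj₁ (x∈p∩q⁻ S S (meets i≢j x∈))) (λ x∈ → x∈p∩q⁺ (S⊆H i x∈ , S⊆H j x∈)))
... | isSunflower , core≡S = H , H∈ , isSunflower , cong ∣_∣ core≡S

-- Roots and sunflowers of roots

record Root (b t : ℕ) (𝓕 : List (Subset n)) (F A : Subset n) : Set where
  field
    A⊆F        : A ⊆ F
    size-A     : ∣ A ∣ ≡ t
    expandable : ∀ S → A ⊆ S → S ⊆ F → S ≢ F → Expandable b 𝓕 S

-- E is the supply of points with which the core of a sunflower of roots is padded. The member F may
-- depend on A; only E is common to all roots, which is why roots belonging to different sets D and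
-- D′ can be treated together.
record Linked (b t : ℕ) (𝓕 : List (Subset n)) (E A : Subset n) : Set where
  field
    F    : Subset n
    F∈   : F ∈ 𝓕
    root : Root b t 𝓕 F A
    E⊆F  : E ⊆ F
    E∩A  : ∀ {x} → x ∈ˢ E → x ∉ˢ A

core-size : 2 ≤ s → (A : Fin s → Subset n) → (∀ i → ∣ A i ∣ ≡ t) → IsSunflower A → ∣ core A ∣ < t
core-size {n = n} {t} (s≤s (s≤s _)) A ∣A∣≡t isSunflower with ∣ core A ∣ <? t
... | yes p = p
... | no ¬p = ⊥-elim (zero≢suc (IsSunflower.distinct isSunflower (trans (sym (absorb zero)) (absorb (suc zero)))))
  where
  zero≢suc : ∀ {m} {i : Fin m} → zero ≢ suc i
  zero≢suc ()
  absorb : ∀ i → core A ≡ A i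
  absorb i = ⊆-card-≡ (λ x∈ → ∈-core⁻ A x∈ i) (≤-trans (≤-reflexive (∣A∣≡t i)) (≮⇒≥ ¬p))

module _ (2≤s : 2 ≤ s) (1≤t : 1 ≤ t) (2t≤k : 2 * t ≤ k) (𝓕 : Family n k) (E : Subset n)
         (A : Fin s → Subset n) (A-sunflower : IsSunflower A) (linked : ∀ i → Linked (s * k) t (sets 𝓕) E (A i)) where

  private
    module L i = Linked (linked i)
    module R i = Root (L.root i)

    core∩E : ∀ {x} → x ∈ˢ core A → x ∉ˢ E
    core∩E = disjoint 2≤s A L.E∩A
      where
      disjoint : ∀ {s} → 2 ≤ s → (A : Fin s → Subset n) → (∀ i {x} → x ∈ˢ E → x ∉ˢ A i) → ∀ {x} → x ∈ˢ core A → x ∉ˢ E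
      disjoint (s≤s (s≤s _)) A E∩A x∈ x∈E = E∩A zero x∈E (∈-core⁻ A x∈ zero)

    -- The sets Aᵢ ∪ E′ are expandable, and E′ brings the size of the core up to t − 1.
    expand-linked : ∀ E′ → E′ ⊆ E → ∣ E′ ∣ ≡ t ∸ 1 ∸ ∣ core A ∣ → HasSunflowerWithCoreSize s (t ∸ 1) 𝓕
    expand-linked E′ E′⊆E ∣E′∣≡ = conclude (expand (uniform 𝓕) S (λ i → <⇒≤ (S<k i)) S-expandable [] ≤-refl)
      where
      S : Fin s → Subset n
      S i = A i ∪ E′
      E′<t : ∣ E′ ∣ < t
      E′<t = ≤-trans (s≤s (≤-trans (≤-reflexive ∣E′∣≡) (m∸n≤m (t ∸ 1) ∣ core A ∣))) (≤-reflexive (m+[n∸m]≡n 1≤t))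
      -- A padded root has at most t + (t - 1) points, so it is a proper subset of its member and
      -- the root property applies to it.
      S<k : ∀ i → ∣ S i ∣ < k
      S<k i = ≤-trans (≤-reflexive (cong suc (card-∪ (A i) E′ (λ x∈A x∈E′ → L.E∩A i (E′⊆E x∈E′) x∈A))))
        (≤-trans (≤-reflexive (sym (+-suc ∣ A i ∣ ∣ E′ ∣)))
        (≤-trans (+-mono-≤ (≤-reflexive (R.size-A i)) E′<t)
        (≤-trans (≤-reflexive (cong (t +_) (sym (+-identityʳ t)))) 2t≤k)))
      S-expandable : ∀ i → Expandable (s * k) (sets 𝓕) (S i)
      S-expandable i = R.expandable i (S i) (x∈p∪q⁺ ∘ inj₁) S⊆F
        (λ S≡F → <⇒≢ (S<k i) (trans (cong ∣_∣ S≡F) (All.lookup (uniform 𝓕) (L.F∈ i))))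
        where
        S⊆F : S i ⊆ L.F i
        S⊆F x∈ with x∈p∪q⁻ (A i) E′ x∈
        ... | inj₁ x∈A  = R.A⊆F i x∈A
        ... | inj₂ x∈E′ = L.E⊆F i (E′⊆E x∈E′)
      K : Subset n
      K = core A ∪ E′
      ∣K∣≡ : ∣ K ∣ ≡ t ∸ 1
      ∣K∣≡ = trans (card-∪ (core A) E′ (λ x∈K x∈E′ → core∩E x∈K (E′⊆E x∈E′)))
        (trans (cong (∣ core A ∣ +_) ∣E′∣≡) (m+[n∸m]≡n
          (≤-pred (≤-trans (core-size 2≤s A R.size-A A-sunflower) (≤-reflexive (sym (m+[n∸m]≡n 1≤t)))))))
      K<k : ∣ K ∣ < k
      K<k = ≤-trans (≤-reflexive (trans (cong suc ∣K∣≡) (m+[n∸m]≡n 1≤t))) (≤-trans (m≤m+n t _) 2t≤k)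
      conclude : Σ[ H ∈ (Fin s → Subset n) ] (∀ i → H i ∈ sets 𝓕) × (∀ i → S i ⊆ H i) ×
                 (∀ i {x} → x ∈ [] → x ∈ˢ H i → x ∈ˢ S i) × (∀ {i j} → i ≢ j → H i ∩ H j ⊆ S i ∩ S j) →
                 HasSunflowerWithCoreSize s (t ∸ 1) 𝓕
      conclude (H , H∈ , S⊆H , _ , meets) = H , H∈ , proj₁ is-sunflower , trans (cong ∣_∣ (proj₂ is-sunflower)) ∣K∣≡
        where
        ⊆meet : ∀ i j → K ⊆ H i ∩ H j
        ⊆meet i j {x} x∈ = x∈p∩q⁺ (member i , member j)
          where
          member : ∀ i → x ∈ˢ H i
          member i with x∈p∪q⁻ (core A) E′ x∈
          ... | inj₁ x∈K  = S⊆H i (x∈p∪q⁺ (inj₁ (∈-core⁻ A x∈K i)))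
          ... | inj₂ x∈E′ = S⊆H i (x∈p∪q⁺ (inj₂ x∈E′))
        meet⊆ : ∀ i j → i ≢ j → H i ∩ H j ⊆ K
        meet⊆ i j i≢j {x} x∈ with x∈p∩q⁻ (S i) (S j) (meets i≢j x∈)
        ... | x∈ᵢ , x∈ⱼ with x∈p∪q⁻ (A i) E′ x∈ᵢ | x∈p∪q⁻ (A j) E′ x∈ⱼ
        ... | inj₂ x∈E′ | _         = x∈p∪q⁺ (inj₂ x∈E′)
        ... | inj₁ _    | inj₂ x∈E′ = x∈p∪q⁺ (inj₂ x∈E′)
        ... | inj₁ x∈Aᵢ | inj₁ x∈Aⱼ = x∈p∪q⁺ (inj₁ (subst (x ∈ˢ_) (IsSunflower.meet A-sunflower i≢j) (x∈p∩q⁺ (x∈Aᵢ , x∈Aⱼ))))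
        is-sunflower = sunflower 2≤s H K (λ i → subst (∣ K ∣ <_) (sym (All.lookup (uniform 𝓕) (H∈ i))) K<k)
          (λ {i} {j} i≢j → ⊆-antisym (meet⊆ i j i≢j) (⊆meet i j))

  linked⇒sunflower : t ∸ 1 ≤ ∣ E ∣ → HasSunflowerWithCoreSize s (t ∸ 1) 𝓕
  linked⇒sunflower t-1≤E with subset-of-size E (≤-trans (m∸n≤m (t ∸ 1) ∣ core A ∣) t-1≤E)
  ... | E′ , E′⊆E , ∣E′∣≡ = expand-linked E′ E′⊆E ∣E′∣≡

-- Agreement sets and kernels of a homogeneous class

lookup-ext : ∀ (f g : Tuple n k) → (∀ a → Vec.lookup f a ≡ Vec.lookup g a) → f ≡ g
lookup-ext Vec.[]      Vec.[]      eq = refl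
lookup-ext (x Vec.∷ f) (y Vec.∷ g) eq = cong₂ Vec._∷_ (eq zero) (lookup-ext f g (eq ∘ suc))

enumerate-all : (xs : List (Subset n)) → All (λ F → ∣ F ∣ ≡ k) xs →
                ∃[ fs ] map (entries {k = k}) fs ≡ xs × All Injectiveᵛ fs
enumerate-all []       []         = [] , refl , []
enumerate-all (F ∷ xs) (eq ∷ eqs) with enumerate F eq | enumerate-all xs eqs
... | f , refl , inj | fs , refl , injs = f ∷ fs , refl , inj ∷ injs

agreement : Tuple n k → Tuple n k → Subset k
agreement f g = comprehension (λ a → Vec.lookup f a Fin.≟ Vec.lookup g a)

agreement-agrees : (f g : Tuple n k) → Agree (agreement f g) f g
agreement-agrees f g a = ∈-comprehension⁻ (λ a → Vec.lookup f a Fin.≟ Vec.lookup g a)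

∈-agreement : (f g : Tuple n k) → ∀ {a} → Vec.lookup f a ≡ Vec.lookup g a → a ∈ˢ agreement f g
∈-agreement f g = ∈-comprehension⁺ (λ a → Vec.lookup f a Fin.≟ Vec.lookup g a)

agreement≢⊤ : (f g : Tuple n k) → f ≢ g → agreement f g ≢ ⊤ˢ
agreement≢⊤ f g f≢g eq = f≢g (lookup-ext f g (λ a → agreement-agrees f g a (subst (a ∈ˢ_) (sym eq) ∈⊤)))

≢⊤⇒card< : {J : Subset k} → J ≢ ⊤ˢ → ∣ J ∣ < k
≢⊤⇒card< {J = J} J≢⊤ = ≤∧≢⇒< (∣p∣≤n J) (J≢⊤ ∘ ∣p∣≡n⇒p≡⊤)

Unique-subsingleton : ∀ {A : Set} {xs : List A} → Unique xs → (∀ {x y} → x ∈ xs → y ∈ xs → x ≢ y → ⊥) → length xs ≤ 1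
Unique-subsingleton {xs = []}         _                  same = z≤n
Unique-subsingleton {xs = x ∷ []}     _                  same = ≤-refl
Unique-subsingleton {xs = x ∷ y ∷ xs} ((x≢y ∷ _) ∷ᵘ _) same = ⊥-elim (same (here refl) (there (here refl)) x≢y)

module _ {b : ℕ} {alive : List (Subset k)} {G : List (Tuple n k)} (homogeneous : Homogeneous b alive G) where

  open Homogeneous homogeneous

  -- Separation at the agreement set would produce one more common position outside it.
  agreement∈alive : ∀ {f g} → f ∈ G → g ∈ G → f ≢ g → agreement f g ∈ alive
  agreement∈alive {f} {g} f∈ g∈ f≢g with separated (agreement f g) (agreement≢⊤ f g f≢g)
  ... | inj₁ J∈  = J∈
  ... | inj₂ sep with sep f g f∈ g∈ (agreement-agrees f g)
  ...   | a , a∉ , eq = ⊥-elim (a∉ (∈-agreement f g eq))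

  module _ (k≤b : k ≤ b) {f : Tuple n k} (f∈G : f ∈ G) where

    -- Properness is a separate clause because every tuple trivially extends itself on all
    -- positions.
    Kernel : Subset k → Set
    Kernel J = J ∈ alive × J ≢ ⊤ˢ

    kernel? : ∀ J → Dec (Kernel J)
    kernel? J = (J ∈?ᴸ alive) ×-dec ¬? (J ≟ˢ ⊤ˢ)
      where open DecMembership _≟ˢ_ renaming (_∈?_ to _∈?ᴸ_)

    -- Extend f along J to g and g along K to h, both times forbidding all points of f. Then h
    -- agrees with f on J ∩ K and nowhere else: outside K by the choice of h, and in K outside J
    -- because there h equals g. So the class is not separated at J ∩ K.
    Kernel-∩ : ∀ J K → Kernel J → Kernel K → Kernel (J ∩ K)
    Kernel-∩ J K (J∈ , J≢⊤) (K∈ , K≢⊤) = J∩K∈ , J∩K≢⊤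
      where
      J∩K≢⊤ : J ∩ K ≢ ⊤ˢ
      J∩K≢⊤ eq = J≢⊤ (⊆-antisym ⊆⊤ (λ {a} _ → proj₁ (x∈p∩q⁻ J K (subst (a ∈ˢ_) (sym eq) ∈⊤))))
      L : List (Fin n)
      L = map (Vec.lookup f) (allFin k)
      ∈L : ∀ a → Vec.lookup f a ∈ L
      ∈L a = ∈-map⁺ (Vec.lookup f) (∈-allFin a)
      L≤b : length L ≤ b
      L≤b = ≤-trans (≤-reflexive (trans (length-map (Vec.lookup f) (allFin k)) (length-tabulate {n = k} (λ a → a)))) k≤b
      J∩K∈ : J ∩ K ∈ alive
      J∩K∈ with separated (J ∩ K) J∩K≢⊤
      ... | inj₁ ∈alive = ∈alive
      ... | inj₂ sep with extends J∈ f∈G L L≤b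
      ... | g , g∈ , f~g , g-avoids with extends K∈ g∈ L L≤b
      ... | h , h∈ , g~h , h-avoids with sep f h f∈G h∈ (λ a a∈ → trans (f~g a (proj₁ (x∈p∩q⁻ J K a∈))) (g~h a (proj₂ (x∈p∩q⁻ J K a∈))))
      ... | a , a∉ , fa≡ha with a ∈? K
      ... | no  a∉K = ⊥-elim (h-avoids (a , a∉K , subst (_∈ L) fa≡ha (∈L a)))
      ... | yes a∈K with a ∈? J
      ... | yes a∈J = ⊥-elim (a∉ (x∈p∩q⁺ (a∈J , a∈K)))
      ... | no  a∉J = ⊥-elim (g-avoids (a , a∉J , subst (_∈ L) (trans fa≡ha (sym (g~h a a∈K))) (∈L a)))

module _ (𝓕 : Family n k) {F₀ : List (Tuple n k)} (F₀≡ : map entries F₀ ≡ sets 𝓕) where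

  extends⇒expandable : ∀ {b G J f} → (∀ {g} → g ∈ G → g ∈ F₀) → Extends b G J f → Expandable b (sets 𝓕) (image f J)
  extends⇒expandable {J = J} {f} G⊆F₀ extends L L≤b with extends L L≤b
  ... | g , g∈G , f~g , avoids = entries g , subst (entries g ∈_) F₀≡ (∈-map⁺ entries (G⊆F₀ g∈G)) , incl , avoid
    where
    incl : image f J ⊆ entries g
    incl x∈ with ∈-image⁻ f J x∈
    ... | a , a∈J , refl = subst (_∈ˢ entries g) (sym (f~g a a∈J)) (∈-image⁺ g ∈⊤)
    avoid : ∀ {x} → x ∈ L → x ∈ˢ entries g → x ∈ˢ image f J
    avoid x∈L x∈g with ∈-image⁻ g ⊤ˢ x∈g
    ... | a , _ , refl with a ∈? J
    ... | yes a∈J = subst (_∈ˢ image f J) (f~g a a∈J) (∈-image⁺ f a∈J)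
    ... | no  a∉J = ⊥-elim (avoids (a , a∉J , x∈L))

-- A bound for φ, and the size of classes with an uncovered set

all-alive : ∀ (F : List (Tuple n k)) J → J ≢ ⊤ˢ → J ∈ allSubsets k ⊎ Separated F J
all-alive F J _ = inj₁ (∈-allSubsets J)

sunflower-bound : ℕ → ℕ → ℕ
sunflower-bound s t = parts t (s * t) (length (allSubsets t))

-- Two distinct members of a homogeneous class have an alive proper agreement set, whose image is
-- the core of a sunflower. So each class has at most one member, and the number of classes is the
-- bound. It lets the error term depend on s and k instead of φ.
sunflower-free⇒size≤ : 2 ≤ s → (𝓕 : Family n t) → ¬ HasSunflower s 𝓕 → size 𝓕 ≤ sunflower-bound s t
sunflower-free⇒size≤ {s} {n} {t} 2≤s 𝓕 free with enumerate-all (sets 𝓕) (uniform 𝓕)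
... | F₀ , F₀≡ , injective = conclude (partition {Ok = λ _ → ⊥} {X = 1} dichotomy (length (allSubsets t)) (allSubsets t) F₀ ≤-refl
                               (λ f∈ → f∈) uniq (all-alive F₀))
  where
  uniq : Unique F₀
  uniq = Unique.map⁻ (subst Unique (sym F₀≡) (Family.unique 𝓕))
  dichotomy : ∀ {alive G} → (∀ {g} → g ∈ G → g ∈ F₀) → Unique G → Homogeneous (s * t) alive G → (∀ {f} → f ∈ G → ⊥) ⊎ length G ≤ 1
  dichotomy G⊆F₀ uniqueG homogeneous = inj₂ (Unique-subsingleton uniqueG λ {f} {g} f∈ g∈ f≢g →
    let J = agreement f g
        inj = All.lookup injective (G⊆F₀ f∈)
        P , P∈ , P-sunflower , _ = expandable⇒sunflower 2≤s 𝓕 (image f J)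
          (subst (_< t) (sym (card-image f J inj)) (≢⊤⇒card< (agreement≢⊤ f g f≢g)))
          (extends⇒expandable 𝓕 F₀≡ {J = J} {f} G⊆F₀ (Homogeneous.extends homogeneous (agreement∈alive homogeneous f∈ g∈ f≢g) f∈))
    in free (P , P∈ , P-sunflower))
  conclude : (∃[ R ] length R ≤ sunflower-bound s t * 1 × (∀ {f} → f ∈ F₀ → f ∈ R ⊎ ⊥)) → size 𝓕 ≤ sunflower-bound s t
  conclude (R , R≤ , cover) = begin
    size 𝓕                    ≡⟨ cong length F₀≡ ⟨
    length (map entries F₀)    ≡⟨ length-map entries F₀ ⟩
    length F₀                  ≤⟨ Unique⇒length≤ uniq (λ f∈ → Sum.fromInj₁ (λ ()) (cover f∈)) ⟩
    length R                   ≤⟨ R≤ ⟩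
    sunflower-bound s t * 1    ≡⟨ *-identityʳ _ ⟩
    sunflower-bound s t        ∎
    where open ≤-Reasoning

-- Two members agreeing on the uncovered set S would have their agreement alive and containing S.
uncovered⇒length≤ : ∀ {b alive} {G : List (Tuple n k)} → Homogeneous b alive G → Unique G →
                    ∀ S → ¬ (∃[ J ] (J ∈ alive × J ≢ ⊤ˢ) × S ⊆ J) → length G ≤ n ^ ∣ S ∣
uncovered⇒length≤ {n} {k} {G = G} homogeneous uniq S uncovered with enumerate S refl
... | e , e≡S , _ = begin
  length G                                ≡⟨ length-map restrict G ⟨
  length (map restrict G)                 ≤⟨ Unique⇒length≤ (Unique-map restrict injective uniq) (λ {v} _ → ∈-allVecs (allFin n) ∈-allFin v) ⟩
  length (allVecs (allFin n) ∣ S ∣)       ≡⟨ length-allVecs (allFin n) ∣ S ∣ ⟩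
  length (allFin n) ^ ∣ S ∣               ≡⟨ cong (_^ ∣ S ∣) (length-tabulate {n = n} (λ x → x)) ⟩
  n ^ ∣ S ∣                               ∎
  where
  open ≤-Reasoning
  restrict : Tuple n k → Vec (Fin n) ∣ S ∣
  restrict f = Vec.map (Vec.lookup f) e
  injective : ∀ {f g} → f ∈ G → g ∈ G → restrict f ≡ restrict g → f ≡ g
  injective {f} {g} f∈ g∈ eq with Vec.≡-dec Fin._≟_ f g
  ... | yes f≡g = f≡g
  ... | no  f≢g = ⊥-elim (uncovered (agreement f g , (agreement∈alive homogeneous f∈ g∈ f≢g , agreement≢⊤ f g f≢g) , S⊆))
    where
    S⊆ : S ⊆ agreement f g
    S⊆ {a} a∈S with ∈-image⁻ e ⊤ˢ (subst (a ∈ˢ_) (sym e≡S) a∈S)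
    ... | p , _ , refl = ∈-agreement f g (trans (sym (Vec.lookup-map p (Vec.lookup f) e))
            (trans (cong (λ v → Vec.lookup v p) eq) (Vec.lookup-map p (Vec.lookup g) e)))

-- Members with a root and exceptional members

supersets⇒root : ∀ {b} (𝓕 : List (Subset n)) {f : Tuple n k} {A : Subset k} → Injectiveᵛ f → ∣ A ∣ ≡ t →
                 (∀ J → A ⊆ J → J ≢ ⊤ˢ → Expandable b 𝓕 (image f J)) → Root b t 𝓕 (entries f) (image f A)
supersets⇒root {b = b} 𝓕 {f} {A} inj ∣A∣≡t expandable = record
  { A⊆F        = λ x∈ → case-entry (∈-image⁻ f A x∈)
  ; size-A     = trans (card-image f A inj) ∣A∣≡t
  ; expandable = expandable′
  }
  where
  case-entry : ∀ {x} → IsEntry f A x → x ∈ˢ entries f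
  case-entry (a , _ , refl) = ∈-image⁺ f ∈⊤
  expandable′ : ∀ S → image f A ⊆ S → S ⊆ entries f → S ≢ entries f → Expandable b 𝓕 S
  expandable′ S A⊆S S⊆f S≢f = subst (Expandable b 𝓕) (⊆-antisym to from) (expandable J A⊆J J≢⊤)
    where
    J? = λ a → Vec.lookup f a ∈? S
    J = comprehension J?
    A⊆J : A ⊆ J
    A⊆J a∈A = ∈-comprehension⁺ J? (A⊆S (∈-image⁺ f a∈A))
    to : image f J ⊆ S
    to x∈ with ∈-image⁻ f J x∈
    ... | a , a∈J , refl = ∈-comprehension⁻ J? a∈J
    from : S ⊆ image f J
    from x∈ with ∈-image⁻ f ⊤ˢ (S⊆f x∈)
    ... | a , _ , refl = ∈-image⁺ f (∈-comprehension⁺ J? x∈)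
    J≢⊤ : J ≢ ⊤ˢ
    J≢⊤ J≡⊤ = S≢f (⊆-antisym S⊆f f⊆S)
      where
      f⊆S : entries f ⊆ S
      f⊆S x∈ with ∈-image⁻ f ⊤ˢ x∈
      ... | a , _ , refl = ∈-comprehension⁻ J? (subst (a ∈ˢ_) (sym J≡⊤) ∈⊤)

exceptions : ℕ → ℕ → ℕ
exceptions s k = parts k (s * k) (length (allSubsets k))

rooted : 2 ≤ s → 1 ≤ t → 2 * t + 1 ≤ k → (𝓕 : Family n k) → ¬ HasSunflowerWithCoreSize s (t ∸ 1) 𝓕 →
         ∃[ R ] length R ≤ exceptions s k * n ^ (k ∸ suc t) ×
         (∀ {F} → F ∈ sets 𝓕 → F ∈ R ⊎ ∃[ A ] Root (s * k) t (sets 𝓕) F A)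
rooted {s} {t} {k} {n} 2≤s 1≤t 2t+1≤k 𝓕 free with enumerate-all (sets 𝓕) (uniform 𝓕)
... | F₀ , F₀≡ , injective = conclude (partition dichotomy (length (allSubsets k)) (allSubsets k) F₀ ≤-refl
                               (λ f∈ → f∈) (Unique.map⁻ (subst Unique (sym F₀≡) (Family.unique 𝓕))) (all-alive F₀))
  where
  Ok : Tuple n k → Set
  Ok f = ∃[ A ] Root (s * k) t (sets 𝓕) (entries f) A
  X : ℕ
  X = n ^ (k ∸ suc t)
  dichotomy : ∀ {alive G} → (∀ {g} → g ∈ G → g ∈ F₀) → Unique G → Homogeneous (s * k) alive G → (∀ {f} → f ∈ G → Ok f) ⊎ length G ≤ X
  dichotomy {alive} {[]}    G⊆F₀ uniq homogeneous = inj₁ λ ()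
  dichotomy {alive} {f ∷ G} G⊆F₀ uniq homogeneous
    with uncovered⊎supersets (Kernel homogeneous k≤sk (here refl)) (kernel? homogeneous k≤sk (here refl))
           (Kernel-∩ homogeneous k≤sk (here refl)) 2t+1≤k (λ J → proj₂) no-t-1
    where
    k≤sk : k ≤ s * k
    k≤sk = ≤-trans (≤-reflexive (sym (*-identityˡ k))) (*-monoˡ-≤ k (≤-trans (s≤s z≤n) 2≤s))
    -- The image of a kernel of size t - 1 would be the core of a forbidden sunflower.
    no-t-1 : ∀ J → J ∈ alive × J ≢ ⊤ˢ → suc ∣ J ∣ ≢ t
    no-t-1 J (J∈ , J≢⊤) refl = free (subst (λ c → HasSunflowerWithCoreSize s c 𝓕) ∣image∣ (expandable⇒sunflower 2≤s 𝓕 (image f J)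
      (subst (_< k) (sym ∣image∣) (≢⊤⇒card< J≢⊤))
      (extends⇒expandable 𝓕 F₀≡ {J = J} {f} G⊆F₀ (Homogeneous.extends homogeneous J∈ (here refl)))))
      where
      ∣image∣ : ∣ image f J ∣ ≡ ∣ J ∣
      ∣image∣ = card-image f J (All.lookup injective (G⊆F₀ (here refl)))
  ... | inj₁ (S , ∣S∣≡ , uncovered) = inj₂ (subst (λ e → length (f ∷ G) ≤ n ^ e) ∣S∣≡ (uncovered⇒length≤ homogeneous uniq S uncovered))
  -- The kernels are determined by `alive`, so the positions A found with the help of f give a root
  -- for every g in the class.
  ... | inj₂ (A , ∣A∣≡t , supersets) = inj₁ λ {g} g∈ → image g A ,
          supersets⇒root (sets 𝓕) {g} {A} (All.lookup injective (G⊆F₀ g∈)) ∣A∣≡t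
            (λ J A⊆J J≢⊤ → extends⇒expandable 𝓕 F₀≡ {J = J} {g} G⊆F₀ (Homogeneous.extends homogeneous (proj₁ (supersets J A⊆J J≢⊤)) g∈))
  conclude : (∃[ R ] length R ≤ exceptions s k * X × (∀ {f} → f ∈ F₀ → f ∈ R ⊎ Ok f)) →
             ∃[ R ] length R ≤ exceptions s k * X × (∀ {F} → F ∈ sets 𝓕 → F ∈ R ⊎ ∃[ A ] Root (s * k) t (sets 𝓕) F A)
  conclude (R , R≤ , cover) = map entries R , subst (_≤ exceptions s k * X) (sym (length-map entries R)) R≤ , cover′
    where
    cover′ : ∀ {F} → F ∈ sets 𝓕 → F ∈ map entries R ⊎ ∃[ A ] Root (s * k) t (sets 𝓕) F A
    cover′ {F} F∈ with ∈-map⁻ entries (subst (F ∈_) (sym F₀≡) F∈)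
    ... | f , f∈ , refl = Sum.map₁ (∈-map⁺ entries) (cover f∈)

-- Spreading along lines

-- At most one coordinate changes; equality is allowed, since the slice compared with all others is
-- one of them.
data Adjacent {A : Set} : ∀ {d} → Vec A d → Vec A d → Set where
  here  : ∀ {d x y} {v : Vec A d} → Adjacent (x ∷ v) (y ∷ v)
  there : ∀ {d x} {v w : Vec A d} → Adjacent v w → Adjacent (x ∷ v) (x ∷ w)

-- In the inductive step, every point is compared with its projection to a slice of
-- below average badness.
spread : ∀ {A : Set} (xs : List A) → 0 < length xs → ∀ d {_~_ : Vec A d → Vec A d → Set} →
         (∀ v → v ~ v) → (∀ {u v w} → u ~ v → v ~ w → u ~ w) → (bad : Vec A d → ℕ) →
         (∀ {v w} → Adjacent v w → bad v ≡ 0 → bad w ≡ 0 → v ~ w) →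
         ∃[ v₀ ] Σ[ bad′ ∈ (Vec A d → ℕ) ] (∀ v → bad′ v ≡ 0 → bad v ≡ 0 × v ~ v₀) ×
         ∑ (allVecs xs d) bad′ ≤ suc d * ∑ (allVecs xs d) bad
spread xs 0<xs zero    ~-refl ~-trans bad step =
  [] , bad , (λ { [] bad≡0 → bad≡0 , ~-refl [] }) , ≤-reflexive (sym (*-identityˡ _))
spread xs 0<xs (suc d) {_~_} ~-refl ~-trans bad step
  with below-average xs (λ x → ∑ (allVecs xs d) (bad ∘ (x ∷_))) 0<xs
... | a , _ , below
  with spread xs 0<xs d {λ v w → (a ∷ v) ~ (a ∷ w)} (λ v → ~-refl (a ∷ v)) ~-trans (bad ∘ (a ∷_)) (λ adj → step (there adj))
... | v₀ , bad₀ , bad₀⇒ , bad₀≤ = a ∷ v₀ , bad′ , bad′⇒ , (begin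
  ∑ (allVecs xs (suc d)) bad′
    ≡⟨ ∑-cartesianProductWith _∷_ xs (allVecs xs d) bad′ ⟩
  ∑ xs (λ x → ∑ (allVecs xs d) (λ v → bad (x ∷ v) + bad₀ v))
    ≡⟨ ∑-cong xs (λ {x} _ → ∑-+ (allVecs xs d) (bad ∘ (x ∷_)) bad₀) ⟩
  ∑ xs (λ x → ∑ (allVecs xs d) (bad ∘ (x ∷_)) + ∑ (allVecs xs d) bad₀)
    ≡⟨ ∑-+ xs _ _ ⟩
  ∑ xs (λ x → ∑ (allVecs xs d) (bad ∘ (x ∷_))) + ∑ xs (λ _ → ∑ (allVecs xs d) bad₀)
    ≡⟨ cong₂ _+_ (sym (∑-cartesianProductWith _∷_ xs (allVecs xs d) bad)) (∑-const xs _) ⟩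
  S + length xs * ∑ (allVecs xs d) bad₀
    ≤⟨ +-monoʳ-≤ S (*-monoʳ-≤ (length xs) bad₀≤) ⟩
  S + length xs * (suc d * ∑ (allVecs xs d) (bad ∘ (a ∷_)))
    ≡⟨ cong (S +_) (x∙yz≈y∙xz (length xs) (suc d) _) ⟩
  S + suc d * (length xs * ∑ (allVecs xs d) (bad ∘ (a ∷_)))
    ≤⟨ +-monoʳ-≤ S (*-monoʳ-≤ (suc d) below) ⟩
  S + suc d * ∑ xs (λ x → ∑ (allVecs xs d) (bad ∘ (x ∷_)))
    ≡⟨ cong (λ z → S + suc d * z) (∑-cartesianProductWith _∷_ xs (allVecs xs d) bad) ⟨
  suc (suc d) * S ∎)
  where
  open ≤-Reasoning
  S : ℕ
  S = ∑ (allVecs xs (suc d)) bad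
  bad′ : Vec _ (suc d) → ℕ
  -- Vanishing of `bad₀ v` also certifies that `a ∷ v` is good, which the change of the first
  -- coordinate requires. The sum of `bad₀` is repeated once per x, and the choice of a slice of
  -- below average badness makes up for this.
  bad′ (x ∷ v) = bad (x ∷ v) + bad₀ v
  bad′⇒ : ∀ v → bad′ v ≡ 0 → bad v ≡ 0 × v ~ (a ∷ v₀)
  bad′⇒ (x ∷ v) bad′≡0 with bad₀⇒ v (m+n≡0⇒n≡0 (bad (x ∷ v)) bad′≡0) | m+n≡0⇒m≡0 (bad (x ∷ v)) bad′≡0
  ... | bad-a≡0 , a~ | bad-x≡0 = bad-x≡0 , ~-trans (step here bad-x≡0 bad-a≡0) a~

-- Orderings of a set

entries-∷⁺ : ∀ {i : Fin n} {v : Vec (Fin n) m} {x} → x ∈ˢ entries v → x ∈ˢ entries (i ∷ v)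
entries-∷⁺ {i = i} {v} x∈ with ∈-image⁻ v ⊤ˢ x∈
... | a , _ , refl = ∈-image⁺ (i ∷ v) {a = suc a} ∈⊤

entries-∷⁻ : ∀ {i : Fin n} (v : Vec (Fin n) m) {x} → x ∈ˢ entries (i ∷ v) → x ≡ i ⊎ x ∈ˢ entries v
entries-∷⁻ {i = i} v x∈ with ∈-image⁻ (i ∷ v) ⊤ˢ x∈
... | zero  , _ , refl = inj₁ refl
... | suc a , _ , refl = inj₂ (∈-image⁺ v ∈⊤)

adjacent-entries : ∀ {v w : Vec (Fin n) m} → Adjacent v w → ∃[ i ] ∀ {x} → x ∈ˢ entries v → x ≡ i ⊎ x ∈ˢ entries w
adjacent-entries (here {x = i} {j} {v}) = i , λ x∈ → Sum.map₂ (entries-∷⁺ {i = j} {v}) (entries-∷⁻ {i = i} v x∈)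
adjacent-entries (there {x = i} {v} {w} adj) with adjacent-entries adj
... | j , v⊆ = j , incl
  where
  incl : ∀ {x} → x ∈ˢ entries (i ∷ v) → x ≡ j ⊎ x ∈ˢ entries (i ∷ w)
  incl x∈ with entries-∷⁻ {i = i} v x∈
  ... | inj₁ refl = inj₂ (∈-image⁺ (i ∷ w) {a = zero} ∈⊤)
  ... | inj₂ x∈v  = Sum.map₂ (entries-∷⁺ {i = i} {w}) (v⊆ x∈v)

card≤suc : ∀ {p q : Subset n} {i} → (∀ {x} → x ∈ˢ p → x ≡ i ⊎ x ∈ˢ q) → ∣ p ∣ ≤ suc ∣ q ∣
card≤suc {p = p} {q} {i} incl with i ∈? p
... | yes i∈p = ≤-trans (≤-reflexive (card-⟍ p i∈p)) (s≤s (p⊆q⇒∣p∣≤∣q∣ (λ x∈ →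
        Sum.fromInj₂ (λ x≡i → ⊥-elim (proj₂ (x∈p⟍y⁻ p x∈) x≡i)) (incl (proj₁ (x∈p⟍y⁻ p x∈))))))
... | no  i∉p = m≤n⇒m≤1+n (p⊆q⇒∣p∣≤∣q∣ (λ x∈ → Sum.fromInj₂ (λ { refl → ⊥-elim (i∉p x∈) }) (incl x∈)))

-- Any point of D may come first, followed by an ordering of the rest. The lower bound suffices:
-- every (k-t)-set is to be counted at least d! times among the tuples.
orderings≥! : ∀ d (D : Subset n) → ∣ D ∣ ≡ d → d ! ≤ ∑ (allVecs (allFin n) d) (λ y → 𝟙 (D ≟ˢ entries y))
orderings≥! zero D ∣D∣≡0 = ≤-reflexive (sym (trans (+-identityʳ _) (𝟙-yes (D ≟ˢ entries []) D≡)))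
  where
  D≡ : D ≡ entries []
  D≡ = ⊆-card-≡ (λ x∈ → ⊥-elim (n≮0 (subst (0 <_) (trans (sym (card-⟍ D x∈)) ∣D∣≡0) (s≤s z≤n))))
         (≤-trans (p⊆q⇒∣p∣≤∣q∣ {q = D} λ x∈ → case-entry (∈-image⁻ [] ⊤ˢ x∈)) ≤-refl)
    where
    case-entry : ∀ {x} → IsEntry [] ⊤ˢ x → x ∈ˢ D
    case-entry ()
orderings≥! {n} (suc d) D ∣D∣≡ = begin
  suc d * d !                                          ≡⟨ cong (_* (d !)) (trans (sym ∣D∣≡) (card-∑ D)) ⟩
  ∑ (allFin n) (λ i → 𝟙 (i ∈? D)) * (d !)              ≡⟨ ∑-*ʳ (allFin n) (d !) _ ⟨
  ∑ (allFin n) (λ i → 𝟙 (i ∈? D) * (d !))              ≤⟨ ∑-mono (allFin n) (λ {i} _ → first i) ⟩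
  ∑ (allFin n) (λ i → ∑ (allVecs (allFin n) d) (λ y → 𝟙 (D ≟ˢ entries (i ∷ y)))) ≡⟨ ∑-cartesianProductWith _∷_ (allFin n) (allVecs (allFin n) d) _ ⟨
  ∑ (allVecs (allFin n) (suc d)) (λ y → 𝟙 (D ≟ˢ entries y)) ∎
  where
  open ≤-Reasoning
  first : ∀ i → 𝟙 (i ∈? D) * (d !) ≤ ∑ (allVecs (allFin n) d) (λ y → 𝟙 (D ≟ˢ entries (i ∷ y)))
  first i with i ∈? D
  ... | no  _   = z≤n
  ... | yes i∈D = begin
    1 * (d !)                                                    ≡⟨ *-identityˡ _ ⟩
    d !                                                          ≤⟨ orderings≥! d (D ⟍ i) (suc-injective (trans (sym (card-⟍ D i∈D)) ∣D∣≡)) ⟩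
    ∑ (allVecs (allFin n) d) (λ y → 𝟙 ((D ⟍ i) ≟ˢ entries y))    ≤⟨ ∑-mono (allVecs (allFin n) d) (λ {y} _ → compare y) ⟩
    ∑ (allVecs (allFin n) d) (λ y → 𝟙 (D ≟ˢ entries (i ∷ y)))    ∎
    where
    compare : ∀ y → 𝟙 ((D ⟍ i) ≟ˢ entries y) ≤ 𝟙 (D ≟ˢ entries (i ∷ y))
    compare y with (D ⟍ i) ≟ˢ entries y
    ... | no  _  = z≤n
    ... | yes eq = ≤-reflexive (sym (𝟙-yes (D ≟ˢ entries (i ∷ y)) (⊆-antisym to from)))
      where
      to : D ⊆ entries (i ∷ y)
      to {x} x∈D with x Fin.≟ i
      ... | yes refl = ∈-image⁺ (i ∷ y) {a = zero} ∈⊤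
      ... | no  x≢i  = entries-∷⁺ {i = i} {y} (subst (x ∈ˢ_) eq (x∈p⟍y⁺ x∈D x≢i))
      from : entries (i ∷ y) ⊆ D
      from {x} x∈ with entries-∷⁻ {i = i} y x∈
      ... | inj₁ refl = i∈D
      ... | inj₂ x∈y  = proj₁ (x∈p⟍y⁻ D (subst (x ∈ˢ_) (sym eq) x∈y))

-- Counting rooted sets

-- Fixes one root for each non-exceptional member, as a list of pairs with distinct first
-- components, so that members and chosen pairs are counted alike.
collect : ∀ {A B : Set} {R : List A} {P : A → B → Set} (xs : List A) → Unique xs →
          (∀ {x} → x ∈ xs → x ∈ R ⊎ ∃[ y ] P x y) →
          ∃[ ps ] (∀ {x y} → (x , y) ∈ ps → x ∈ xs × P x y) × Unique (map proj₁ ps) ×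
          (∀ {x} → x ∈ xs → x ∈ R ⊎ ∃[ y ] (x , y) ∈ ps)
collect []       uniq        cover = [] , (λ ()) , [] , λ ()
collect {A} {B} {R} {P} (x ∷ xs) (x≢ ∷ᵘ uniq) cover with collect xs uniq (λ x∈ → cover (there x∈)) | cover (here refl)
... | ps , sound , uniq-ps , complete | inj₁ x∈R =
  ps , (λ p∈ → there (proj₁ (sound p∈)) , proj₂ (sound p∈)) , uniq-ps , λ { (here refl) → inj₁ x∈R ; (there x∈) → complete x∈ }
... | ps , sound , uniq-ps , complete | inj₂ (y , Pxy) = (x , y) ∷ ps , sound′ , All.tabulate fresh ∷ᵘ uniq-ps , complete′
  where
  sound′ : ∀ {x′ y′} → (x′ , y′) ∈ (x , y) ∷ ps → x′ ∈ x ∷ xs × P x′ y′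
  sound′ (here refl) = here refl , Pxy
  sound′ (there p∈)  = there (proj₁ (sound p∈)) , proj₂ (sound p∈)
  fresh : ∀ {z} → z ∈ map proj₁ ps → x ≢ z
  fresh z∈ refl with ∈-map⁻ proj₁ z∈
  ... | (_ , y′) , p∈ , refl = All.lookup x≢ (proj₁ (sound p∈)) refl
  complete′ : ∀ {z} → z ∈ x ∷ xs → z ∈ R ⊎ ∃[ y ] (z , y) ∈ _ ∷ ps
  complete′ (here refl) = inj₂ (y , here refl)
  complete′ (there z∈)  = Sum.map₂ (λ { (y′ , p∈) → y′ , there p∈ }) (complete z∈)

module _ {φ : ℕ} (0<n : 0 < n) (2≤s : 2 ≤ s) (1≤t : 1 ≤ t) (2t+1≤k : 2 * t + 1 ≤ k) (isPhi : IsPhi s t φ)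
         (𝓕 : Family n k) (free : ¬ HasSunflowerWithCoreSize s (t ∸ 1) 𝓕)
         {R : List (Subset n)} (ps : List (Subset n × Subset n))
         (sound : ∀ {F A} → (F , A) ∈ ps → F ∈ sets 𝓕 × Root (s * k) t (sets 𝓕) F A)
         (uniq-ps : Unique (map proj₁ ps))
         (complete : ∀ {F} → F ∈ sets 𝓕 → F ∈ R ⊎ ∃[ A ] (F , A) ∈ ps) where

  private
    rest : Subset n × Subset n → Subset n
    rest (F , A) = F ∩ ∁ A

    d′ : ℕ
    d′ = k ∸ t

    2t≤k : 2 * t ≤ k
    2t≤k = ≤-trans (m≤m+n (2 * t) 1) 2t+1≤k

    1+[t∸1]≤d′ : suc (t ∸ 1) ≤ d′
    1+[t∸1]≤d′ = ≤-trans (≤-reflexive (m+[n∸m]≡n 1≤t))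
      (≤-trans (≤-reflexive (sym (trans (cong (_∸ t) (cong (t +_) (+-identityʳ t))) (m+n∸m≡n t t)))) (∸-monoˡ-≤ t 2t≤k))

    size-rest : ∀ {p} → p ∈ ps → ∣ rest p ∣ ≡ d′
    size-rest {F , A} p∈ with sound p∈
    ... | F∈ , root = begin
      ∣ F ∩ ∁ A ∣                          ≡⟨ m+n∸m≡n t _ ⟨
      t + ∣ F ∩ ∁ A ∣ ∸ t                  ≡⟨ cong (λ z → z + ∣ F ∩ ∁ A ∣ ∸ t) (trans (cong ∣_∣ F∩A≡A) size-A) ⟨
      ∣ F ∩ A ∣ + ∣ F ∩ ∁ A ∣ ∸ t          ≡⟨ cong (_∸ t) (trans (sym (card-split F A)) (All.lookup (uniform 𝓕) F∈)) ⟩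
      k ∸ t                                ∎
      where
      open ≡-Reasoning
      open Root root
      F∩A≡A : F ∩ A ≡ A
      F∩A≡A = ⊆-antisym (proj₂ ∘ x∈p∩q⁻ F A) (λ x∈ → x∈p∩q⁺ (A⊆F x∈ , x∈))

    selected : Vec (Fin n) d′ → List (Subset n × Subset n)
    selected y = filter (λ p → rest p ≟ˢ entries y) ps

    -- The family T(D) of the overview, indexed by orderings. If y has a repeated entry, no set of
    -- d′ points equals `entries y`, and `T y` is empty.
    T : Vec (Fin n) d′ → List (Subset n)
    T y = map proj₂ (selected y)

    ∈-T⁺ : ∀ {F A y} → (F , A) ∈ ps → F ∩ ∁ A ≡ entries y → A ∈ T y
    ∈-T⁺ {y = y} p∈ eq = ∈-map⁺ proj₂ (∈-filter⁺ (λ p → rest p ≟ˢ entries y) p∈ eq)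

    ∈-T⁻ : ∀ {A} y → A ∈ T y → ∃[ F ] (F , A) ∈ ps × F ∩ ∁ A ≡ entries y
    ∈-T⁻ y A∈ with ∈-map⁻ proj₂ A∈
    ... | (F , A) , p∈ , refl = F , ∈-filter⁻ (λ p → rest p ≟ˢ entries y) {xs = ps} p∈

    restore : ∀ {F A} → (F , A) ∈ ps → F ≡ A ∪ (F ∩ ∁ A)
    restore {F} {A} p∈ = ⊆-antisym to from
      where
      open Root (proj₂ (sound p∈))
      to : F ⊆ A ∪ (F ∩ ∁ A)
      to {x} x∈F with x ∈? A
      ... | yes x∈A = x∈p∪q⁺ (inj₁ x∈A)
      ... | no  x∉A = x∈p∪q⁺ (inj₂ (x∈p∩q⁺ (x∈F , x∉p⇒x∈∁p x∉A)))
      from : A ∪ (F ∩ ∁ A) ⊆ F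
      from x∈ with x∈p∪q⁻ A (F ∩ ∁ A) x∈
      ... | inj₁ x∈A = A⊆F x∈A
      ... | inj₂ x∈  = proj₁ (x∈p∩q⁻ F (∁ A) x∈)

    T-unique : ∀ y → Unique (T y)
    T-unique y = Unique-map proj₂ injective (Unique.filter⁺ _ (Unique.map⁻ uniq-ps))
      where
      injective : ∀ {p q} → p ∈ selected y → q ∈ selected y → proj₂ p ≡ proj₂ q → p ≡ q
      injective {F , A} {G , .A} p∈ q∈ refl with ∈-filter⁻ (λ p → rest p ≟ˢ entries y) {xs = ps} p∈ | ∈-filter⁻ (λ p → rest p ≟ˢ entries y) {xs = ps} q∈
      ... | p∈ps , eq-p | q∈ps , eq-q = cong (_, A) (trans (restore p∈ps) (trans (cong (A ∪_) (trans eq-p (sym eq-q))) (sym (restore q∈ps))))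

    size-entries : ∀ {A y} → A ∈ T y → ∣ entries y ∣ ≡ d′
    size-entries {y = y} A∈ with ∈-T⁻ y A∈
    ... | F , p∈ , eq = trans (cong ∣_∣ (sym eq)) (size-rest p∈)

    T-linked : ∀ {A y E} → A ∈ T y → E ⊆ entries y → Linked (s * k) t (sets 𝓕) E A
    T-linked {A} {y} A∈ E⊆ with ∈-T⁻ y A∈
    ... | F , p∈ , eq = record
      { F = F ; F∈ = proj₁ (sound p∈) ; root = proj₂ (sound p∈)
      ; E⊆F = λ x∈E → proj₁ (x∈p∩q⁻ F (∁ A) (subst (_ ∈ˢ_) (sym eq) (E⊆ x∈E)))
      ; E∩A = λ x∈E → x∈∁p⇒x∉p (proj₂ (x∈p∩q⁻ F (∁ A) (subst (_ ∈ˢ_) (sym eq) (E⊆ x∈E))))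
      }

    -- The lower bound on ∣ E ∣ is asked for only in the presence of a member, because the number of
    -- entries of y is known only when `T y` is nonempty; a sunflower with a petal supplies that
    -- member.
    linked-free : ∀ {E} (𝓣 : Family n t) → (∀ {A} → A ∈ sets 𝓣 → Linked (s * k) t (sets 𝓕) E A) →
                  (∀ {A} → A ∈ sets 𝓣 → t ∸ 1 ≤ ∣ E ∣) → ¬ HasSunflower s 𝓣
    linked-free {E} 𝓣 linked large (P , P∈ , P-sunflower) =
      free (linked⇒sunflower 2≤s 1≤t 2t≤k 𝓕 E P P-sunflower (λ i → linked (P∈ i)) (large (P∈ (first 2≤s))))
      where
      first : ∀ {s} → 2 ≤ s → Fin s
      first (s≤s _) = zero

    linked-size : ∀ {A E} → Linked (s * k) t (sets 𝓕) E A → ∣ A ∣ ≡ t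
    linked-size linked = Root.size-A (Linked.root linked)

    T-family : Vec (Fin n) d′ → Family n t
    T-family y = record { sets = T y ; unique = T-unique y ; uniform = All.tabulate (λ A∈ → linked-size (T-linked {y = y} {entries y} A∈ (λ x∈ → x∈))) }

    T-free : ∀ y → ¬ HasSunflower s (T-family y)
    T-free y = linked-free {entries y} (T-family y) (λ A∈ → T-linked {y = y} A∈ (λ x∈ → x∈))
      (λ A∈ → ≤-trans (n≤1+n _) (≤-trans 1+[t∸1]≤d′ (≤-reflexive (sym (size-entries {y = y} A∈)))))

    T≤φ : ∀ y → length (T y) ≤ φ
    T≤φ y = IsPhi.maximal isPhi n (T-family y) (T-free y)

    deficit : Vec (Fin n) d′ → ℕ
    deficit y = φ ∸ length (T y)

    -- Adjacent orderings share t − 1 points, to which all of T v and T w are linked;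
    -- so a member of T v missing from T w could be added to the extremal family T w.
    T-adjacent : ∀ {v w} → Adjacent v w → deficit v ≡ 0 → deficit w ≡ 0 → ∀ {A} → A ∈ T v → A ∈ T w
    T-adjacent {v} {w} adj _ full {A} A∈v with A ∈?ᴸ T w
      where open DecMembership _≟ˢ_ renaming (_∈?_ to _∈?ᴸ_)
    ... | yes A∈w = A∈w
    ... | no  A∉w = ⊥-elim (<⇒≱ (s≤s (m∸n≡0⇒m≤n full)) (IsPhi.maximal isPhi n 𝓣 (linked-free {E} 𝓣 linked (λ _ → t-1≤E))))
      where
      E : Subset n
      E = entries v ∩ entries w
      t-1≤E : t ∸ 1 ≤ ∣ E ∣
      t-1≤E = ≤-pred (≤-trans 1+[t∸1]≤d′ (≤-trans (≤-reflexive (sym (size-entries {y = v} A∈v)))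
        (card≤suc (λ x∈ → Sum.map₂ (λ x∈w → x∈p∩q⁺ (x∈ , x∈w)) (proj₂ (adjacent-entries adj) x∈)))))
      linked : ∀ {B} → B ∈ A ∷ T w → Linked (s * k) t (sets 𝓕) E B
      linked (here refl) = T-linked {y = v} A∈v (proj₁ ∘ x∈p∩q⁻ (entries v) (entries w))
      linked (there B∈)  = T-linked {y = w} B∈ (proj₂ ∘ x∈p∩q⁻ (entries v) (entries w))
      𝓣 : Family n t
      𝓣 = record { sets = A ∷ T w ; unique = All.tabulate (λ B∈ A≡B → A∉w (subst (_∈ T w) (sym A≡B) B∈)) ∷ᵘ T-unique w
                 ; uniform = All.tabulate (λ B∈ → linked-size (linked B∈)) }

    vs : List (Vec (Fin n) d′)
    vs = allVecs (allFin n) d′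

    length-T : ∀ y → length (T y) ≡ ∑ ps (λ p → 𝟙 (rest p ≟ˢ entries y))
    length-T y = trans (length-map proj₂ (selected y)) (length-filter-𝟙 _ ps)

    -- Each of the n^d′ tuples has room for φ roots, and each pair (F , A) uses up at least d′! of
    -- these places, one for every ordering of F ∖ A.
    deficit-sum : ∑ vs deficit + (d′ !) * length ps ≤ n ^ d′ * φ
    deficit-sum = begin
      ∑ vs deficit + (d′ !) * length ps                ≤⟨ +-monoʳ-≤ (∑ vs deficit) count ⟩
      ∑ vs deficit + ∑ vs (λ y → length (T y))       ≡⟨ ∑-+ vs deficit _ ⟨
      ∑ vs (λ y → deficit y + length (T y))          ≡⟨ ∑-cong vs (λ {y} _ → m∸n+n≡m (T≤φ y)) ⟩
      ∑ vs (λ _ → φ)                                 ≡⟨ ∑-const vs φ ⟩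
      length vs * φ                                  ≡⟨ cong (_* φ) (trans (length-allVecs (allFin n) d′) (cong (_^ d′) (length-tabulate {n = n} (λ x → x)))) ⟩
      n ^ d′ * φ                                     ∎
      where
      open ≤-Reasoning
      count : (d′ !) * length ps ≤ ∑ vs (λ y → length (T y))
      count = begin
        (d′ !) * length ps                                       ≡⟨ *-comm (d′ !) (length ps) ⟩
        length ps * (d′ !)                                       ≡⟨ ∑-const ps (d′ !) ⟨
        ∑ ps (λ _ → d′ !)                                      ≤⟨ ∑-mono ps (λ {p} p∈ → orderings≥! d′ (rest p) (size-rest p∈)) ⟩
        ∑ ps (λ p → ∑ vs (λ y → 𝟙 (rest p ≟ˢ entries y)))      ≡⟨ ∑-swap ps vs _ ⟩
        ∑ vs (λ y → ∑ ps (λ p → 𝟙 (rest p ≟ˢ entries y)))      ≡⟨ ∑-cong vs (λ {y} _ → sym (length-T y)) ⟩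
        ∑ vs (λ y → length (T y))                              ∎

  size≤ : size 𝓕 ≤ length R + length ps
  size≤ = begin
    size 𝓕                                ≤⟨ Unique⇒length≤ (unique 𝓕) incl ⟩
    length (R ++ map proj₁ ps)            ≡⟨ length-++ R ⟩
    length R + length (map proj₁ ps)      ≡⟨ cong (length R +_) (length-map proj₁ ps) ⟩
    length R + length ps                  ∎
    where
    open ≤-Reasoning
    incl : ∀ {F} → F ∈ sets 𝓕 → F ∈ R ++ map proj₁ ps
    incl F∈ with complete F∈
    ... | inj₁ F∈R       = ∈-++⁺ˡ F∈R
    ... | inj₂ (A , p∈)  = ∈-++⁺ʳ R (∈-map⁺ proj₁ p∈)

  -- Spreading is applied to inclusion of the families `T y`, with the deficit as badness. A member
  -- that contains no set of `T v₀` is exceptional or has its chosen root outside `T v₀`.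
  near-full-family : Σ[ 𝓣 ∈ Family n t ] ¬ HasSunflower s 𝓣 × ∃[ B ] B + (d′ !) * length ps ≤ n ^ d′ * φ ×
    (d′ !) * length (sets 𝓕 ∖ sets 𝓕 [ sets 𝓣 ]) ≤ (d′ !) * length R + suc d′ * B * φ
  near-full-family with spread (allFin n) (subst (0 <_) (sym (length-tabulate {n = n} (λ x → x))) 0<n) d′
    {λ v w → ∀ {A} → A ∈ T v → A ∈ T w} (λ _ A∈ → A∈) (λ u⊆v v⊆w A∈ → v⊆w (u⊆v A∈)) deficit (λ {v} {w} → T-adjacent {v} {w})
  ... | v₀ , bad , bad⇒ , bad≤ = T-family v₀ , T-free v₀ , ∑ vs deficit , deficit-sum , bound
    where
    open ≤-Reasoning
    open DecMembership (_≟ˢ_ {n}) using () renaming (_∈?_ to _∈?ᴸ_)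
    missed? = λ (p : Subset n × Subset n) → ¬? (proj₂ p ∈?ᴸ T v₀)
    missed : List (Subset n × Subset n)
    missed = filter missed? ps
    uncovered = sets 𝓕 ∖ sets 𝓕 [ T v₀ ]
    uncovered≤ : length uncovered ≤ length R + length missed
    uncovered≤ = begin
      length uncovered                      ≤⟨ Unique⇒length≤ (Unique.filter⁺ _ (unique 𝓕)) incl ⟩
      length (R ++ map proj₁ missed)        ≡⟨ length-++ R ⟩
      length R + length (map proj₁ missed)  ≡⟨ cong (length R +_) (length-map proj₁ missed) ⟩
      length R + length missed              ∎
      where
      incl : ∀ {F} → F ∈ uncovered → F ∈ R ++ map proj₁ missed
      incl {F} F∈U with ∈-filter⁻ _ {xs = sets 𝓕} F∈U
      ... | F∈ , F∉ with complete F∈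
      ... | inj₁ F∈R      = ∈-++⁺ˡ F∈R
      ... | inj₂ (A , p∈) = ∈-++⁺ʳ R (∈-map⁺ proj₁ (∈-filter⁺ missed? p∈
              (λ A∈ → F∉ (∈-filter⁺ (λ F → Any.any? (λ B → B ⊆? F) (T v₀)) F∈ (lose A∈ (Root.A⊆F (proj₂ (sound p∈))))))))
    -- For every ordering y of F ∖ A the root A lies in `T y`. If A is not in `T v₀`, the inclusion
    -- of `T y` fails, so all these y have positive `bad y`.
    weight : ∀ {p} → p ∈ ps → 𝟙 (missed? p) * (d′ !) ≤ ∑ vs (λ y → bad y * 𝟙 (rest p ≟ˢ entries y))
    weight {F , A} p∈ with missed? (F , A)
    ... | no  _  = z≤n
    ... | yes A∉ = begin
      1 * (d′ !)                                            ≡⟨ *-identityˡ (d′ !) ⟩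
      d′ !                                                ≤⟨ orderings≥! d′ (F ∩ ∁ A) (size-rest p∈) ⟩
      ∑ vs (λ y → 𝟙 ((F ∩ ∁ A) ≟ˢ entries y))             ≤⟨ ∑-mono vs (λ {y} _ → pointwise y) ⟩
      ∑ vs (λ y → bad y * 𝟙 ((F ∩ ∁ A) ≟ˢ entries y))     ∎
      where
      pointwise : ∀ y → 𝟙 ((F ∩ ∁ A) ≟ˢ entries y) ≤ bad y * 𝟙 ((F ∩ ∁ A) ≟ˢ entries y)
      pointwise y with (F ∩ ∁ A) ≟ˢ entries y
      ... | no  _  = z≤n
      ... | yes eq = ≤-trans (n≢0⇒n>0 (λ bad≡0 → A∉ (proj₂ (bad⇒ y bad≡0) (∈-T⁺ {y = y} p∈ eq)))) (≤-reflexive (sym (*-identityʳ (bad y))))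
    missed≤ : (d′ !) * length missed ≤ suc d′ * ∑ vs deficit * φ
    missed≤ = begin
      (d′ !) * length missed                                         ≡⟨ *-comm (d′ !) (length missed) ⟩
      length missed * (d′ !)                                         ≡⟨ cong (_* (d′ !)) (length-filter-𝟙 missed? ps) ⟩
      ∑ ps (λ p → 𝟙 (missed? p)) * (d′ !)                            ≡⟨ ∑-*ʳ ps (d′ !) _ ⟨
      ∑ ps (λ p → 𝟙 (missed? p) * (d′ !))                            ≤⟨ ∑-mono ps weight ⟩
      ∑ ps (λ p → ∑ vs (λ y → bad y * 𝟙 (rest p ≟ˢ entries y)))    ≡⟨ ∑-swap ps vs _ ⟩
      ∑ vs (λ y → ∑ ps (λ p → bad y * 𝟙 (rest p ≟ˢ entries y)))    ≡⟨ ∑-cong vs (λ {y} _ → trans (∑-*ˡ ps (bad y) _) (cong (bad y *_) (sym (length-T y)))) ⟩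
      ∑ vs (λ y → bad y * length (T y))                            ≤⟨ ∑-mono vs (λ {y} _ → *-monoʳ-≤ (bad y) (T≤φ y)) ⟩
      ∑ vs (λ y → bad y * φ)                                       ≡⟨ ∑-*ʳ vs φ bad ⟩
      ∑ vs bad * φ                                                 ≤⟨ *-monoˡ-≤ φ bad≤ ⟩
      suc d′ * ∑ vs deficit * φ                                    ∎
    bound : (d′ !) * length uncovered ≤ (d′ !) * length R + suc d′ * ∑ vs deficit * φ
    bound = begin
      (d′ !) * length uncovered                               ≤⟨ *-monoʳ-≤ (d′ !) uncovered≤ ⟩
      (d′ !) * (length R + length missed)                     ≡⟨ *-distribˡ-+ (d′ !) (length R) (length missed) ⟩
      (d′ !) * length R + (d′ !) * length missed                ≤⟨ +-monoʳ-≤ ((d′ !) * length R) missed≤ ⟩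
      (d′ !) * length R + suc d′ * ∑ vs deficit * φ           ∎

-- The pairs (D , A) with A ∪ D rooted at A number g, and B measures by how much they fall short of
-- φ for every ordering of a (k − t)-set D.
NearFull : ℕ → ℕ → ℕ → Family n k → List (Subset n) → Set
NearFull {n} {k} s t φ 𝓕 R = Σ[ 𝓣 ∈ Family n t ] ¬ HasSunflower s 𝓣 × ∃[ B ] ∃[ g ]
  size 𝓕 ≤ length R + g × B + ((k ∸ t) !) * g ≤ n ^ (k ∸ t) * φ ×
  ((k ∸ t) !) * length (sets 𝓕 ∖ sets 𝓕 [ sets 𝓣 ]) ≤ ((k ∸ t) !) * length R + suc (k ∸ t) * B * φ

near-full : ∀ {φ} → 0 < n → 2 ≤ s → 1 ≤ t → 2 * t + 1 ≤ k → IsPhi s t φ →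
            (𝓕 : Family n k) → ¬ HasSunflowerWithCoreSize s (t ∸ 1) 𝓕 → (R : List (Subset n)) →
            (∀ {F} → F ∈ sets 𝓕 → F ∈ R ⊎ ∃[ A ] Root (s * k) t (sets 𝓕) F A) → NearFull s t φ 𝓕 R
near-full {n} {s} {t} {k} {φ} 0<n 2≤s 1≤t 2t+1≤k isPhi 𝓕 free R cover = package (collect (sets 𝓕) (unique 𝓕) cover)
  where
  package : (∃[ ps ] (∀ {F A} → (F , A) ∈ ps → F ∈ sets 𝓕 × Root (s * k) t (sets 𝓕) F A) × Unique (map proj₁ ps) ×
            (∀ {F} → F ∈ sets 𝓕 → F ∈ R ⊎ ∃[ A ] (F , A) ∈ ps)) → NearFull s t φ 𝓕 R
  package (ps , sound , uniq-ps , complete) = count (near-full-family 0<n 2≤s 1≤t 2t+1≤k isPhi 𝓕 free {R} ps sound uniq-ps complete)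
    where
    count : (Σ[ 𝓣 ∈ Family n t ] ¬ HasSunflower s 𝓣 × ∃[ B ] B + ((k ∸ t) !) * length ps ≤ n ^ (k ∸ t) * φ ×
            ((k ∸ t) !) * length (sets 𝓕 ∖ sets 𝓕 [ sets 𝓣 ]) ≤ ((k ∸ t) !) * length R + suc (k ∸ t) * B * φ) → NearFull s t φ 𝓕 R
    count (𝓣 , 𝓣-free , B , full , uncovered) = 𝓣 , 𝓣-free , B , length ps ,
      size≤ 0<n 2≤s 1≤t 2t+1≤k isPhi 𝓕 free {R} ps sound uniq-ps complete , full , uncovered

-- Estimates for binomial coefficients

k!*nCk≡nP′k : ∀ {n k} → k ≤ n → (k !) * (n C k) ≡ n ℘′ k
k!*nCk≡nP′k {n} {k} k≤n = begin
  (k !) * (n C k)                         ≡⟨ cong ((k !) *_) (nCk≡nPk/k! k≤n) ⟩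
  (k !) * ((n ℘ k) ℕ./ (k !)) {{k !≢0}}   ≡⟨ cong (λ z → (k !) * (z ℕ./ (k !)) {{k !≢0}}) nPk≡ ⟩
  (k !) * ((n ℘′ k) ℕ./ (k !)) {{k !≢0}}  ≡⟨ m*[n/m]≡n {{k !≢0}} (k!∣nP′k k≤n) ⟩
  n ℘′ k                                  ∎
  where
  open ≡-Reasoning
  nPk≡ : n ℘ k ≡ n ℘′ k
  nPk≡ = trans (nPk≡n!/[n∸k]! k≤n) (sym (nP′k≡n!/[n∸k]! k≤n))

nP′k≤n^k : ∀ n k → n ℘′ k ≤ n ^ k
nP′k≤n^k n zero    = ≤-refl
nP′k≤n^k n (suc k) = *-mono-≤ (m∸n≤m n k) (nP′k≤n^k n k)

[n∸m]^k≤nP′k : ∀ n {m} k → k ≤ m → (n ∸ m) ^ k ≤ n ℘′ k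
[n∸m]^k≤nP′k n zero    _    = ≤-refl
[n∸m]^k≤nP′k n (suc k) k<m = *-mono-≤ (∸-monoʳ-≤ n (<⇒≤ k<m)) ([n∸m]^k≤nP′k n k (<⇒≤ k<m))

-- Bernoulli's inequality in homogeneous form. Truncated subtraction does no harm, as n ≤ m + (n ∸
-- m) always.
shifted-power : ∀ n m e → n ^ suc e ≤ (n ∸ m) ^ suc e + suc e * m * n ^ e
shifted-power n m zero = begin
  n * 1                          ≤⟨ *-monoˡ-≤ 1 (≤-trans (m≤n+m∸n n m) (≤-reflexive (+-comm m (n ∸ m)))) ⟩
  (n ∸ m + m) * 1                ≡⟨ *-distribʳ-+ 1 (n ∸ m) m ⟩
  (n ∸ m) * 1 + m * 1            ≡⟨ cong (λ z → (n ∸ m) * 1 + z * 1) (sym (+-identityʳ m)) ⟩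
  (n ∸ m) * 1 + (m + 0) * 1      ∎
  where open ≤-Reasoning
shifted-power n m (suc e) = begin
  n * n ^ suc e                                                    ≤⟨ *-monoʳ-≤ n (shifted-power n m e) ⟩
  n * ((n ∸ m) ^ suc e + suc e * m * n ^ e)                        ≡⟨ expandˡ n ((n ∸ m) ^ suc e) (suc e * m) (n ^ e) ⟩
  n * (n ∸ m) ^ suc e + suc e * m * n ^ suc e                      ≤⟨ +-monoˡ-≤ _ (*-monoˡ-≤ ((n ∸ m) ^ suc e) (m≤n+m∸n n m)) ⟩
  (m + (n ∸ m)) * (n ∸ m) ^ suc e + suc e * m * n ^ suc e          ≡⟨ cong (_+ suc e * m * n ^ suc e) (*-distribʳ-+ ((n ∸ m) ^ suc e) m (n ∸ m)) ⟩
  m * (n ∸ m) ^ suc e + (n ∸ m) ^ suc (suc e) + suc e * m * n ^ suc e ≤⟨ +-monoˡ-≤ _ (+-monoˡ-≤ _ (*-monoʳ-≤ m (^-monoˡ-≤ (suc e) (m∸n≤m n m)))) ⟩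
  m * n ^ suc e + (n ∸ m) ^ suc (suc e) + suc e * m * n ^ suc e    ≡⟨ collectˡ m (n ^ suc e) ((n ∸ m) ^ suc (suc e)) (suc e) ⟩
  (n ∸ m) ^ suc (suc e) + suc (suc e) * m * n ^ suc e              ∎
  where
  open ≤-Reasoning
  open ℕ-Solver.+-*-Solver
  expandˡ : ∀ n x y z → n * (x + y * z) ≡ n * x + y * (n * z)
  expandˡ = solve 4 (λ n x y z → n :* (x :+ y :* z) := n :* x :+ y :* (n :* z)) refl
  collectˡ : ∀ m x y e → m * x + y + e * m * x ≡ y + suc e * m * x
  collectˡ = solve 4 (λ m x y e → m :* x :+ y :+ e :* m :* x := y :+ (con 1 :+ e) :* m :* x) refl

module _ {n k t e : ℕ} (k≡ : k ≡ t + suc e) (2k²≤n : 2 * (k * k) ≤ n) where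

  private
    open ≤-Reasoning
    d D q b b′ K : ℕ
    d  = suc e
    D  = d !
    q  = n ^ e
    b  = n C d
    b′ = (n ∸ t) C d
    K  = d * k

    d≤k : d ≤ k
    d≤k = subst (d ≤_) (sym k≡) (m≤n+m d t)

    k≤n : k ≤ n
    k≤n = begin
      k            ≡⟨ *-identityʳ k ⟨
      k * 1        ≤⟨ *-monoʳ-≤ k (≤-trans (s≤s z≤n) d≤k) ⟩
      k * k        ≤⟨ m≤m+n (k * k) _ ⟩
      2 * (k * k)  ≤⟨ 2k²≤n ⟩
      n            ∎

    d≤n∸t : d ≤ n ∸ t
    d≤n∸t = ≤-trans (≤-reflexive (sym (trans (cong (_∸ t) k≡) (m+n∸m≡n t d)))) (∸-monoˡ-≤ t k≤n)

    0<D : 0 < D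
    0<D = 1≤n! d

  power≤C : n ^ d ≤ D * b + K * q
  power≤C = begin
    n ^ d                          ≤⟨ shifted-power n k e ⟩
    (n ∸ k) ^ d + K * q            ≤⟨ +-monoˡ-≤ (K * q) ([n∸m]^k≤nP′k n d d≤k) ⟩
    n ℘′ d + K * q                 ≡⟨ cong (_+ K * q) (k!*nCk≡nP′k (≤-trans d≤k k≤n)) ⟨
    D * b + K * q                  ∎

  -- The loss K · q in Bernoulli's inequality is at most half of n · q, since K = d · k ≤ k². This
  -- is the origin of the threshold 2k².
  power≤2C′ : n * q ≤ 2 * (D * b′)
  power≤2C′ = +-cancelʳ-≤ (n * q) (n * q) (2 * (D * b′)) (begin
    n * q + n * q                              ≡⟨ cong (n * q +_) (+-identityʳ (n * q)) ⟨
    2 * (n ^ d)                                ≤⟨ *-monoʳ-≤ 2 (shifted-power n k e) ⟩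
    2 * ((n ∸ k) ^ d + K * q)                  ≡⟨ *-distribˡ-+ 2 ((n ∸ k) ^ d) (K * q) ⟩
    2 * (n ∸ k) ^ d + 2 * (K * q)              ≤⟨ +-mono-≤ (*-monoʳ-≤ 2 x≤) 2Kq≤ ⟩
    2 * (D * b′) + n * q                       ∎)
    where
    x≤ : (n ∸ k) ^ d ≤ D * b′
    x≤ = begin
      (n ∸ k) ^ d         ≡⟨ cong (λ z → (n ∸ z) ^ d) k≡ ⟩
      (n ∸ (t + d)) ^ d   ≡⟨ cong (_^ d) (∸-+-assoc n t d) ⟨
      (n ∸ t ∸ d) ^ d     ≤⟨ [n∸m]^k≤nP′k (n ∸ t) d ≤-refl ⟩
      (n ∸ t) ℘′ d        ≡⟨ k!*nCk≡nP′k d≤n∸t ⟨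
      D * b′              ∎
    2Kq≤ : 2 * (K * q) ≤ n * q
    2Kq≤ = begin
      2 * (K * q)         ≡⟨ *-assoc 2 K q ⟨
      2 * K * q           ≤⟨ *-monoˡ-≤ q (*-monoʳ-≤ 2 (*-monoˡ-≤ k d≤k)) ⟩
      2 * (k * k) * q     ≤⟨ *-monoˡ-≤ q 2k²≤n ⟩
      n * q               ∎

  C≤2C′ : b ≤ 2 * b′
  C≤2C′ = *-cancelˡ-≤ D {{>-nonZero 0<D}} (begin
    D * b              ≡⟨ k!*nCk≡nP′k (≤-trans d≤k k≤n) ⟩
    n ℘′ d             ≤⟨ nP′k≤n^k n d ⟩
    n * q              ≤⟨ power≤2C′ ⟩
    2 * (D * b′)       ≡⟨ x∙yz≈y∙xz 2 D b′ ⟩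
    D * (2 * b′)       ∎)

-- The first N counts the exceptional members themselves. In the last factor, D · N is the shortfall
-- that they cause in the number of pairs, and K · Φ comes from comparing n^d with d! (n C d).
error-constant : ℕ → ℕ → ℕ → ℕ → ℕ → ℕ
error-constant N Φ d D K = N + suc d * Φ * (D * N + K * Φ)

-- Eliminates B and g: few pairs are missing because z ≤ r + g, so B is at most D times the
-- shortfall φ · b ∸ z plus a multiple of q; this is inserted into the bound for U and D is
-- cancelled.
combine-bounds : ∀ {B D g nᵈ φ U r d z N q b K Φ} → 0 < D →
  B + D * g ≤ nᵈ * φ → D * U ≤ D * r + suc d * B * φ → z ≤ r + g → r ≤ N * q →
  nᵈ ≤ D * b + K * q → φ ≤ Φ →
  U ≤ suc d * φ * (φ * b ∸ z) + error-constant N Φ d D K * q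
combine-bounds {B} {D} {g} {nᵈ} {φ} {U} {r} {d} {z} {N} {q} {b} {K} {Φ} 0<D full uncovered z≤ r≤ nᵈ≤ φ≤ =
  *-cancelˡ-≤ D {{>-nonZero 0<D}} (begin
    D * U                                                                   ≤⟨ uncovered ⟩
    D * r + suc d * B * φ                                                   ≤⟨ +-mono-≤ (*-monoʳ-≤ D r≤) (*-monoˡ-≤ φ (*-monoʳ-≤ (suc d) B≤)) ⟩
    D * (N * q) + suc d * (D * X + (D * N + K * Φ) * q) * φ                 ≡⟨ arrange D N q d X (K * Φ) φ ⟩
    D * (suc d * φ * X) + (D * N + suc d * φ * (D * N + K * Φ)) * q         ≤⟨ +-monoʳ-≤ (D * (suc d * φ * X)) (*-monoˡ-≤ q c≤) ⟩
    D * (suc d * φ * X) + D * error-constant N Φ d D K * q                  ≡⟨ factor D (suc d * φ * X) (error-constant N Φ d D K) q ⟩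
    D * (suc d * φ * X + error-constant N Φ d D K * q)                      ∎)
  where
  open ≤-Reasoning
  open ℕ-Solver.+-*-Solver
  X : ℕ
  X = φ * b ∸ z
  arrange : ∀ D N q d X Y φ → D * (N * q) + suc d * (D * X + (D * N + Y) * q) * φ ≡
            D * (suc d * φ * X) + (D * N + suc d * φ * (D * N + Y)) * q
  arrange = solve 7 (λ D N q d X Y φ → D :* (N :* q) :+ (con 1 :+ d) :* (D :* X :+ (D :* N :+ Y) :* q) :* φ :=
            D :* ((con 1 :+ d) :* φ :* X) :+ (D :* N :+ (con 1 :+ d) :* φ :* (D :* N :+ Y)) :* q) refl
  factor : ∀ D x c q → D * x + D * c * q ≡ D * (x + c * q)
  factor = solve 4 (λ D x c q → D :* x :+ D :* c :* q := D :* (x :+ c :* q)) refl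
  c≤ : D * N + suc d * φ * (D * N + K * Φ) ≤ D * error-constant N Φ d D K
  c≤ = begin
    D * N + suc d * φ * (D * N + K * Φ)              ≤⟨ +-monoʳ-≤ (D * N) (*-monoˡ-≤ (D * N + K * Φ) (*-monoʳ-≤ (suc d) φ≤)) ⟩
    -- A crude extra factor D, so that D can be pulled out of the whole coefficient.
    D * N + suc d * Φ * (D * N + K * Φ)              ≤⟨ +-monoʳ-≤ (D * N) (m≤n*m (suc d * Φ * (D * N + K * Φ)) D {{>-nonZero 0<D}}) ⟩
    D * N + D * (suc d * Φ * (D * N + K * Φ))        ≡⟨ *-distribˡ-+ D N _ ⟨
    D * error-constant N Φ d D K                     ∎
  B≤ : B ≤ D * X + (D * N + K * Φ) * q
  B≤ = +-cancelʳ-≤ (D * g) B _ (begin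
    B + D * g                                        ≤⟨ full ⟩
    nᵈ * φ                                           ≤⟨ *-monoˡ-≤ φ nᵈ≤ ⟩
    (D * b + K * q) * φ                              ≡⟨ solve 5 (λ D b K q φ → (D :* b :+ K :* q) :* φ := D :* (φ :* b) :+ K :* φ :* q) refl D b K q φ ⟩
    D * (φ * b) + K * φ * q                          ≤⟨ +-mono-≤ (*-monoʳ-≤ D (m≤n+m∸n (φ * b) z)) (*-monoˡ-≤ q (*-monoʳ-≤ K φ≤)) ⟩
    D * (z + X) + K * Φ * q                          ≤⟨ +-monoˡ-≤ (K * Φ * q) (*-monoʳ-≤ D (+-monoˡ-≤ X (≤-trans z≤ (+-monoˡ-≤ g r≤)))) ⟩
    D * (N * q + g + X) + K * Φ * q                  ≡⟨ solve 6 (λ D N q g X Y → D :* (N :* q :+ g :+ X) :+ Y :* q := (D :* X :+ (D :* N :+ Y) :* q) :+ D :* g) refl D N q g X (K * Φ) ⟩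
    D * X + (D * N + K * Φ) * q + D * g              ∎)

-- The stability bound over the natural numbers

-- A single t-set has no two distinct petals. Positivity allows the factors φ of the final bound to
-- be inserted.
IsPhi⇒0<φ : ∀ {φ} → 2 ≤ s → IsPhi s t φ → 0 < φ
IsPhi⇒0<φ {t = t} (s≤s (s≤s _)) isPhi = IsPhi.maximal isPhi t full λ { (b , P∈ , P-sunflower) →
  zero≢suc (IsSunflower.distinct P-sunflower (trans (only (P∈ zero)) (sym (only (P∈ (suc zero)))))) }
  where
  full : Family t t
  full = record { sets = ⊤ˢ ∷ [] ; unique = [] ∷ᵘ [] ; uniform = ∣⊤∣≡n t ∷ [] }
  only : ∀ {F : Subset t} → F ∈ ⊤ˢ ∷ [] → F ≡ ⊤ˢ
  only (here eq) = eq
  zero≢suc : ∀ {m} {i : Fin m} → zero ≢ suc i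
  zero≢suc ()

IsPhi⇒φ≤ : ∀ {φ} → 2 ≤ s → IsPhi s t φ → φ ≤ sunflower-bound s t
IsPhi⇒φ≤ 2≤s isPhi with IsPhi.attained isPhi
... | N , 𝓕 , free , refl = sunflower-free⇒size≤ 2≤s 𝓕 free

-- The factor 2 · d! converts n · n^(d-1) into (n - t) C d.
constant-for : ℕ → ℕ → ℕ → ℕ
constant-for s k t = 2 * ((d !) * error-constant (exceptions s k) (sunflower-bound s t) d (d !) (d * k))
  where
  d : ℕ
  d = k ∸ t

-- Summing over all t ≤ k removes the dependence on t.
stability-constant : ℕ → ℕ → ℕ
stability-constant s k = ∑ (upTo (suc k)) (constant-for s k)

threshold : ℕ → ℕ
threshold k = 2 * (k * k)

-- δ does not occur: the shortfall of 𝓕 is a truncated difference, and `n * Y` replaces a division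
-- by n, so that reals enter only when the hypothesis on ∣ 𝓕 ∣ is used.
stability-ℕ : ∀ {φ} → 2 ≤ s → 1 ≤ t → 2 * t + 1 ≤ k → .{{_ : NonZero n}} → threshold k ≤ n → IsPhi s t φ →
  (𝓕 : Family n k) → ¬ HasSunflowerWithCoreSize s (t ∸ 1) 𝓕 →
  Σ[ 𝓣 ∈ Family n t ] ¬ HasSunflower s 𝓣 × ∃[ Y ]
  length (sets 𝓕 ∖ sets 𝓕 [ sets 𝓣 ]) ≤ k * φ * (φ * (n C (k ∸ t)) ∸ size 𝓕) + Y ×
  n * Y ≤ stability-constant s k * ((n ∸ t) C (k ∸ t)) × n C (k ∸ t) ≤ 2 * ((n ∸ t) C (k ∸ t))
stability-ℕ {s} {t} {k} {n} {φ} 2≤s 1≤t 2t+1≤k n₀≤n isPhi 𝓕 free =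
  let R , R≤ , cover = rooted 2≤s 1≤t 2t+1≤k 𝓕 free
  in bound R R≤ (near-full (>-nonZero⁻¹ n) 2≤s 1≤t 2t+1≤k isPhi 𝓕 free R cover)
  where
  open ≤-Reasoning
  t<k : t < k
  t<k = ≤-trans (≤-reflexive (+-comm 1 t)) (≤-trans (+-monoˡ-≤ 1 (m≤m+n t _)) 2t+1≤k)
  e d : ℕ
  e = k ∸ suc t
  d = k ∸ t
  k∸t≡ : k ∸ t ≡ suc e
  k∸t≡ = +-∸-assoc 1 {k} {suc t} t<k
  k≡ : k ≡ t + suc e
  k≡ = trans (sym (m+[n∸m]≡n (<⇒≤ t<k))) (cong (t +_) k∸t≡)
  -- The factor k of the theorem: spreading costs k - t + 1, which is at most k because t ≥ 1.
  sd≤k : suc d ≤ k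
  sd≤k = ≤-trans (+-monoˡ-≤ d 1≤t) (≤-reflexive (m+[n∸m]≡n (<⇒≤ t<k)))
  c₁ : ℕ
  c₁ = error-constant (exceptions s k) (sunflower-bound s t) d (d !) (d * k)
  b b′ q : ℕ
  b = n C d
  b′ = (n ∸ t) C d
  q = n ^ e
  nq≤ : n * q ≤ 2 * ((d !) * b′)
  nq≤ = subst (λ d → n * q ≤ 2 * ((d !) * ((n ∸ t) C d))) (sym k∸t≡) (power≤2C′ k≡ n₀≤n)
  b≤2b′ : b ≤ 2 * b′
  b≤2b′ = subst (λ d → n C d ≤ 2 * ((n ∸ t) C d)) (sym k∸t≡) (C≤2C′ k≡ n₀≤n)
  power≤ : n ^ d ≤ (d !) * b + d * k * q
  power≤ = subst (λ d → n ^ d ≤ (d !) * (n C d) + d * k * q) (sym k∸t≡) (power≤C k≡ n₀≤n)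
  nY≤ : n * (c₁ * q) ≤ stability-constant s k * b′
  nY≤ = begin
    n * (c₁ * q)                 ≡⟨ x∙yz≈y∙xz n c₁ q ⟩
    c₁ * (n * q)                 ≤⟨ *-monoʳ-≤ c₁ nq≤ ⟩
    c₁ * (2 * ((d !) * b′))      ≡⟨ solve 3 (λ c D b → c :* (con 2 :* (D :* b)) := con 2 :* (D :* c) :* b) refl c₁ (d !) b′ ⟩
    constant-for s k t * b′          ≤⟨ *-monoˡ-≤ b′ (∑-∈ (constant-for s k) (∈-upTo⁺ (m≤n⇒m≤1+n t<k))) ⟩
    stability-constant s k * b′                  ∎
    where
    open ℕ-Solver.+-*-Solver
  U≤ : ∀ {B g U r} → size 𝓕 ≤ r + g → B + (d !) * g ≤ n ^ d * φ → (d !) * U ≤ (d !) * r + suc d * B * φ →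
       r ≤ exceptions s k * q → U ≤ k * φ * (φ * b ∸ size 𝓕) + c₁ * q
  U≤ {B} {g} {U} {r} size≤ full uncovered r≤ = begin
    U                                            ≤⟨ combine-bounds {B} {d !} {g} {n ^ d} {φ} {U} {r} {d} {size 𝓕} {exceptions s k} {q} {b} {d * k} {sunflower-bound s t}
                                                      (1≤n! d) full uncovered size≤ r≤ power≤ (IsPhi⇒φ≤ 2≤s isPhi) ⟩
    suc d * φ * (φ * b ∸ size 𝓕) + c₁ * q        ≤⟨ +-monoˡ-≤ (c₁ * q) (*-monoˡ-≤ (φ * b ∸ size 𝓕) (*-monoˡ-≤ φ sd≤k)) ⟩
    k * φ * (φ * b ∸ size 𝓕) + c₁ * q            ∎
  bound : ∀ R → length R ≤ exceptions s k * q → NearFull s t φ 𝓕 R →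
    Σ[ 𝓣 ∈ Family n t ] ¬ HasSunflower s 𝓣 × ∃[ Y ]
    length (sets 𝓕 ∖ sets 𝓕 [ sets 𝓣 ]) ≤ k * φ * (φ * b ∸ size 𝓕) + Y ×
    n * Y ≤ stability-constant s k * b′ × b ≤ 2 * b′
  bound R R≤ (𝓣 , 𝓣-free , B , g , size≤ , full , uncovered) =
    𝓣 , 𝓣-free , c₁ * q , U≤ {B} {g} {_} {length R} size≤ full uncovered R≤ , nY≤ , b≤2b′

-- Natural numbers as rationals

ι : ℕ → ℚ
ι n = pos n ℚ./ 1

ι-+ : ∀ a b → ι (a + b) ≡ ι a ℚ.+ ι b
ι-+ a b = ℚ.toℚᵘ-injective (begin
  ℚ.toℚᵘ (ι (a + b))                     ≈⟨ ℚ.toℚᵘ-fromℚᵘ (mkℚᵘ (pos (a + b)) 0) ⟩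
  mkℚᵘ (pos (a + b)) 0                     ≈⟨ *≡* (cong (ℤ._* pos 1) (cong₂ ℤ._+_ (sym (ℤ.*-identityʳ (pos a))) (sym (ℤ.*-identityʳ (pos b))))) ⟩
  mkℚᵘ (pos a) 0 ℚᵘ.+ mkℚᵘ (pos b) 0         ≈⟨ ℚᵘ.+-cong (ℚ.toℚᵘ-fromℚᵘ (mkℚᵘ (pos a) 0)) (ℚ.toℚᵘ-fromℚᵘ (mkℚᵘ (pos b) 0)) ⟨
  ℚ.toℚᵘ (ι a) ℚᵘ.+ ℚ.toℚᵘ (ι b)         ≈⟨ ℚ.toℚᵘ-homo-+ (ι a) (ι b) ⟨
  ℚ.toℚᵘ (ι a ℚ.+ ι b)                   ∎)
  where open ℚᵘ.≃-Reasoning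

ι-* : ∀ a b → ι (a * b) ≡ ι a ℚ.* ι b
ι-* a b = ℚ.toℚᵘ-injective (begin
  ℚ.toℚᵘ (ι (a * b))                     ≈⟨ ℚ.toℚᵘ-fromℚᵘ (mkℚᵘ (pos (a * b)) 0) ⟩
  mkℚᵘ (pos (a * b)) 0                     ≈⟨ *≡* (cong (ℤ._* pos 1) (ℤ.pos-* a b)) ⟩
  mkℚᵘ (pos a) 0 ℚᵘ.* mkℚᵘ (pos b) 0         ≈⟨ ℚᵘ.*-cong (ℚ.toℚᵘ-fromℚᵘ (mkℚᵘ (pos a) 0)) (ℚ.toℚᵘ-fromℚᵘ (mkℚᵘ (pos b) 0)) ⟨
  ℚ.toℚᵘ (ι a) ℚᵘ.* ℚ.toℚᵘ (ι b)         ≈⟨ ℚ.toℚᵘ-homo-* (ι a) (ι b) ⟨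
  ℚ.toℚᵘ (ι a ℚ.* ι b)                   ∎)
  where open ℚᵘ.≃-Reasoning

ι-nonNeg : ∀ a → ℚ.NonNegative (ι a)
ι-nonNeg a = ℚ.normalize-nonNeg a 1

ι-mono-≤ : ∀ {a b} → a ≤ b → ι a ℚ.≤ ι b
ι-mono-≤ {a} {b} a≤b = begin
  ι a                    ≡⟨ ℚ.+-identityʳ (ι a) ⟨
  ι a ℚ.+ 0ℚ             ≤⟨ ℚ.+-monoʳ-≤ (ι a) (ℚ.nonNegative⁻¹ (ι (b ∸ a)) {{ι-nonNeg (b ∸ a)}}) ⟩
  ι a ℚ.+ ι (b ∸ a)      ≡⟨ ι-+ a (b ∸ a) ⟨
  ι (a + (b ∸ a))        ≡⟨ cong ι (m+[n∸m]≡n a≤b) ⟩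
  ι b                    ∎
  where open ℚ.≤-Reasoning

ι-inverse : ∀ n .{{_ : NonZero n}} → ι n ℚ.* (pos 1 ℚ./ n) ≡ 1ℚ
ι-inverse (suc n) = ℚ.toℚᵘ-injective (begin
  ℚ.toℚᵘ (ι (suc n) ℚ.* (pos 1 ℚ./ suc n))               ≈⟨ ℚ.toℚᵘ-homo-* (ι (suc n)) (pos 1 ℚ./ suc n) ⟩
  ℚ.toℚᵘ (ι (suc n)) ℚᵘ.* ℚ.toℚᵘ (pos 1 ℚ./ suc n)       ≈⟨ ℚᵘ.*-cong (ℚ.toℚᵘ-fromℚᵘ (mkℚᵘ (pos (suc n)) 0)) (ℚ.toℚᵘ-fromℚᵘ (mkℚᵘ (pos 1) n)) ⟩
  mkℚᵘ (pos (suc n)) 0 ℚᵘ.* mkℚᵘ (pos 1) n                   ≈⟨ *≡* (trans (ℤ.*-identityʳ _) (trans (ℤ.*-identityʳ (pos (suc n))) (sym (trans (ℤ.*-identityˡ _) (cong (λ m → pos (suc m)) (+-identityʳ n)))))) ⟩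
  ℚ.toℚᵘ 1ℚ                                            ∎)
  where open ℚᵘ.≃-Reasoning

-- From the bound over ℕ to the bound over ℝ

reciprocal-positive : ∀ n .{{_ : NonZero n}} → ℚ.Positive (pos 1 ℚ./ n)
reciprocal-positive n = ℚ.normalize-pos 1 n

-- The comparison of the two binomial coefficients contributes 2; then 2 ≤ 3 and φ ≥ 1 lead to the
-- constant of the theorem.
main-term : ∀ k {φ b b′} → 0 < φ → b ≤ 2 * b′ → k * φ * (φ * b) ≤ 3 * k * φ ^ 2 * (φ * b′)
main-term k {φ} {b} {b′} 0<φ b≤2b′ = begin
  k * φ * (φ * b)               ≤⟨ *-monoʳ-≤ (k * φ) (*-monoʳ-≤ φ b≤2b′) ⟩
  k * φ * (φ * (2 * b′))        ≡⟨ solve 3 (λ k φ b → k :* φ :* (φ :* (con 2 :* b)) := con 2 :* (k :* φ :* φ :* b)) refl k φ b′ ⟩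
  2 * (k * φ * φ * b′)          ≤⟨ *-monoˡ-≤ (k * φ * φ * b′) {2} {3} (s≤s (s≤s z≤n)) ⟩
  3 * (k * φ * φ * b′)          ≤⟨ m≤m*n (3 * (k * φ * φ * b′)) φ {{>-nonZero 0<φ}} ⟩
  3 * (k * φ * φ * b′) * φ      ≡⟨ solve 3 (λ k φ b → con 3 :* (k :* φ :* φ :* b) :* φ := con 3 :* k :* φ :^ 2 :* (φ :* b)) refl k φ b′ ⟩
  3 * k * φ ^ 2 * (φ * b′)      ∎
  where
  open ≤-Reasoning
  open ℕ-Solver.+-*-Solver

module _ {k φ z U Y c n : ℕ} {b b′ : ℕ} .{{_ : NonZero n}} (0<φ : 0 < φ)
         (U≤ : U ≤ k * φ * (φ * b ∸ z) + Y) (nY≤ : n * Y ≤ c * b′) (b≤2b′ : b ≤ 2 * b′) where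

  private
    open ℚ.≤-Reasoning
    open ℚ-Solver.+-*-Solver

    w : ℚ
    w = pos 1 ℚ./ n

    error-term : ι Y ℚ.≤ ι c ℚ.* w ℚ.* ι φ ℚ.* ι b′
    error-term = begin
      ι Y                              ≡⟨ ℚ.*-identityˡ (ι Y) ⟨
      1ℚ ℚ.* ι Y                       ≡⟨ cong (ℚ._* ι Y) (ι-inverse n) ⟨
      ι n ℚ.* w ℚ.* ι Y                ≡⟨ solve 3 (λ n w y → n :* w :* y := w :* (n :* y)) refl (ι n) w (ι Y) ⟩
      w ℚ.* (ι n ℚ.* ι Y)              ≡⟨ cong (w ℚ.*_) (ι-* n Y) ⟨
      w ℚ.* ι (n * Y)                  ≤⟨ ℚ.*-monoˡ-≤-nonNeg w {{ℚ.pos⇒nonNeg w {{reciprocal-positive n}}}} (ι-mono-≤ (≤-trans nY≤ (m≤m*n (c * b′) φ {{>-nonZero 0<φ}}))) ⟩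
      w ℚ.* ι (c * b′ * φ)             ≡⟨ cong (w ℚ.*_) (trans (ι-* (c * b′) φ) (cong (ℚ._* ι φ) (ι-* c b′))) ⟩
      w ℚ.* (ι c ℚ.* ι b′ ℚ.* ι φ)     ≡⟨ solve 4 (λ w c b φ → w :* (c :* b :* φ) := c :* w :* φ :* b) refl w (ι c) (ι b′) (ι φ) ⟩
      ι c ℚ.* w ℚ.* ι φ ℚ.* ι b′       ∎

  module _ {x ε ε′ : ℚ} (0≤x : 0ℚ ℚ.≤ x) (0≤ε′ : 0ℚ ℚ.≤ ε′) (ε′≤ : ι (k * φ) ℚ.* ε′ ℚ.≤ ε)
           (large : (1ℚ ℚ.+ ℚ.- 1ℚ ℚ.* x) ℚ.* ι φ ℚ.* ι b ℚ.≤ ι z ℚ.+ ε′) where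

    private
      p X : ℚ
      p = ι φ ℚ.* ι b
      X = ι (φ * b ∸ z)

      x≥0 : ℚ.NonNegative x
      x≥0 = ℚ.nonNegative 0≤x

      -- When 𝓕 has at least φ · b members the truncated difference is 0, and the claim rests on x
      -- being nonnegative; otherwise it is the hypothesis rearranged.
      X≤ : X ℚ.≤ x ℚ.* p ℚ.+ ε′
      X≤ with ≤-total z (φ * b)
      ... | inj₁ z≤φb = begin
        X                                          ≡⟨ solve 2 (λ X z → X := X :+ z :- z) refl X (ι z) ⟩
        X ℚ.+ ι z ℚ.- ι z                          ≡⟨ cong (ℚ._- ι z) (trans (sym (ι-+ (φ * b ∸ z) z)) (trans (cong ι (m∸n+n≡m z≤φb)) (ι-* φ b))) ⟩
        p ℚ.- ι z                                  ≡⟨ solve 4 (λ x f b z → f :* b :- z := (con 1ℚ :+ (:- con 1ℚ) :* x) :* f :* b :+ (x :* (f :* b) :- z)) refl x (ι φ) (ι b) (ι z) ⟩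
        (1ℚ ℚ.+ ℚ.- 1ℚ ℚ.* x) ℚ.* ι φ ℚ.* ι b ℚ.+ (x ℚ.* p ℚ.- ι z) ≤⟨ ℚ.+-monoˡ-≤ (x ℚ.* p ℚ.- ι z) large ⟩
        ι z ℚ.+ ε′ ℚ.+ (x ℚ.* p ℚ.- ι z)           ≡⟨ solve 3 (λ z e y → z :+ e :+ (y :- z) := y :+ e) refl (ι z) ε′ (x ℚ.* p) ⟩
        x ℚ.* p ℚ.+ ε′                             ∎
      ... | inj₂ φb≤z = begin
        X                                          ≡⟨ cong ι (m≤n⇒m∸n≡0 φb≤z) ⟩
        0ℚ                                         ≡⟨ ℚ.*-zeroʳ x ⟨
        x ℚ.* 0ℚ                                   ≤⟨ ℚ.*-monoˡ-≤-nonNeg x {{x≥0}} (ℚ.nonNegative⁻¹ p {{ℚ.nonNeg*nonNeg⇒nonNeg (ι φ) {{ι-nonNeg φ}} (ι b) {{ι-nonNeg b}}}}) ⟩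
        x ℚ.* p                                    ≡⟨ ℚ.+-identityʳ (x ℚ.* p) ⟨
        x ℚ.* p ℚ.+ 0ℚ                             ≤⟨ ℚ.+-monoʳ-≤ (x ℚ.* p) 0≤ε′ ⟩
        x ℚ.* p ℚ.+ ε′                             ∎

    rational-bound : ι U ℚ.≤ (ι (3 * k * φ ^ 2) ℚ.* x ℚ.+ ι c ℚ.* w) ℚ.* ι φ ℚ.* ι b′ ℚ.+ ε
    rational-bound = begin
      ι U
        ≤⟨ ι-mono-≤ U≤ ⟩
      ι (k * φ * (φ * b ∸ z) + Y)
        ≡⟨ trans (ι-+ (k * φ * (φ * b ∸ z)) Y) (cong (ℚ._+ ι Y) (ι-* (k * φ) (φ * b ∸ z))) ⟩
      ι (k * φ) ℚ.* X ℚ.+ ι Y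
        ≤⟨ ℚ.+-mono-≤ (ℚ.*-monoˡ-≤-nonNeg (ι (k * φ)) {{ι-nonNeg (k * φ)}} X≤) error-term ⟩
      ι (k * φ) ℚ.* (x ℚ.* p ℚ.+ ε′) ℚ.+ ι c ℚ.* w ℚ.* ι φ ℚ.* ι b′
        ≡⟨ solve 5 (λ κ x p e r → κ :* (x :* p :+ e) :+ r := x :* (κ :* p) :+ κ :* e :+ r) refl (ι (k * φ)) x p ε′ (ι c ℚ.* w ℚ.* ι φ ℚ.* ι b′) ⟩
      x ℚ.* (ι (k * φ) ℚ.* p) ℚ.+ ι (k * φ) ℚ.* ε′ ℚ.+ ι c ℚ.* w ℚ.* ι φ ℚ.* ι b′
        ≡⟨ cong (λ y → x ℚ.* y ℚ.+ ι (k * φ) ℚ.* ε′ ℚ.+ ι c ℚ.* w ℚ.* ι φ ℚ.* ι b′) (trans (ι-* (k * φ) (φ * b)) (cong (ι (k * φ) ℚ.*_) (ι-* φ b))) ⟨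
      x ℚ.* ι (k * φ * (φ * b)) ℚ.+ ι (k * φ) ℚ.* ε′ ℚ.+ ι c ℚ.* w ℚ.* ι φ ℚ.* ι b′
        ≤⟨ ℚ.+-monoˡ-≤ (ι c ℚ.* w ℚ.* ι φ ℚ.* ι b′) (ℚ.+-mono-≤ (ℚ.*-monoˡ-≤-nonNeg x {{x≥0}} (ι-mono-≤ (main-term k 0<φ b≤2b′))) ε′≤) ⟩
      x ℚ.* ι (3 * k * φ ^ 2 * (φ * b′)) ℚ.+ ε ℚ.+ ι c ℚ.* w ℚ.* ι φ ℚ.* ι b′
        ≡⟨ cong (λ y → x ℚ.* y ℚ.+ ε ℚ.+ ι c ℚ.* w ℚ.* ι φ ℚ.* ι b′) (trans (ι-* (3 * k * φ ^ 2) (φ * b′)) (cong (ι (3 * k * φ ^ 2) ℚ.*_) (ι-* φ b′))) ⟩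
      x ℚ.* (ι (3 * k * φ ^ 2) ℚ.* (ι φ ℚ.* ι b′)) ℚ.+ ε ℚ.+ ι c ℚ.* w ℚ.* ι φ ℚ.* ι b′
        ≡⟨ solve 7 (λ x a f b e c w → x :* (a :* (f :* b)) :+ e :+ c :* w :* f :* b := (a :* x :+ c :* w) :* f :* b :+ e) refl x (ι (3 * k * φ ^ 2)) (ι φ) (ι b′) ε (ι c) w ⟩
      (ι (3 * k * φ ^ 2) ℚ.* x ℚ.+ ι c ℚ.* w) ℚ.* ι φ ℚ.* ι b′ ℚ.+ ε ∎

  real-bound : (δ : ℝ) → fromℕ 0 <ᵣ δ → (fromℕ 1 -ᵣ δ) *ᵣ fromℕ φ *ᵣ fromℕ b ≤ᵣ fromℕ z →
               fromℕ U ≤ᵣ (fromℕ (3 * k * φ ^ 2) *ᵣ δ +ᵣ fromℕ c /ᵣ n) *ᵣ fromℕ φ *ᵣ fromℕ b′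
  real-bound δ (η , 0<η , M , positive) large ε 0<ε = tail (large ε′ 0<ε′)
    where
    κ : ℕ
    κ = k * φ
    v ε′ : ℚ
    -- The hypothesis is used with tolerance ε / (κ + 1), as it gets multiplied by κ = k · φ. The
    -- successor makes the reciprocal exist whatever κ is.
    v = pos 1 ℚ./ suc κ
    ε′ = ε ℚ.* v
    0<ε′ : 0ℚ ℚ.< ε′
    0<ε′ = ℚ.positive⁻¹ ε′ {{ℚ.pos*pos⇒pos ε {{ℚ.positive 0<ε}} v {{reciprocal-positive (suc κ)}}}}
    ε′≤ : ι κ ℚ.* ε′ ℚ.≤ ε
    ε′≤ = begin
      ι κ ℚ.* ε′                 ≤⟨ ℚ.*-monoʳ-≤-nonNeg ε′ {{ℚ.nonNegative (ℚ.<⇒≤ 0<ε′)}} (ι-mono-≤ (n≤1+n κ)) ⟩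
      ι (suc κ) ℚ.* (ε ℚ.* v)    ≡⟨ solve 3 (λ κ e v → κ :* (e :* v) := e :* (κ :* v)) refl (ι (suc κ)) ε v ⟩
      ε ℚ.* (ι (suc κ) ℚ.* v)    ≡⟨ cong (ε ℚ.*_) (ι-inverse (suc κ)) ⟩
      ε ℚ.* 1ℚ                   ≡⟨ ℚ.*-identityʳ ε ⟩
      ε                          ∎
    tail : (∃[ N ] ∀ m → N ≤ m → seq ((fromℕ 1 -ᵣ δ) *ᵣ fromℕ φ *ᵣ fromℕ b) m ℚ.≤ ι z ℚ.+ ε′) →
           ∃[ N ] ∀ m → N ≤ m → ι U ℚ.≤ seq ((fromℕ (3 * k * φ ^ 2) *ᵣ δ +ᵣ fromℕ c /ᵣ n) *ᵣ fromℕ φ *ᵣ fromℕ b′) m ℚ.+ ε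
    -- From N on the hypothesis holds up to ε′, from M on the terms of δ are nonnegative; the
    -- rational bound needs both at the same index.
    tail (N , large-tail) = N ⊔ M , λ m N⊔M≤m →
      rational-bound {seq δ m} {ε} {ε′} (0≤δ m (m⊔n≤o⇒n≤o N M N⊔M≤m)) (ℚ.<⇒≤ 0<ε′) ε′≤ (large-tail m (m⊔n≤o⇒m≤o N M N⊔M≤m))
      where
      0≤δ : ∀ m → M ≤ m → 0ℚ ℚ.≤ seq δ m
      0≤δ m M≤m = ℚ.≤-trans (ℚ.<⇒≤ (subst (0ℚ ℚ.<_) (sym (ℚ.+-identityˡ η)) 0<η)) (positive m M≤m)

theorem1p3 : ∀ (s k : ℕ) → 2 ≤ s →
    Σ[ c ∈ ℝ ] ∃[ n₀ ]
    (∀ (t : ℕ) → 1 ≤ t → 2 * t + 1 ≤ k →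
    ∀ (n : ℕ) .{{_ : NonZero n}} → n₀ ≤ n →
    ∀ (δ : ℝ) → fromℕ 0 <ᵣ δ →
    ∀ (φ : ℕ) → IsPhi s t φ →
    ∀ (𝓕 : Family n k) → ¬ HasSunflowerWithCoreSize s (t ∸ 1) 𝓕 →
    (fromℕ 1 -ᵣ δ) *ᵣ fromℕ φ *ᵣ fromℕ (n C (k ∸ t)) ≤ᵣ fromℕ (size 𝓕) →
    Σ[ 𝓣 ∈ Family n t ]
    ¬ HasSunflower s 𝓣 ×
    fromℕ (length (sets 𝓕 ∖ sets 𝓕 [ sets 𝓣 ])) ≤ᵣ
    (fromℕ (3 * k * φ ^ 2) *ᵣ δ +ᵣ c /ᵣ n) *ᵣ fromℕ φ *ᵣ fromℕ ((n ∸ t) C (k ∸ t)))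
theorem1p3 s k 2≤s = fromℕ (stability-constant s k) , threshold k , stable
  where
  stable : ∀ t → 1 ≤ t → 2 * t + 1 ≤ k → ∀ n .{{_ : NonZero n}} → threshold k ≤ n → ∀ δ → fromℕ 0 <ᵣ δ → ∀ φ → IsPhi s t φ →
           (𝓕 : Family n k) → ¬ HasSunflowerWithCoreSize s (t ∸ 1) 𝓕 →
           (fromℕ 1 -ᵣ δ) *ᵣ fromℕ φ *ᵣ fromℕ (n C (k ∸ t)) ≤ᵣ fromℕ (size 𝓕) →
           Σ[ 𝓣 ∈ Family n t ] ¬ HasSunflower s 𝓣 ×
           fromℕ (length (sets 𝓕 ∖ sets 𝓕 [ sets 𝓣 ])) ≤ᵣ
           (fromℕ (3 * k * φ ^ 2) *ᵣ δ +ᵣ fromℕ (stability-constant s k) /ᵣ n) *ᵣ fromℕ φ *ᵣ fromℕ ((n ∸ t) C (k ∸ t))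
  stable t 1≤t 2t+1≤k n n₀≤n δ 0<δ φ isPhi 𝓕 free large =
    let 𝓣 , 𝓣-free , Y , U≤ , nY≤ , b≤2b′ = stability-ℕ 2≤s 1≤t 2t+1≤k n₀≤n isPhi 𝓕 free
    in 𝓣 , 𝓣-free , real-bound {k} {φ} {size 𝓕} {Y = Y} {c = stability-constant s k} {n} (IsPhi⇒0<φ 2≤s isPhi) U≤ nY≤ b≤2b′ δ 0<δ large
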